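{- Let $m>1$ be an odd integer. Then \[ \triangle(q)^{2m^2-2}=\frac{(-1)^{m(m+1)/2}}{m!\left(\prod_{i=1}^{m-1}i!\right)^2}(1-q^m)\sum_{J\subset\{1,\dots,m\}}(-1)^{|J|}\sum_{\substack{\vec k\in\mathbb{Z}^{m-1}\\ (\vec k,-|\vec k|)\in\mathbb{Z}^m_J}}\ \sum_{\vec r\in\mathbb{Z}^m_J} q^{\sum_{j=1}^{m-1}(2k_j-1)r_j-(1+2|\vec k|)r_m-\frac{m^2-1}{4}}\prod_{1\le i<j\le m}(r_i-r_j)^2. \]
   Context: $\triangle(q)=\sum_{n\ge0}q^{n(n+1)/2}$. For $J\subset\{1,\dots,m\}$, $\mathbb{Z}^m_J=\{\vec k=(k_1,\dots,k_m)\in\mathbb{Z}^m : J=\{j: k_j\le 0\}\}$. For $\vec k=(k_1,\dots,k_{m-1})\in\mathbb{Z}^{m-1}$, $|\vec k|=k_1+\cdots+k_{m-1}$, and $(\vec k,-|\vec k|)$ denotes the vector $(k_1,\dots,k_{m-1},-|\vec k|)\in\mathbb{Z}^m$. $\vec r=(r_1,\dots,r_m)$. -}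

module Defs where

open import Data.Bool using (Bool; true; false; if_then_else_; _∧_)
open import Data.Nat as ℕ using (ℕ; zero; suc; _!)
open import Data.Nat.DivMod using (_/_)
open import Data.Integer as ℤ using (ℤ; +_; -_; _+_; _*_; _-_; 0ℤ; 1ℤ; _≤ᵇ_)
open import Data.List as List using (List; []; _∷_; concatMap; map; foldr; upTo)
open import Data.Vec as Vec using (Vec; []; _∷_; _∷ʳ_; init; last)
open import Relation.Nullary.Decidable using (isYes)

Series : Set
Series = ℕ → ℤ

sumℤ : List ℤ → ℤ
sumℤ = foldr _+_ 0ℤ

_⊛_ : Series → Series → Series
(f ⊛ g) n = sumℤ (map (λ i → f i * g (n ℕ.∸ i)) (upTo (suc n)))

one : Series
one zero    = 1ℤ
one (suc _) = 0ℤ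

_^ˢ_ : Series → ℕ → Series
f ^ˢ zero  = one
f ^ˢ suc k = f ⊛ (f ^ˢ k)

-- △(q) = Σ_{n≥0} q^{n(n+1)/2}: the coefficient of q^N is the number of
-- n ≥ 0 with n(n+1)/2 = N (any such n satisfies n ≤ N).
triangle : Series
triangle N = sumℤ (map (λ n → if (n ℕ.* suc n) ℕ.≡ᵇ (2 ℕ.* N) then 1ℤ else 0ℤ)
                       (upTo (suc N)))

coeffℤ : Series → ℤ → ℤ
coeffℤ f (+ n)     = f n
coeffℤ f ℤ.-[1+ _ ] = 0ℤ

range : ℕ → List ℤ
range B = map (λ i → + i - + B) (upTo (suc (2 ℕ.* B)))

box : (n : ℕ) → ℕ → List (Vec ℤ n)
box zero    B = [] ∷ []
box (suc n) B = concatMap (λ x → map (x ∷_) (box n B)) (range B)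

subsets : (m : ℕ) → List (Vec Bool m)
subsets zero    = [] ∷ []
subsets (suc m) = concatMap (λ b → map (b ∷_) (subsets m)) (true ∷ false ∷ [])

card : ∀ {m} → Vec Bool m → ℕ
card []          = 0
card (true ∷ J)  = suc (card J)
card (false ∷ J) = card J

minusOnePow : ℕ → ℤ
minusOnePow zero    = 1ℤ
minusOnePow (suc k) = - minusOnePow k

_==_ : Bool → Bool → Bool
true  == b = b
false == true  = false
false == false = true

inZJ : ∀ {m} → Vec Bool m → Vec ℤ m → Bool
inZJ []      []      = true
inZJ (b ∷ J) (x ∷ v) = (b == (x ≤ᵇ 0ℤ)) ∧ inZJ J v

sumV : ∀ {n} → Vec ℤ n → ℤ
sumV = Vec.foldr _ _+_ 0ℤ

ext : ∀ {n} → Vec ℤ n → Vec ℤ (suc n)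
ext k = k ∷ʳ (- sumV k)

dotPart : ∀ {n} → Vec ℤ n → Vec ℤ n → ℤ
dotPart []      []      = 0ℤ
dotPart (k ∷ ks) (r ∷ rs) = (+ 2 * k - 1ℤ) * r + dotPart ks rs

vdm2 : ∀ {m} → Vec ℤ m → ℤ
vdm2 []       = 1ℤ
vdm2 (x ∷ xs) = Vec.foldr _ (λ y acc → ((x - y) * (x - y)) * acc) 1ℤ xs * vdm2 xs

expo : (n : ℕ) → Vec ℤ n → Vec ℤ (suc n) → ℤ
expo n k r = dotPart k (init r) - (1ℤ + + 2 * sumV k) * last r
             - + ((suc n ℕ.* suc n ℕ.∸ 1) / 4)

-- Coefficient of q^N in the triple sum (over J, k, r), with k and r
-- truncated to the box [-B,B]^{m-1} × [-B,B]^m.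
tripleSumTrunc : ℕ → ℕ → ℤ → ℤ
tripleSumTrunc zero    B N = 0ℤ
tripleSumTrunc (suc n) B N =
  sumℤ (map (λ J →
    minusOnePow (card J) *
    sumℤ (map (λ k →
      sumℤ (map (λ r →
        if inZJ J (ext k) ∧ inZJ J r ∧ isYes (expo n k r ℤ.≟ N)
        then vdm2 r else 0ℤ) (box (suc n) B))) (box n B))) (subsets (suc n)))

-- Coefficient of q^N in (1 - q^m) · (triple sum), truncated to box B.
rhsCoeffTrunc : ℕ → ℕ → ℤ → ℤ
rhsCoeffTrunc m B N = tripleSumTrunc m B N - tripleSumTrunc m B (N - + m)

prodFact : ℕ → ℕ
prodFact m = List.foldr ℕ._*_ 1 (map (λ i → (suc i) !) (upTo (m ℕ.∸ 1)))

{-# OPTIONS --safe #-}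
-- Write m = 2s + 1, let ε(k, r) be 1 if k, r > 0, -1 if k, r ≤ 0 and 0
-- otherwise, and let Δ be the Vandermonde product. The sum over J turns the
-- triple sum into Σ Π ε(kⱼ, rⱼ) q^(Σ (2kⱼ - 1) rⱼ) Δ(r)² over Σ kⱼ = 0.
-- Translating r by 1 multiplies a term by q^(-m) and changes ε only at
-- r = 0. As Δ(r) kills repeated entries, (1 - q^m) leaves only the terms with
-- exactly one rⱼ = 0, that is -m times
--   I = Σ over r ∈ ℤ^(2s) of Δ(0, r)² Π ŵ(rᵢ),  ŵ(r) = q^r / (1 - q^(2r)).
--
-- Expanding Δ², I is a polynomial in the moments 2 Cₗ, Cₗ = Σ r^(2l+1) ŵ(r)
-- over r > 0. Partial fractions give ŵ(a) ŵ(b) as ŵ(a + b) times a sum of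
-- simple Lambert series, whence a quadratic recursion that writes each Cₗ,
-- l ≥ 1, as a homogeneous polynomial in A = 1 + O(q) (weight 2) and
-- C₁ = q + O(q²) (weight 4). So I is homogeneous of weight 4s(s + 1) in A
-- and C₁. Its order in q is at least s(s + 1), because the rᵢ are distinct
-- and nonzero; hence I is a multiple of C₁^(s(s+1)), and the factor is the
-- leading coefficient of I, which comes from the orderings of ±1, …, ±s.
--
-- Finally C₁ = q △⁸: the same convolutions give q d/dq log C₁ = 1 + 8 L with
-- L = Σ (-1)^(r-1) r q^r / (1 - q^r), and q d/dq △ = L △.
module Submission where

open import Defs
open import Algebra using (CommutativeRing)
import Algebra.Solver.Ring as RingSolver
import Algebra.Solver.Ring.AlmostCommutativeRing as ACR
open import Data.Bool using (Bool; true; false; if_then_else_; _∧_)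
open import Data.Bool.Properties using (∧-zeroʳ)
open import Data.Empty using (⊥-elim)
open import Data.Fin as Fin using (Fin)
open import Data.Integer as ℤ using (ℤ; +_; -_; _+_; _*_; _-_; 0ℤ; 1ℤ; -[1+_]; ∣_∣)
import Data.Integer.Properties as ℤₚ
open import Data.Integer.Tactic.RingSolver using (solve-∀)
open import Data.List as List using (List; []; _∷_; map; applyUpTo; upTo; _++_)
import Data.List.Properties as Listₚ
open import Data.List.Membership.Propositional using (_∈_)
open import Data.List.Membership.Propositional.Properties using (∈-∃++; ∈-++⁻; ∈-++⁺ˡ; ∈-++⁺ʳ)
open import Data.List.Relation.Binary.Permutation.Propositional as ↭ using (_↭_; ↭-sym; ↭-trans)
open import Data.List.Relation.Binary.Permutation.Propositional.Properties using (map⁺; shift; shifts; ++⁺ˡ; ++⁺ʳ)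
import Data.List.Relation.Unary.All as ListAll
import Data.List.Relation.Unary.AllPairs as AllPairs
open import Data.List.Relation.Unary.Any using (here; there)
open import Data.List.Relation.Unary.Unique.Propositional using (Unique)
import Data.Maybe as Maybe
open import Data.Nat as ℕ using (ℕ; zero; suc; _<_; _≤_; _%_; _!; z≤n; s≤s; _∸_)
import Data.Nat.DivMod as DivMod
import Data.Nat.Properties as ℕₚ
import Data.Nat.Tactic.RingSolver as ℕS
open import Data.Product using (∃; Σ-syntax; _×_; _,_; proj₁; proj₂)
open import Data.Sum using (_⊎_; inj₁; inj₂)
open import Data.Unit using (tt)
open import Data.Vec as Vec using (Vec; []; _∷_; _∷ʳ_; toList; lookup; updateAt; replicate; allFin)
import Data.Vec.Properties as Vecₚ
open import Data.Vec.Relation.Unary.All using (All; []; _∷_)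
open import Function using (_∘_; id)
open import Level using (0ℓ)
open import Relation.Binary.PropositionalEquality
open import Relation.Nullary using (¬_; yes; no)
open import Relation.Nullary.Decidable using (dec⇒maybe; isYes)

open ≡-Reasoning

-- `C 0` and `Y` are only quasimodular; the combination `A` = 2 E₂(q²) - E₂(q) is what has weight 2.
-- Homogeneity thus hinges on `C 0` never occurring outside `A`. In I this holds because Δ(0, r)²
-- contains every rᵢ², so the moments start at order 2 and the odd ones at order 3; in the
-- recursion, because the double sum left over after `A` is formed carries a factor a³ b³.
--
-- q d/dq △ = L △ is the logarithmic derivative of the product formula for △. It is derived from the
-- series itself: n q^(n(n+1)/2) is expanded into a sum over r with denominators 1 - q^r, and the
-- sums over n and r are exchanged.
--
-- The finite boxes are the other obstacle. They bound r and the first m - 1 entries of k, while the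
-- last entry of k is minus the sum of the others, so the m coordinates do not enter symmetrically.
-- That all positions of the zero of r contribute equally therefore needs a reflection inside the
-- box for k; it loses nothing because the exponent of a nonzero term bounds the entries involved.

infixr 5 _⟨+⟩_ _⟨*⟩_

_⟨+⟩_ : ∀ x {y z} → y ≡ z → x + y ≡ x + z
x ⟨+⟩ refl = refl

_⟨*⟩_ : ∀ x {y z} → y ≡ z → x * y ≡ x * z
x ⟨*⟩ refl = refl

-- Finite sums of integers

Σ : ℕ → (ℕ → ℤ) → ℤ
Σ zero    f = 0ℤ
Σ (suc n) f = f 0 + Σ n (f ∘ suc)

Σ-cong< : ∀ n {f g : ℕ → ℤ} → (∀ i → i < n → f i ≡ g i) → Σ n f ≡ Σ n g
Σ-cong< zero    e = refl
Σ-cong< (suc n) e = cong₂ _+_ (e 0 (s≤s z≤n)) (Σ-cong< n λ i i<n → e (suc i) (s≤s i<n))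

Σ-cong : ∀ n {f g : ℕ → ℤ} → (∀ i → f i ≡ g i) → Σ n f ≡ Σ n g
Σ-cong n e = Σ-cong< n λ i _ → e i

Σ-zero : ∀ n {f : ℕ → ℤ} → (∀ i → i < n → f i ≡ 0ℤ) → Σ n f ≡ 0ℤ
Σ-zero zero    e = refl
Σ-zero (suc n) e rewrite e 0 (s≤s z≤n) | Σ-zero n (λ i i<n → e (suc i) (s≤s i<n)) = refl

Σ-+ : ∀ n (f g : ℕ → ℤ) → Σ n (λ i → f i + g i) ≡ Σ n f + Σ n g
Σ-+ zero    f g = refl
Σ-+ (suc n) f g rewrite Σ-+ n (f ∘ suc) (g ∘ suc) = lem (f 0) (g 0) (Σ n (f ∘ suc)) (Σ n (g ∘ suc))
  where
  lem : ∀ a b c d → (a + b) + (c + d) ≡ (a + c) + (b + d)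
  lem = solve-∀

Σ-*ˡ : ∀ n c (f : ℕ → ℤ) → Σ n (λ i → c * f i) ≡ c * Σ n f
Σ-*ˡ zero    c f = sym (ℤₚ.*-zeroʳ c)
Σ-*ˡ (suc n) c f rewrite Σ-*ˡ n c (f ∘ suc) = sym (ℤₚ.*-distribˡ-+ c (f 0) _)

Σ-*ʳ : ∀ n c (f : ℕ → ℤ) → Σ n (λ i → f i * c) ≡ Σ n f * c
Σ-*ʳ n c f = trans (Σ-cong n λ i → ℤₚ.*-comm (f i) c) (trans (Σ-*ˡ n c f) (ℤₚ.*-comm c _))

Σ-swap : ∀ n m (f : ℕ → ℕ → ℤ) → Σ n (λ i → Σ m (f i)) ≡ Σ m (λ j → Σ n (λ i → f i j))
Σ-swap zero    m f = sym (Σ-zero m λ _ _ → refl)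
Σ-swap (suc n) m f = trans ((Σ m (f 0)) ⟨+⟩ (Σ-swap n m (f ∘ suc))) (sym (Σ-+ m (f 0) (λ j → Σ n (λ i → f (suc i) j))))

Σ-last : ∀ n (f : ℕ → ℤ) → Σ (suc n) f ≡ Σ n f + f n
Σ-last zero    f = ℤₚ.+-comm (f 0) 0ℤ
Σ-last (suc n) f = trans ((f 0) ⟨+⟩ (Σ-last n (f ∘ suc))) (sym (ℤₚ.+-assoc (f 0) _ _))

Σ-split : ∀ n m (f : ℕ → ℤ) → Σ (n ℕ.+ m) f ≡ Σ n f + Σ m (λ i → f (n ℕ.+ i))
Σ-split zero    m f = sym (ℤₚ.+-identityˡ _)
Σ-split (suc n) m f = trans ((f 0) ⟨+⟩ (Σ-split n m (f ∘ suc))) (sym (ℤₚ.+-assoc (f 0) _ _))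

Σ-extend : ∀ {n m} (f : ℕ → ℤ) → n ≤ m → (∀ i → n ≤ i → f i ≡ 0ℤ) → Σ m f ≡ Σ n f
Σ-extend {n} {m} f n≤m e = begin
  Σ m f                                        ≡⟨ cong (λ k → Σ k f) (sym (ℕₚ.m+[n∸m]≡n n≤m)) ⟩
  Σ (n ℕ.+ (m ∸ n)) f                          ≡⟨ Σ-split n (m ∸ n) f ⟩
  Σ n f + Σ (m ∸ n) (λ i → f (n ℕ.+ i))        ≡⟨ (Σ n f) ⟨+⟩ (Σ-zero (m ∸ n) λ i _ → e _ (ℕₚ.m≤m+n n i)) ⟩
  Σ n f + 0ℤ                                   ≡⟨ ℤₚ.+-identityʳ _ ⟩
  Σ n f                                        ∎

Σ-reverse : ∀ n (f : ℕ → ℤ) → Σ (suc n) (λ i → f (n ∸ i)) ≡ Σ (suc n) f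
Σ-reverse zero    f = refl
Σ-reverse (suc n) f = begin
  f (suc n) + Σ (suc n) (λ i → f (n ∸ i)) ≡⟨ (f (suc n)) ⟨+⟩ (Σ-reverse n f) ⟩
  f (suc n) + Σ (suc n) f                 ≡⟨ ℤₚ.+-comm (f (suc n)) _ ⟩
  Σ (suc n) f + f (suc n)                 ≡⟨ sym (Σ-last (suc n) f) ⟩
  Σ (suc (suc n)) f                       ∎

sumℤ-upTo : ∀ n (f : ℕ → ℤ) → sumℤ (map f (upTo n)) ≡ Σ n f
sumℤ-upTo n f = go n id
  where
  go : ∀ n (h : ℕ → ℕ) → sumℤ (map f (applyUpTo h n)) ≡ Σ n (f ∘ h)
  go zero    h = refl
  go (suc n) h = (f (h 0)) ⟨+⟩ (go n (h ∘ suc))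

-- Power series

infix 4 _≈_
-- Pointwise equality, wrapped in a record so that unification can recover `f` and `g` from the type
-- of a proof.
record _≈_ (f g : Series) : Set where
  constructor pw
  field at : ∀ n → f n ≡ g n
open _≈_ public

infixl 6 _⊞_
infixl 7 _·_
infix  8 ⊟_

_⊞_ : Series → Series → Series
(f ⊞ g) n = f n + g n

⊟_ : Series → Series
(⊟ f) n = - f n

𝟎 : Series
𝟎 _ = 0ℤ

_·_ : Series → Series → Series
(f · g) n = Σ (suc n) (λ i → f i * g (n ∸ i))

ι : ℤ → Series
ι c zero    = c
ι c (suc _) = 0ℤ

⊛≈· : ∀ f g → f ⊛ g ≈ f · g
⊛≈· f g = pw λ n → sumℤ-upTo (suc n) (λ i → f i * g (n ∸ i))

·-cong : ∀ {f f′ g g′} → f ≈ f′ → g ≈ g′ → f · g ≈ f′ · g′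
·-cong p q = pw λ n → Σ-cong (suc n) λ i → cong₂ _*_ (at p i) (at q (n ∸ i))

·-last : ∀ f g n → (f · g) (suc n) ≡ f (suc n) * g 0 + (f · (g ∘ suc)) n
·-last f g zero    = lem (f 0) (f 1) (g 0) (g 1)
  where
  lem : ∀ a b c d → a * d + (b * c + 0ℤ) ≡ b * c + (a * d + 0ℤ)
  lem = solve-∀
·-last f g (suc n) rewrite ·-last (f ∘ suc) g n =
  lem (f 0 * g (suc (suc n))) (f (suc (suc n)) * g 0) _
  where
  lem : ∀ a b c → a + (b + c) ≡ b + (a + c)
  lem = solve-∀

·-comm : ∀ f g → f · g ≈ g · f
·-comm f g = pw λ n → go n f g
  where
  go : ∀ n f g → (f · g) n ≡ (g · f) n
  go zero    f g = cong (_+ 0ℤ) (ℤₚ.*-comm (f 0) (g 0))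
  go (suc n) f g = begin
    f 0 * g (suc n) + ((f ∘ suc) · g) n ≡⟨ cong₂ _+_ (ℤₚ.*-comm (f 0) _) (go n (f ∘ suc) g) ⟩
    g (suc n) * f 0 + (g · (f ∘ suc)) n ≡⟨ sym (·-last g f n) ⟩
    (g · f) (suc n)                     ∎

·-distribʳ : ∀ h f g → (f ⊞ g) · h ≈ f · h ⊞ g · h
·-distribʳ h f g = pw λ n → trans (Σ-cong (suc n) λ i → ℤₚ.*-distribʳ-+ (h (n ∸ i)) (f i) (g i))
  (Σ-+ (suc n) (λ i → f i * h (n ∸ i)) (λ i → g i * h (n ∸ i)))

·-distribˡ : ∀ h f g → h · (f ⊞ g) ≈ h · f ⊞ h · g
·-distribˡ h f g = pw λ n → trans (Σ-cong (suc n) λ i → ℤₚ.*-distribˡ-+ (h i) (f (n ∸ i)) (g (n ∸ i)))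
  (Σ-+ (suc n) (λ i → h i * f (n ∸ i)) (λ i → h i * g (n ∸ i)))

ι-· : ∀ c f n → (ι c · f) n ≡ c * f n
ι-· c f n = trans ((c * f n) ⟨+⟩ (Σ-zero n λ _ _ → refl)) (ℤₚ.+-identityʳ _)

·-assoc : ∀ f g h → (f · g) · h ≈ f · (g · h)
·-assoc f g h = pw λ n → go n f
  where
  lem : ∀ a b c → a * b * c + 0ℤ ≡ a * (b * c)
  lem = solve-∀
  lem₂ : ∀ a b c d e → a * b * c + (a * d + e) ≡ a * (b * c + d) + e
  lem₂ = solve-∀
  go : ∀ n f → ((f · g) · h) n ≡ (f · (g · h)) n
  go zero    f = trans (lem₀ (f 0) (g 0) (h 0)) refl
    where
    lem₀ : ∀ a b c → (a * b + 0ℤ) * c + 0ℤ ≡ a * (b * c + 0ℤ) + 0ℤ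
    lem₀ = solve-∀
  go (suc n) f = begin
    (f 0 * g 0 + 0ℤ) * h (suc n) + (((λ i → f 0 * g (suc i)) ⊞ (f ∘ suc) · g) · h) n
      ≡⟨ cong₂ _+_ (cong (_* h (suc n)) (ℤₚ.+-identityʳ (f 0 * g 0))) (at (·-distribʳ h (λ i → f 0 * g (suc i)) ((f ∘ suc) · g)) n) ⟩
    f 0 * g 0 * h (suc n) + (((λ i → f 0 * g (suc i)) · h) n + (((f ∘ suc) · g) · h) n)
      ≡⟨ (f 0 * g 0 * h (suc n)) ⟨+⟩ (cong₂ _+_
           (trans (Σ-cong (suc n) λ i → ℤₚ.*-assoc (f 0) (g (suc i)) (h (n ∸ i)))
             (Σ-*ˡ (suc n) (f 0) (λ i → g (suc i) * h (n ∸ i))))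
           (go n (f ∘ suc))) ⟩
    f 0 * g 0 * h (suc n) + (f 0 * ((g ∘ suc) · h) n + ((f ∘ suc) · (g · h)) n)
      ≡⟨ lem₂ (f 0) (g 0) (h (suc n)) _ _ ⟩
    f 0 * (g · h) (suc n) + ((f ∘ suc) · (g · h)) n ∎

≈-refl : ∀ {f} → f ≈ f
≈-refl = pw λ _ → refl

≈-sym : ∀ {f g} → f ≈ g → g ≈ f
≈-sym p = pw λ n → sym (at p n)

≈-trans : ∀ {f g h} → f ≈ g → g ≈ h → f ≈ h
≈-trans p q = pw λ n → trans (at p n) (at q n)

⊞-cong : ∀ {f f′ g g′} → f ≈ f′ → g ≈ g′ → f ⊞ g ≈ f′ ⊞ g′
⊞-cong p q = pw λ n → cong₂ _+_ (at p n) (at q n)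

one≈ι : one ≈ ι 1ℤ
one≈ι = pw λ { zero → refl ; (suc n) → refl }

·-identityˡ : ∀ f → ι 1ℤ · f ≈ f
·-identityˡ f = pw λ n → trans (ι-· 1ℤ f n) (ℤₚ.*-identityˡ (f n))

seriesRing : CommutativeRing 0ℓ 0ℓ
seriesRing = record
  { Carrier = Series ; _≈_ = _≈_ ; _+_ = _⊞_ ; _*_ = _·_ ; -_ = ⊟_ ; 0# = 𝟎 ; 1# = ι 1ℤ
  ; isCommutativeRing = record
    { isRing = record
      { +-isAbelianGroup = record
        { isGroup = record
          { isMonoid = record
            { isSemigroup = record
              { isMagma = record
                { isEquivalence = record { refl = ≈-refl ; sym = ≈-sym ; trans = ≈-trans }
                ; ∙-cong = ⊞-cong }
              ; assoc = λ f g h → pw λ n → ℤₚ.+-assoc (f n) (g n) (h n) }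
            ; identity = (λ f → pw λ n → ℤₚ.+-identityˡ (f n)) , (λ f → pw λ n → ℤₚ.+-identityʳ (f n)) }
          ; inverse = (λ f → pw λ n → ℤₚ.+-inverseˡ (f n)) , (λ f → pw λ n → ℤₚ.+-inverseʳ (f n))
          ; ⁻¹-cong = λ p → pw λ n → cong -_ (at p n) }
        ; comm = λ f g → pw λ n → ℤₚ.+-comm (f n) (g n) }
      ; *-cong = ·-cong
      ; *-assoc = ·-assoc
      ; *-identity = ·-identityˡ , λ f → ≈-trans (·-comm f (ι 1ℤ)) (·-identityˡ f)
      ; distrib = ·-distribˡ , ·-distribʳ }
    ; *-comm = ·-comm } }


ι-+ : ∀ a b → ι (a + b) ≈ ι a ⊞ ι b
ι-+ a b = pw λ { zero → refl ; (suc n) → refl }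

ι-* : ∀ a b → ι (a * b) ≈ ι a · ι b
ι-* a b = pw λ { zero → sym (ℤₚ.+-identityʳ (a * b)) ; (suc n) → sym (trans (ι-· a (ι b) (suc n)) (ℤₚ.*-zeroʳ a)) }

ι-neg : ∀ a → ι (- a) ≈ ⊟ ι a
ι-neg a = pw λ { zero → refl ; (suc n) → refl }

ι-morphism : ℤ.+-*-rawRing ACR.-Raw-AlmostCommutative⟶ ACR.fromCommutativeRing seriesRing
ι-morphism = record
  { ⟦_⟧ = ι ; +-homo = ι-+ ; *-homo = ι-* ; -‿homo = ι-neg
  ; 0-homo = pw (λ { zero → refl ; (suc n) → refl }) ; 1-homo = ≈-refl }

ι-≟ : ∀ a b → Maybe.Maybe (ι a ≈ ι b)
ι-≟ a b = Maybe.map (λ { refl → ≈-refl }) (dec⇒maybe (a ℤ.≟ b))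

open RingSolver ℤ.+-*-rawRing (ACR.fromCommutativeRing seriesRing) ι-morphism ι-≟
  using (con; _:+_; _:*_; :-_; _:-_; _:=_) renaming (solve to solveˢ) public

infixr 2 _≈⟨_⟩_
infix  3 _∎ˢ

_≈⟨_⟩_ : ∀ f {g h} → f ≈ g → g ≈ h → f ≈ h
f ≈⟨ p ⟩ q = ≈-trans p q

_∎ˢ : ∀ f → f ≈ f
f ∎ˢ = ≈-refl

infixr 5 _⟨·⟩_ _⟨⊞⟩_

_⟨·⟩_ : ∀ f {g h} → g ≈ h → f · g ≈ f · h
f ⟨·⟩ p = ·-cong (≈-refl {f}) p

_⟨⊞⟩_ : ∀ f {g h} → g ≈ h → f ⊞ g ≈ f ⊞ h
f ⟨⊞⟩ p = ⊞-cong (≈-refl {f}) p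

infixr 7 _•_
_•_ : ℤ → Series → Series
(c • f) n = c * f n

•≈ι· : ∀ c f → c • f ≈ ι c · f
•≈ι· c f = pw λ n → sym (ι-· c f n)

infixr 5 _⟨•⟩_
_⟨•⟩_ : ∀ c {f g} → f ≈ g → c • f ≈ c • g
c ⟨•⟩ p = pw λ n → c ⟨*⟩ at p n

•-·ˡ : ∀ c f g → (c • f) · g ≈ c • (f · g)
•-·ˡ c f g = pw λ n → trans (Σ-cong (suc n) λ i → ℤₚ.*-assoc c (f i) (g (n ∸ i))) (Σ-*ˡ (suc n) c (λ i → f i * g (n ∸ i)))

-- Order in q and infinite sums of series

Ord : ℕ → Series → Set
Ord k f = ∀ n → n < k → f n ≡ 0ℤ

Ord-resp : ∀ {k f g} → f ≈ g → Ord k f → Ord k g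
Ord-resp p o n n<k = trans (sym (at p n)) (o n n<k)

Ord-≤ : ∀ {k l f} → l ≤ k → Ord k f → Ord l f
Ord-≤ l≤k o n n<l = o n (ℕₚ.<-≤-trans n<l l≤k)

Ord-⊞ : ∀ {k f g} → Ord k f → Ord k g → Ord k (f ⊞ g)
Ord-⊞ o p n n<k = cong₂ _+_ (o n n<k) (p n n<k)

Ord-⊟ : ∀ {k f} → Ord k f → Ord k (⊟ f)
Ord-⊟ o n n<k = cong -_ (o n n<k)

Ord-• : ∀ {k f} c → Ord k f → Ord k (c • f)
Ord-• c o n n<k = trans (cong (c *_) (o n n<k)) (ℤₚ.*-zeroʳ c)

Ord-· : ∀ {a b f g} → Ord a f → Ord b g → Ord (a ℕ.+ b) (f · g)
Ord-· {a} {b} {f} {g} o p n n<a+b = Σ-zero (suc n) term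
  where
  term : ∀ i → i < suc n → f i * g (n ∸ i) ≡ 0ℤ
  term i i≤n with i ℕ.<? a
  ... | yes i<a = cong (_* g (n ∸ i)) (o i i<a)
  ... | no i≮a = trans (cong (f i *_) (p (n ∸ i) n∸i<b)) (ℤₚ.*-zeroʳ (f i))
    where
    n∸i<b : n ∸ i < b
    n∸i<b = ℕₚ.+-cancelˡ-< i _ _ (ℕₚ.≤-<-trans (ℕₚ.≤-reflexive (ℕₚ.m+[n∸m]≡n (ℕₚ.≤-pred i≤n)))
              (ℕₚ.<-≤-trans n<a+b (ℕₚ.+-monoˡ-≤ b (ℕₚ.≮⇒≥ i≮a))))

Ord-·ʳ : ∀ {k f} g → Ord k f → Ord k (f · g)
Ord-·ʳ {k} g o = Ord-≤ (ℕₚ.≤-reflexive (sym (ℕₚ.+-identityʳ k))) (Ord-· {b = 0} {g = g} o λ _ ())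

·-top : ∀ {k f} g → Ord k f → (f · g) k ≡ f k * g 0
·-top {k} {f} g o = trans (Σ-last k (λ i → f i * g (k ∸ i))) (trans (cong₂ _+_ (Σ-zero k λ i i<k → cong (_* g (k ∸ i)) (o i i<k))
  (cong (λ m → f k * g m) (ℕₚ.n∸n≡0 k))) (ℤₚ.+-identityˡ (f k * g 0)))

Ord-suc : ∀ {k f} → Ord k f → f k ≡ 0ℤ → Ord (suc k) f
Ord-suc {k} {f} o e n n<sk with n ℕ.<? k
... | yes n<k = o n n<k
... | no n≮k = subst (λ m → f m ≡ 0ℤ) (ℕₚ.≤-antisym (ℕₚ.≮⇒≥ n≮k) (ℕₚ.≤-pred n<sk)) e

-- Order i for the i-th term is stronger than local finiteness: degree n then sees only the indices
-- up to n, so an infinite sum is a finite one with an explicit range. Families with a slower growth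
-- of order receive an extra power of q.
Summable : (ℕ → Series) → Set
Summable F = ∀ i → Ord i (F i)

-- The sum of a summable family; without summability this is a junk value.
Σ∞ : (ℕ → Series) → Series
Σ∞ F n = Σ (suc n) (λ i → F i n)

Σ∞-at : ∀ {F} → Summable F → ∀ {n k} → n < k → Σ k (λ i → F i n) ≡ Σ∞ F n
Σ∞-at s n<k = Σ-extend _ n<k λ i n<i → s i _ n<i

Σ∞-cong : ∀ {F G} → (∀ i → F i ≈ G i) → Σ∞ F ≈ Σ∞ G
Σ∞-cong p = pw λ n → Σ-cong (suc n) λ i → at (p i) n

Σ∞-⊞ : ∀ F G → Σ∞ (λ i → F i ⊞ G i) ≈ Σ∞ F ⊞ Σ∞ G
Σ∞-⊞ F G = pw λ n → Σ-+ (suc n) (λ i → F i n) (λ i → G i n)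

Σ∞-• : ∀ c F → Σ∞ (λ i → c • F i) ≈ c • Σ∞ F
Σ∞-• c F = pw λ n → Σ-*ˡ (suc n) c (λ i → F i n)

-- In degree n both sides run over the same square of indices up to n.
Σ∞-swap : ∀ (F : ℕ → ℕ → Series) → Σ∞ (λ i → Σ∞ (F i)) ≈ Σ∞ (λ j → Σ∞ (λ i → F i j))
Σ∞-swap F = pw λ n → Σ-swap (suc n) (suc n) (λ i j → F i j n)

Σ∞-·ˡ : ∀ f F → Summable F → Σ∞ (λ i → f · F i) ≈ f · Σ∞ F
Σ∞-·ˡ f F s = pw λ n → begin
  Σ (suc n) (λ i → Σ (suc n) (λ t → f t * F i (n ∸ t)))
    ≡⟨ Σ-swap (suc n) (suc n) (λ i t → f t * F i (n ∸ t)) ⟩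
  Σ (suc n) (λ t → Σ (suc n) (λ i → f t * F i (n ∸ t)))
    ≡⟨ Σ-cong (suc n) (λ t → trans (Σ-*ˡ (suc n) (f t) (λ i → F i (n ∸ t)))
         (cong (f t *_) (Σ∞-at s (s≤s (ℕₚ.m∸n≤m n t))))) ⟩
  (f · Σ∞ F) n ∎

Summable-suc : ∀ {F} → Summable F → Summable (F ∘ suc)
Summable-suc s i = Ord-≤ (ℕₚ.n≤1+n i) (s (suc i))

Σ∞-suc : ∀ {F} → Summable F → Σ∞ F ≈ F 0 ⊞ Σ∞ (F ∘ suc)
Σ∞-suc {F} s = pw λ n → (F 0 n) ⟨+⟩ (sym (Σ-extend _ (ℕₚ.n≤1+n n) λ i n≤i → s (suc i) n (s≤s n≤i)))

Σˢ : ℕ → (ℕ → Series) → Series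
Σˢ n F k = Σ n (λ i → F i k)

·-Σˢ : ∀ n f F → Σˢ n (λ i → f · F i) ≈ f · Σˢ n F
·-Σˢ n f F = pw λ k → trans (Σ-swap n (suc k) (λ i t → f t * F i (k ∸ t)))
  (Σ-cong (suc k) λ t → Σ-*ˡ n (f t) (λ i → F i (k ∸ t)))

Σ∞-split : ∀ {F} k → Summable F → Σ∞ F ≈ Σˢ k F ⊞ Σ∞ (λ i → F (k ℕ.+ i))
Σ∞-split zero    s = pw λ n → sym (ℤₚ.+-identityˡ _)
Σ∞-split {F} (suc k) s = pw λ n → begin
  Σ∞ F n                                                    ≡⟨ at (Σ∞-suc s) n ⟩
  F 0 n + Σ∞ (F ∘ suc) n                                    ≡⟨ F 0 n ⟨+⟩ (at (Σ∞-split k (Summable-suc s)) n) ⟩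
  F 0 n + (Σ k (λ i → F (suc i) n) + Σ∞ (λ i → F (suc k ℕ.+ i)) n) ≡⟨ sym (ℤₚ.+-assoc (F 0 n) _ _) ⟩
  Σ (suc k) (λ i → F i n) + Σ∞ (λ i → F (suc k ℕ.+ i)) n    ∎

private
  Σ-triangle : ∀ k (ψ : ℕ → ℕ → ℤ) → Σ k (λ a → Σ (k ∸ a) (ψ a)) ≡ Σ k (λ n → Σ (suc n) (λ a → ψ a (n ∸ a)))
  Σ-triangle zero    ψ = refl
  Σ-triangle (suc k) ψ = begin
    Σ (suc k) (λ a → Σ (suc k ∸ a) (ψ a))
      ≡⟨ Σ-cong< (suc k) (λ a a<k → trans (cong (λ m → Σ m (ψ a)) (ℕₚ.+-∸-assoc 1 (ℕₚ.≤-pred a<k))) (Σ-last (k ∸ a) (ψ a))) ⟩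
    Σ (suc k) (λ a → Σ (k ∸ a) (ψ a) + ψ a (k ∸ a))
      ≡⟨ Σ-+ (suc k) (λ a → Σ (k ∸ a) (ψ a)) (λ a → ψ a (k ∸ a)) ⟩
    Σ (suc k) (λ a → Σ (k ∸ a) (ψ a)) + Σ (suc k) (λ a → ψ a (k ∸ a))
      ≡⟨ cong (_+ Σ (suc k) (λ a → ψ a (k ∸ a))) (trans (Σ-last k (λ a → Σ (k ∸ a) (ψ a)))
           (trans (cong₂ _+_ (Σ-triangle k ψ) (cong (λ m → Σ m (ψ k)) (ℕₚ.n∸n≡0 k))) (ℤₚ.+-identityʳ (Σ k (λ n → Σ (suc n) (λ a → ψ a (n ∸ a))))))) ⟩
    Σ k (λ n → Σ (suc n) (λ a → ψ a (n ∸ a))) + Σ (suc k) (λ a → ψ a (k ∸ a))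
      ≡⟨ sym (Σ-last k (λ n → Σ (suc n) (λ a → ψ a (n ∸ a)))) ⟩
    Σ (suc k) (λ n → Σ (suc n) (λ a → ψ a (n ∸ a))) ∎

  -- Induction on the side of the square: row 0 and column 0 are the entries d = 0 of the
  -- off-diagonals. The vanishing hypotheses let every off-diagonal run over the full range, even
  -- where it leaves the square.
  Σ-diagonals : ∀ k (ψ : ℕ → ℕ → ℤ) → (∀ a b → k ≤ a → ψ a b ≡ 0ℤ) → (∀ a b → k ≤ b → ψ a b ≡ 0ℤ) →
    Σ k (λ a → Σ k (ψ a)) ≡
    Σ k (λ d → ψ d d) + Σ k (λ j → Σ k (λ d → ψ d (suc j ℕ.+ d) + ψ (suc j ℕ.+ d) d))
  Σ-diagonals zero    ψ va vb = refl
  Σ-diagonals (suc k) ψ va vb = begin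
    (ψ 0 0 + Σ k (λ b → ψ 0 (suc b))) + Σ k (λ a → ψ (suc a) 0 + Σ k (ψ′ a))
      ≡⟨ (ψ 0 0 + Σ k (λ b → ψ 0 (suc b))) ⟨+⟩ (Σ-+ k (λ a → ψ (suc a) 0) (λ a → Σ k (ψ′ a))) ⟩
    (ψ 0 0 + Σ k (λ b → ψ 0 (suc b))) + (Σ k (λ a → ψ (suc a) 0) + Σ k (λ a → Σ k (ψ′ a)))
      ≡⟨ (ψ 0 0 + Σ k (λ b → ψ 0 (suc b))) ⟨+⟩ (Σ k (λ a → ψ (suc a) 0) ⟨+⟩
           (Σ-diagonals k ψ′ (λ a b k≤a → va _ _ (s≤s k≤a)) (λ a b k≤b → vb _ _ (s≤s k≤b)))) ⟩
    (ψ 0 0 + Σ k (λ b → ψ 0 (suc b))) + (Σ k (λ a → ψ (suc a) 0) + (Σ k (λ d → ψ′ d d) + Σ k (λ j → Σ k (R j))))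
      ≡⟨ lem (ψ 0 0) _ _ _ _ ⟩
    (ψ 0 0 + Σ k (λ d → ψ′ d d)) + ((Σ k (λ b → ψ 0 (suc b)) + Σ k (λ a → ψ (suc a) 0)) + Σ k (λ j → Σ k (R j)))
      ≡⟨ (ψ 0 0 + Σ k (λ d → ψ′ d d)) ⟨+⟩ (cong (_+ Σ k (λ j → Σ k (R j))) (sym (Σ-+ k (λ b → ψ 0 (suc b)) (λ a → ψ (suc a) 0)))) ⟩
    (ψ 0 0 + Σ k (λ d → ψ′ d d)) + (Σ k (λ j → E j 0) + Σ k (λ j → Σ k (R j)))
      ≡⟨ (ψ 0 0 + Σ k (λ d → ψ′ d d)) ⟨+⟩ (sym (Σ-+ k (λ j → E j 0) (λ j → Σ k (R j)))) ⟩
    (ψ 0 0 + Σ k (λ d → ψ′ d d)) + Σ k (λ j → E j 0 + Σ k (R j))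
      ≡⟨ (ψ 0 0 + Σ k (λ d → ψ′ d d)) ⟨+⟩ (Σ-cong k λ j → cong₂ _+_ (cong₂ _+_ (cong (ψ 0) (sym (cong suc (ℕₚ.+-identityʳ j))))
           (cong (λ m → ψ m 0) (sym (cong suc (ℕₚ.+-identityʳ j)))))
           (Σ-cong k λ d → cong₂ _+_ (cong (ψ (suc d)) (sym (cong suc (ℕₚ.+-suc j d))))
             (cong (λ m → ψ m (suc d)) (sym (cong suc (ℕₚ.+-suc j d)))))) ⟩
    (ψ 0 0 + Σ k (λ d → ψ′ d d)) + Σ k (λ j → Σ (suc k) (T j))
      ≡⟨ (ψ 0 0 + Σ k (λ d → ψ′ d d)) ⟨+⟩ (sym (trans (Σ-last k (λ j → Σ (suc k) (T j)))
           (trans (Σ k (λ j → Σ (suc k) (T j)) ⟨+⟩ (Σ-zero (suc k) λ d _ → cong₂ _+_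
              (vb d _ (ℕₚ.m≤m+n (suc k) d)) (va _ d (ℕₚ.m≤m+n (suc k) d)))) (ℤₚ.+-identityʳ _)))) ⟩
    (ψ 0 0 + Σ k (λ d → ψ′ d d)) + Σ (suc k) (λ j → Σ (suc k) (T j)) ∎
    where
    ψ′ : ℕ → ℕ → ℤ
    ψ′ a b = ψ (suc a) (suc b)
    R T : ℕ → ℕ → ℤ
    R j d = ψ′ d (suc j ℕ.+ d) + ψ′ (suc j ℕ.+ d) d
    T j d = ψ d (suc j ℕ.+ d) + ψ (suc j ℕ.+ d) d
    E : ℕ → ℕ → ℤ
    E j _ = ψ 0 (suc j) + ψ (suc j) 0
    lem : ∀ a b c d e → (a + b) + (c + (d + e)) ≡ (a + d) + ((b + c) + e)
    lem = solve-∀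

Σ∞-triangle : ∀ (F : ℕ → ℕ → Series) → (∀ a b → Ord (a ℕ.+ b) (F a b)) →
  Σ∞ (λ a → Σ∞ (F a)) ≈ Σ∞ (λ n → Σˢ (suc n) (λ a → F a (n ∸ a)))
Σ∞-triangle F o = pw λ n → trans
  (Σ-cong (suc n) λ a → Σ-extend (λ b → F a b n) (ℕₚ.m∸n≤m (suc n) a)
    λ b sn∸a≤b → o a b n (ℕₚ.≤-trans (ℕₚ.m≤n+m∸n (suc n) a) (ℕₚ.+-monoʳ-≤ a sn∸a≤b)))
  (Σ-triangle (suc n) (λ a b → F a b n))

-- Regroups by the difference of the two indices, both signs together, to match products of the
-- shape `w d` · `w (n + d)`.
Σ∞-diagonals : ∀ (F : ℕ → ℕ → Series) → (∀ a b → Ord a (F a b)) → (∀ a b → Ord b (F a b)) →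
  Σ∞ (λ a → Σ∞ (F a)) ≈ Σ∞ (λ d → F d d) ⊞ Σ∞ (λ k → Σ∞ (λ d → F d (suc k ℕ.+ d) ⊞ F (suc k ℕ.+ d) d))
Σ∞-diagonals F oa ob = pw λ n → Σ-diagonals (suc n) (λ a b → F a b n)
  (λ a b n<a → oa a b n n<a) (λ a b n<b → ob a b n n<b)

-- Monomials and geometric series

X : ℕ → Series
X e n = if e ℕ.≡ᵇ n then 1ℤ else 0ℤ

X-0 : X 0 ≈ ι 1ℤ
X-0 = pw λ { zero → refl ; (suc n) → refl }

Ord-X : ∀ e → Ord e (X e)
Ord-X (suc e) zero    _         = refl
Ord-X (suc e) (suc n) (s≤s n<e) = Ord-X e n n<e

X-·-at : ∀ e f n → (X e · f) (e ℕ.+ n) ≡ f n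
X-·-at zero    f n = trans (at (·-cong X-0 (≈-refl {f})) n) (at (·-identityˡ f) n)
X-·-at (suc e) f n = trans (ℤₚ.+-identityˡ _) (X-·-at e f n)

X-+ : ∀ e f → X e · X f ≈ X (e ℕ.+ f)
X-+ e f = pw (go e)
  where
  go : ∀ e n → (X e · X f) n ≡ X (e ℕ.+ f) n
  go zero    n       = trans (at (·-cong X-0 (≈-refl {X f})) n) (at (·-identityˡ (X f)) n)
  go (suc e) zero    = refl
  go (suc e) (suc n) = trans (ℤₚ.+-identityˡ _) (go e n)

-- The inverse of 1 - q^e for e > 0. At e = 0 the family is not summable, hence the `suc e` in the
-- lemmas.
geo : ℕ → Series
geo e = Σ∞ (λ k → X (k ℕ.* e))

module _ (e : ℕ) where
  private
    summable-X : Summable (λ k → X (k ℕ.* suc e))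
    summable-X k = Ord-≤ (ℕₚ.m≤m*n k (suc e)) (Ord-X (k ℕ.* suc e))

  X-geo : X (suc e) · geo (suc e) ≈ Σ∞ (λ k → X (suc k ℕ.* suc e))
  X-geo = ≈-trans (≈-sym (Σ∞-·ˡ (X (suc e)) (λ k → X (k ℕ.* suc e)) summable-X)) (Σ∞-cong λ k → X-+ (suc e) (k ℕ.* suc e))

  geo-unfold : geo (suc e) ≈ ι 1ℤ ⊞ X (suc e) · geo (suc e)
  geo-unfold = ≈-trans (Σ∞-suc summable-X) (⊞-cong X-0 (≈-sym X-geo))

  geo-recip : geo (suc e) · (ι 1ℤ ⊞ ⊟ X (suc e)) ≈ ι 1ℤ
  geo-recip =
      g · (ι 1ℤ ⊞ ⊟ x)         ≈⟨ solveˢ 2 (λ g x → g :* (con 1ℤ :- x) := g :- x :* g) ≈-refl g x ⟩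
      g ⊞ ⊟ (x · g)            ≈⟨ ⊞-cong geo-unfold (≈-refl {⊟ (x · g)}) ⟩
      ι 1ℤ ⊞ x · g ⊞ ⊟ (x · g) ≈⟨ solveˢ 2 (λ g x → con 1ℤ :+ x :* g :- x :* g := con 1ℤ) ≈-refl g x ⟩
      ι 1ℤ                     ∎ˢ
    where
    g = geo (suc e)
    x = X (suc e)

-- Lambert series

-- For a > 0, `w a` = 1 / (q^(-a) - q^a), a reciprocal hyperbolic sine in a, and 1 + 2 `y a` = (1 +
-- q^(2a)) / (1 - q^(2a)) is the matching hyperbolic cotangent.
w y : ℕ → Series
w a = X a · geo (a ℕ.+ a)
y a = X (a ℕ.+ a) · geo (a ℕ.+ a)

Ord-w : ∀ a → Ord a (w a)
Ord-w a = Ord-·ʳ (geo (a ℕ.+ a)) (Ord-X a)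

Ord-y : ∀ a → Ord a (y a)
Ord-y a = Ord-≤ (ℕₚ.m≤m+n a a) (Ord-·ʳ (geo (a ℕ.+ a)) (Ord-X (a ℕ.+ a)))

-- 1 - x x′ = (1 - x) + (1 - x′) - (1 - x) (1 - x′)
recip-product : ∀ x x′ g g′ h → g · (ι 1ℤ ⊞ ⊟ x) ≈ ι 1ℤ → g′ · (ι 1ℤ ⊞ ⊟ x′) ≈ ι 1ℤ →
  h · (ι 1ℤ ⊞ ⊟ (x · x′)) ≈ ι 1ℤ → g · g′ ≈ h · (g ⊞ g′ ⊞ ⊟ ι 1ℤ)
recip-product x x′ g g′ h p p′ q =
  g · g′ ≈⟨ ≈-sym (≈-trans (·-cong q ≈-refl) (·-identityˡ (g · g′))) ⟩
  (h · (ι 1ℤ ⊞ ⊟ (x · x′))) · (g · g′)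
    ≈⟨ solveˢ 5 (λ x x′ g g′ h → (h :* (con 1ℤ :- x :* x′)) :* (g :* g′) :=
         h :* ((g :* (con 1ℤ :- x)) :* g′ :+ (g′ :* (con 1ℤ :- x′)) :* g :- (g :* (con 1ℤ :- x)) :* (g′ :* (con 1ℤ :- x′))))
         ≈-refl x x′ g g′ h ⟩
  h · ((g · (ι 1ℤ ⊞ ⊟ x)) · g′ ⊞ (g′ · (ι 1ℤ ⊞ ⊟ x′)) · g ⊞ ⊟ ((g · (ι 1ℤ ⊞ ⊟ x)) · (g′ · (ι 1ℤ ⊞ ⊟ x′))))
    ≈⟨ h ⟨·⟩ (⊞-cong (⊞-cong (·-cong p ≈-refl) (·-cong p′ ≈-refl)) (pw λ n → cong -_ (at (·-cong p p′) n))) ⟩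
  h · (ι 1ℤ · g′ ⊞ ι 1ℤ · g ⊞ ⊟ (ι 1ℤ · ι 1ℤ))
    ≈⟨ solveˢ 3 (λ g g′ h → h :* (con 1ℤ :* g′ :+ con 1ℤ :* g :- con 1ℤ :* con 1ℤ) := h :* (g :+ g′ :- con 1ℤ)) ≈-refl g g′ h ⟩
  h · (g ⊞ g′ ⊞ ⊟ ι 1ℤ) ∎ˢ

-- Over the common denominator, 1 / (1 - x′) - 1 / (1 - x x′) has numerator x′ (1 - x), and g
-- cancels 1 - x.
recip-quotient : ∀ x x′ g g′ h → g · (ι 1ℤ ⊞ ⊟ x) ≈ ι 1ℤ → g′ · (ι 1ℤ ⊞ ⊟ x′) ≈ ι 1ℤ →
  h · (ι 1ℤ ⊞ ⊟ (x · x′)) ≈ ι 1ℤ → x′ · (h · g′) ≈ g · (g′ ⊞ ⊟ h)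
recip-quotient x x′ g g′ h p p′ q =
  x′ · (h · g′) ≈⟨ ≈-sym (≈-trans (·-cong p ≈-refl) (·-identityˡ (x′ · (h · g′)))) ⟩
  (g · (ι 1ℤ ⊞ ⊟ x)) · (x′ · (h · g′))
    ≈⟨ solveˢ 5 (λ x x′ g g′ h → (g :* (con 1ℤ :- x)) :* (x′ :* (h :* g′)) :=
         g :* ((h :* (con 1ℤ :- x :* x′)) :* g′ :- (g′ :* (con 1ℤ :- x′)) :* h)) ≈-refl x x′ g g′ h ⟩
  g · ((h · (ι 1ℤ ⊞ ⊟ (x · x′))) · g′ ⊞ ⊟ ((g′ · (ι 1ℤ ⊞ ⊟ x′)) · h))
    ≈⟨ g ⟨·⟩ (⊞-cong (·-cong q ≈-refl) (pw λ n → cong -_ (at (·-cong p′ (≈-refl {h})) n))) ⟩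
  g · (ι 1ℤ · g′ ⊞ ⊟ (ι 1ℤ · h))
    ≈⟨ solveˢ 3 (λ g g′ h → g :* (con 1ℤ :* g′ :- con 1ℤ :* h) := g :* (g′ :- h)) ≈-refl g g′ h ⟩
  g · (g′ ⊞ ⊟ h) ∎ˢ

≡⇒≈ : ∀ {f g : Series} → f ≡ g → f ≈ g
≡⇒≈ refl = ≈-refl

⊟-cong : ∀ {f g} → f ≈ g → ⊟ f ≈ ⊟ g
⊟-cong p = pw λ n → cong -_ (at p n)

X-double : ∀ a b → X ((a ℕ.+ b) ℕ.+ (a ℕ.+ b)) ≈ X (a ℕ.+ a) · X (b ℕ.+ b)
X-double a b = ≈-trans (≡⇒≈ (cong X (lem a b))) (≈-sym (X-+ (a ℕ.+ a) (b ℕ.+ b)))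
  where
  lem : ∀ a b → (a ℕ.+ b) ℕ.+ (a ℕ.+ b) ≡ (a ℕ.+ a) ℕ.+ (b ℕ.+ b)
  lem = ℕS.solve-∀

geo-recip-sum : ∀ a b → geo ((suc a ℕ.+ suc b) ℕ.+ (suc a ℕ.+ suc b)) · (ι 1ℤ ⊞ ⊟ (X (suc a ℕ.+ suc a) · X (suc b ℕ.+ suc b))) ≈ ι 1ℤ
geo-recip-sum a b = ≈-trans
  (·-cong (≈-refl {geo ((suc a ℕ.+ suc b) ℕ.+ (suc a ℕ.+ suc b))}) (⊞-cong (≈-refl {ι 1ℤ}) (⊟-cong (≈-sym (X-double (suc a) (suc b))))))
  (geo-recip (a ℕ.+ suc b ℕ.+ (suc a ℕ.+ suc b)))

-- The addition formula 1 / (sinh a sinh b) = (coth a + coth b) / sinh (a + b), up to normalisation.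
w-·-w : ∀ a b → w (suc a) · w (suc b) ≈ w (suc a ℕ.+ suc b) · (ι 1ℤ ⊞ (y (suc a) ⊞ y (suc b)))
w-·-w a b =
  (p · g) · (s · g′)
    ≈⟨ solveˢ 4 (λ p g s g′ → (p :* g) :* (s :* g′) := (p :* s) :* (g :* g′)) ≈-refl p g s g′ ⟩
  (p · s) · (g · g′)
    ≈⟨ ·-cong (X-+ (suc a) (suc b)) (recip-product x x′ g g′ h (geo-recip (a ℕ.+ suc a)) (geo-recip (b ℕ.+ suc b)) (geo-recip-sum a b)) ⟩
  ps · (h · (g ⊞ g′ ⊞ ⊟ ι 1ℤ))
    ≈⟨ ps ⟨·⟩ (h ⟨·⟩ (⊞-cong (⊞-cong (geo-unfold (a ℕ.+ suc a)) (geo-unfold (b ℕ.+ suc b))) (≈-refl {⊟ ι 1ℤ}))) ⟩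
  ps · (h · ((ι 1ℤ ⊞ x · g) ⊞ (ι 1ℤ ⊞ x′ · g′) ⊞ ⊟ ι 1ℤ))
    ≈⟨ solveˢ 4 (λ ps h xg xg′ → ps :* (h :* ((con 1ℤ :+ xg) :+ (con 1ℤ :+ xg′) :- con 1ℤ)) := (ps :* h) :* (con 1ℤ :+ (xg :+ xg′)))
         ≈-refl ps h (x · g) (x′ · g′) ⟩
  (ps · h) · (ι 1ℤ ⊞ (x · g ⊞ x′ · g′)) ∎ˢ
  where
  p = X (suc a)
  s = X (suc b)
  ps = X (suc a ℕ.+ suc b)
  x = X (suc a ℕ.+ suc a)
  x′ = X (suc b ℕ.+ suc b)
  g = geo (suc a ℕ.+ suc a)
  g′ = geo (suc b ℕ.+ suc b)
  h = geo ((suc a ℕ.+ suc b) ℕ.+ (suc a ℕ.+ suc b))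

-- The same formula for arguments of opposite sign, whose sum is c: the difference of two cotangents
-- loses its constant 1.
w-·-w-shift : ∀ c d → w (suc d) · w (suc c ℕ.+ suc d) ≈ w (suc c) · (y (suc d) ⊞ ⊟ y (suc c ℕ.+ suc d))
w-·-w-shift c d =
  (s · g′) · (ps · h)
    ≈⟨ s · g′ ⟨·⟩ (·-cong (≈-sym (X-+ (suc c) (suc d))) (≈-refl {h})) ⟩
  (s · g′) · ((p · s) · h)
    ≈⟨ solveˢ 4 (λ p s g′ h → (s :* g′) :* ((p :* s) :* h) := p :* ((s :* s) :* (h :* g′))) ≈-refl p s g′ h ⟩
  p · ((s · s) · (h · g′))
    ≈⟨ p ⟨·⟩ (·-cong (X-+ (suc d) (suc d)) (≈-refl {h · g′})) ⟩
  p · (x′ · (h · g′))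
    ≈⟨ p ⟨·⟩ (recip-quotient x x′ g g′ h (geo-recip (c ℕ.+ suc c)) (geo-recip (d ℕ.+ suc d)) (geo-recip-sum c d)) ⟩
  p · (g · (g′ ⊞ ⊟ h))
    ≈⟨ p ⟨·⟩ (g ⟨·⟩ (⊞-cong (geo-unfold (d ℕ.+ suc d)) (⊟-cong (geo-unfold (c ℕ.+ suc d ℕ.+ (suc c ℕ.+ suc d)))))) ⟩
  p · (g · ((ι 1ℤ ⊞ x′ · g′) ⊞ ⊟ (ι 1ℤ ⊞ xx′ · h)))
    ≈⟨ solveˢ 4 (λ p g u v → p :* (g :* ((con 1ℤ :+ u) :- (con 1ℤ :+ v))) := (p :* g) :* (u :- v)) ≈-refl p g (x′ · g′) (xx′ · h) ⟩
  (p · g) · (x′ · g′ ⊞ ⊟ (xx′ · h)) ∎ˢ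
  where
  p = X (suc c)
  s = X (suc d)
  ps = X (suc c ℕ.+ suc d)
  x = X (suc c ℕ.+ suc c)
  x′ = X (suc d ℕ.+ suc d)
  xx′ = X ((suc c ℕ.+ suc d) ℕ.+ (suc c ℕ.+ suc d))
  g = geo (suc c ℕ.+ suc c)
  g′ = geo (suc d ℕ.+ suc d)
  h = geo ((suc c ℕ.+ suc d) ℕ.+ (suc c ℕ.+ suc d))

-- Convolutions of `w` over a fixed sum of the indices

•-·ʳ : ∀ c f g → c • (f · g) ≈ f · (c • g)
•-·ʳ c f g = ≈-trans (•≈ι· c (f · g)) (≈-trans
  (solveˢ 3 (λ c f g → c :* (f :* g) := f :* (c :* g)) ≈-refl (ι c) f g) (f ⟨·⟩ ≈-sym (•≈ι· c g)))

Σˢ-cong< : ∀ n {F G : ℕ → Series} → (∀ i → i < n → F i ≈ G i) → Σˢ n F ≈ Σˢ n G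
Σˢ-cong< n p = pw λ k → Σ-cong< n λ i i<n → at (p i i<n) k

∸-suc : ∀ {a k} → a < k → suc a ℕ.+ suc (k ∸ suc a) ≡ suc k
∸-suc {a} {k} a<k = trans (ℕₚ.+-suc (suc a) (k ∸ suc a)) (cong suc (ℕₚ.m+[n∸m]≡n a<k))

[m+n]-m : ∀ m n → (m + n) - m ≡ n
[m+n]-m = solve-∀

suc-minus : ∀ {a k} → a < k → + suc k - + suc a ≡ + suc (k ∸ suc a)
suc-minus {a} {k} a<k = trans (cong (λ n → + n - + suc a) (sym (∸-suc a<k))) ([m+n]-m (+ suc a) (+ suc (k ∸ suc a)))

module Convolution (F : ℤ → ℤ → ℤ) (F-sym : ∀ a b → F a b ≡ F b a) where

  -- The factor left when `w n`, n = k + 1, is taken out of `convolution`. The coefficient F(e, n -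
  -- e) comes from the `y e` of the larger or of a positive argument, F(n + e, -e) from that of a
  -- negative argument. The sum over all e includes e = n, which no pair produces; the last summand
  -- takes it away.
  bracket : ℕ → Series
  bracket k = ι (Σ k (λ a → F (+ suc a) (+ suc (k ∸ suc a)))) ⊞
    (+ 2 • Σ∞ (λ e → (F (+ suc e) (+ suc k - + suc e) - F (+ (suc k ℕ.+ suc e)) (- + suc e)) • y (suc e))
     ⊞ (- + 2 * F (+ suc k) 0ℤ) • y (suc k))

  private
    bracket-eval : ∀ k N →
      Σ k (λ a → F (+ suc a) (+ suc (k ∸ suc a)) * (ι 1ℤ N + (y (suc a) N + y (suc (k ∸ suc a)) N)))
      + - + 2 * Σ∞ (λ d → F (+ (suc k ℕ.+ suc d)) (- + suc d) • (y (suc d) ⊞ ⊟ y (suc k ℕ.+ suc d))) N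
      ≡ bracket k N
    bracket-eval k N = trans (cong₂ (λ u v → u + - + 2 * v) finite infinite)
      (trans (lem P c A Q R (F (+ suc k) 0ℤ) (y (suc k) N)) (cong₂ (λ u v → u + (+ 2 * v + - + 2 * F (+ suc k) 0ℤ * y (suc k) N)) (sym const) (sym linear)))
      where
      c = ι 1ℤ N
      f1 f2 f0 : ℕ → ℤ
      f1 e = F (+ suc e) (+ suc k - + suc e)
      f2 e = F (+ (suc k ℕ.+ suc e)) (- + suc e)
      f0 a = F (+ suc a) (+ suc (k ∸ suc a))
      P = Σ k f0
      A = Σ k (λ a → f1 a * y (suc a) N)
      Q = Σ∞ (λ d → f2 d • y (suc d)) N
      R = Σ∞ (λ d → f2 d • y (suc k ℕ.+ suc d)) N
      lem : ∀ P c A Q R f v → (P * c + (A + A)) + - + 2 * (Q + - + 1 * R) ≡ P * c + (+ 2 * (((A + f * v) + R) + - + 1 * Q) + - + 2 * f * v)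
      lem = solve-∀
      const : ι P N ≡ P * c
      const = ι-scale N
        where
        ι-scale : ∀ N → ι P N ≡ P * ι 1ℤ N
        ι-scale zero    = sym (ℤₚ.*-identityʳ P)
        ι-scale (suc N) = sym (ℤₚ.*-zeroʳ P)
      f1≡f0 : ∀ a → a < k → f1 a ≡ f0 a
      f1≡f0 a a<k = cong (F (+ suc a)) (suc-minus a<k)
      -- The symmetry of F makes both `y` terms of a pair of positive arguments contribute the same
      -- sum A.
      reversal : ∀ k → Σ k (λ a → F (+ suc a) (+ suc (k ∸ suc a)) * y (suc (k ∸ suc a)) N)
                     ≡ Σ k (λ a → F (+ suc a) (+ suc (k ∸ suc a)) * y (suc a) N)
      reversal zero    = refl
      reversal (suc j) = trans (Σ-cong< (suc j) λ a a≤j → cong (_* y (suc (j ∸ a)) N)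
           (trans (F-sym _ _) (cong (λ m → F (+ suc (j ∸ a)) (+ suc m)) (sym (ℕₚ.m∸[m∸n]≡n (ℕₚ.≤-pred a≤j))))))
        (Σ-reverse j (λ a → F (+ suc a) (+ suc (j ∸ a)) * y (suc a) N))
      finite : Σ k (λ a → f0 a * (c + (y (suc a) N + y (suc (k ∸ suc a)) N))) ≡ P * c + (A + A)
      finite = begin
        Σ k (λ a → f0 a * (c + (y (suc a) N + y (suc (k ∸ suc a)) N)))
          ≡⟨ Σ-cong k (λ a → lem₁ (f0 a) c (y (suc a) N) (y (suc (k ∸ suc a)) N)) ⟩
        Σ k (λ a → f0 a * c + (f0 a * y (suc a) N + f0 a * y (suc (k ∸ suc a)) N))
          ≡⟨ Σ-+ k (λ a → f0 a * c) (λ a → f0 a * y (suc a) N + f0 a * y (suc (k ∸ suc a)) N) ⟩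
        Σ k (λ a → f0 a * c) + Σ k (λ a → f0 a * y (suc a) N + f0 a * y (suc (k ∸ suc a)) N)
          ≡⟨ cong₂ _+_ (Σ-*ʳ k c f0) (Σ-+ k (λ a → f0 a * y (suc a) N) (λ a → f0 a * y (suc (k ∸ suc a)) N)) ⟩
        P * c + (Σ k (λ a → f0 a * y (suc a) N) + Σ k (λ a → f0 a * y (suc (k ∸ suc a)) N))
          ≡⟨ P * c ⟨+⟩ cong₂ _+_ toA (trans (reversal k) toA) ⟩
        P * c + (A + A) ∎
        where
        lem₁ : ∀ f c u v → f * (c + (u + v)) ≡ f * c + (f * u + f * v)
        lem₁ = solve-∀
        toA : Σ k (λ a → f0 a * y (suc a) N) ≡ A
        toA = Σ-cong< k λ a a<k → cong (_* y (suc a) N) (sym (f1≡f0 a a<k))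
      infinite : Σ∞ (λ d → f2 d • (y (suc d) ⊞ ⊟ y (suc k ℕ.+ suc d))) N ≡ Q + - + 1 * R
      infinite = trans (Σ-cong (suc N) λ d → lem₂ (f2 d) (y (suc d) N) (y (suc k ℕ.+ suc d) N))
        (trans (Σ-+ (suc N) (λ d → f2 d * y (suc d) N) (λ d → - + 1 * (f2 d * y (suc k ℕ.+ suc d) N)))
          (Q ⟨+⟩ Σ-*ˡ (suc N) (- + 1) (λ d → f2 d * y (suc k ℕ.+ suc d) N)))
        where
        lem₂ : ∀ f u v → f * (u + - v) ≡ f * u + - + 1 * (f * v)
        lem₂ = solve-∀
      -- The full sum over e is cut at n = k + 1: below n it is A, at n it is the term in F(n, 0),
      -- and e = n + d gives R, since then n - e = -d.
      tail : Σ∞ (λ e → f1 e • y (suc e)) N ≡ (A + F (+ suc k) 0ℤ * y (suc k) N) + R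
      tail = trans (at (Σ∞-split (suc k) (λ e → Ord-• (f1 e) (Ord-≤ (ℕₚ.n≤1+n e) (Ord-y (suc e))))) N)
        (cong₂ _+_ (trans (Σ-last k (λ e → f1 e * y (suc e) N))
                      (A ⟨+⟩ cong (_* y (suc k) N) (cong (F (+ suc k)) (ℤₚ.+-inverseʳ (+ suc k)))))
          (Σ-cong (suc N) λ d → cong₂ (λ u m → u * y m N) (f1-tail d) (sym (ℕₚ.+-suc (suc k) d))))
        where
        f1-tail : ∀ d → f1 (suc k ℕ.+ d) ≡ f2 d
        f1-tail d = trans (cong (λ m → F (+ m) (+ suc k - + m)) (sym (ℕₚ.+-suc (suc k) d)))
          (cong (F (+ (suc k ℕ.+ suc d))) (lem₃ (+ suc k) (+ suc d)))
          where
          lem₃ : ∀ a b → a - (a + b) ≡ - b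
          lem₃ = solve-∀
      linear : Σ∞ (λ e → (f1 e - f2 e) • y (suc e)) N ≡ ((A + F (+ suc k) 0ℤ * y (suc k) N) + R) + - + 1 * Q
      linear = trans (Σ-cong (suc N) λ e → lem₄ (f1 e) (f2 e) (y (suc e) N))
        (trans (Σ-+ (suc N) (λ e → f1 e * y (suc e) N) (λ e → - + 1 * (f2 e * y (suc e) N)))
          (cong₂ _+_ tail (Σ-*ˡ (suc N) (- + 1) (λ e → f2 e * y (suc e) N))))
        where
        lem₄ : ∀ a b u → (a - b) * u ≡ a * u + - + 1 * (b * u)
        lem₄ = solve-∀

  -- The left side is the sum of F(a, b) ŵ(a) ŵ(b) over all nonzero integers with a + b = n. Pairs
  -- of opposite sign are (n + d, -d) and its mirror image, and ŵ is odd: hence the factor -2.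
  convolution : ∀ k →
    Σˢ k (λ a → F (+ suc a) (+ suc (k ∸ suc a)) • (w (suc a) · w (suc (k ∸ suc a))))
    ⊞ (- + 2) • Σ∞ (λ d → F (+ (suc k ℕ.+ suc d)) (- + suc d) • (w (suc d) · w (suc k ℕ.+ suc d)))
    ≈ w (suc k) · bracket k
  convolution k =
    Σˢ k (λ a → f0 a • (w (suc a) · w (suc (k ∸ suc a)))) ⊞ (- + 2) • Σ∞ (λ d → f2 d • (w (suc d) · w (suc k ℕ.+ suc d)))
      ≈⟨ ⊞-cong (Σˢ-cong< k λ a a<k → ≈-trans (f0 a ⟨•⟩ (≈-trans (w-·-w a (k ∸ suc a))
              (·-cong (≡⇒≈ (cong w (∸-suc a<k))) (≈-refl {B a})))) (•-·ʳ (f0 a) (w (suc k)) (B a)))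
           ((- + 2) ⟨•⟩ (Σ∞-cong λ d → ≈-trans (f2 d ⟨•⟩ (w-·-w-shift k d)) (•-·ʳ (f2 d) (w (suc k)) (D d)))) ⟩
    Σˢ k (λ a → w (suc k) · (f0 a • B a)) ⊞ (- + 2) • Σ∞ (λ d → w (suc k) · (f2 d • D d))
      ≈⟨ ⊞-cong (·-Σˢ k (w (suc k)) (λ a → f0 a • B a))
           (≈-trans ((- + 2) ⟨•⟩ (Σ∞-·ˡ (w (suc k)) (λ d → f2 d • D d) λ d → Ord-• (f2 d) (Ord-⊞ (Ord-≤ (ℕₚ.n≤1+n d) (Ord-y (suc d)))
              (Ord-⊟ (Ord-≤ (ℕₚ.≤-trans (ℕₚ.n≤1+n d) (ℕₚ.m≤n+m (suc d) (suc k))) (Ord-y (suc k ℕ.+ suc d)))))))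
             (•-·ʳ (- + 2) (w (suc k)) (Σ∞ (λ d → f2 d • D d)))) ⟩
    w (suc k) · Σˢ k (λ a → f0 a • B a) ⊞ w (suc k) · ((- + 2) • Σ∞ (λ d → f2 d • D d))
      ≈⟨ ≈-sym (·-distribˡ (w (suc k)) (Σˢ k (λ a → f0 a • B a)) ((- + 2) • Σ∞ (λ d → f2 d • D d))) ⟩
    w (suc k) · (Σˢ k (λ a → f0 a • B a) ⊞ (- + 2) • Σ∞ (λ d → f2 d • D d))
      ≈⟨ w (suc k) ⟨·⟩ pw (bracket-eval k) ⟩
    w (suc k) · bracket k ∎ˢ
    where
    f2 f0 : ℕ → ℤ
    f2 e = F (+ (suc k ℕ.+ suc e)) (- + suc e)
    f0 a = F (+ suc a) (+ suc (k ∸ suc a))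
    B D : ℕ → Series
    B a = ι 1ℤ ⊞ (y (suc a) ⊞ y (suc (k ∸ suc a)))
    D d = y (suc d) ⊞ ⊟ y (suc k ℕ.+ suc d)

Ord-Σˢ : ∀ {k} n {F} → (∀ i → i < n → Ord k (F i)) → Ord k (Σˢ n F)
Ord-Σˢ n o t t<k = Σ-zero n λ i i<n → o i i<n t t<k

-- Double sums over positive indices

ww : ℕ → ℕ → Series
ww a b = w (suc a) · w (suc b)

Ord-ww : ∀ a b → Ord (suc a ℕ.+ suc b) (ww a b)
Ord-ww a b = Ord-· {f = w (suc a)} {g = w (suc b)} (Ord-w (suc a)) (Ord-w (suc b))

DS : (ℤ → ℤ → ℤ) → Series
DS φ = Σ∞ (λ a → Σ∞ (λ b → φ (+ suc a) (+ suc b) • ww a b))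

DS-cong : ∀ {φ ψ} → (∀ a b → φ a b ≡ ψ a b) → DS φ ≈ DS ψ
DS-cong p = Σ∞-cong λ a → Σ∞-cong λ b → pw λ n → cong (_* ww a b n) (p (+ suc a) (+ suc b))

DS-+ : ∀ φ ψ → DS (λ a b → φ a b + ψ a b) ≈ DS φ ⊞ DS ψ
DS-+ φ ψ = ≈-trans (Σ∞-cong λ a → ≈-trans (Σ∞-cong λ b → pw λ n → ℤₚ.*-distribʳ-+ (ww a b n) (φ (+ suc a) (+ suc b)) (ψ (+ suc a) (+ suc b)))
    (Σ∞-⊞ (λ b → φ (+ suc a) (+ suc b) • ww a b) (λ b → ψ (+ suc a) (+ suc b) • ww a b)))
  (Σ∞-⊞ (λ a → Σ∞ (λ b → φ (+ suc a) (+ suc b) • ww a b)) (λ a → Σ∞ (λ b → ψ (+ suc a) (+ suc b) • ww a b)))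

DS-* : ∀ c φ → DS (λ a b → c * φ a b) ≈ c • DS φ
DS-* c φ = ≈-trans (Σ∞-cong λ a → ≈-trans (Σ∞-cong λ b → pw λ n → ℤₚ.*-assoc c (φ (+ suc a) (+ suc b)) (ww a b n))
    (Σ∞-• c (λ b → φ (+ suc a) (+ suc b) • ww a b)))
  (Σ∞-• c (λ a → Σ∞ (λ b → φ (+ suc a) (+ suc b) • ww a b)))

moment : (ℤ → ℤ) → Series
moment f = Σ∞ (λ a → f (+ suc a) • w (suc a))

summable-moment : ∀ (f : ℤ → ℤ) → Summable (λ a → f (+ suc a) • w (suc a))
summable-moment f a = Ord-• (f (+ suc a)) (Ord-≤ (ℕₚ.n≤1+n a) (Ord-w (suc a)))

moment-·ʳ : ∀ (f : ℤ → ℤ) g → Σ∞ (λ a → f (+ suc a) • (w (suc a) · g)) ≈ moment f · g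
moment-·ʳ f g = ≈-trans
  (Σ∞-cong λ a → ≈-trans (≈-sym (•-·ˡ (f (+ suc a)) (w (suc a)) g)) (·-comm (f (+ suc a) • w (suc a)) g))
  (≈-trans (Σ∞-·ˡ g (λ a → f (+ suc a) • w (suc a)) (summable-moment f)) (·-comm g (moment f)))

DS-product : ∀ f g → DS (λ a b → f a * g b) ≈ moment f · moment g
DS-product f g = ≈-trans
  (Σ∞-cong λ a → ≈-trans (Σ∞-cong λ b → ≈-trans (pw λ n → ℤₚ.*-assoc (f (+ suc a)) (g (+ suc b)) (ww a b n))
       (f (+ suc a) ⟨•⟩ •-·ʳ (g (+ suc b)) (w (suc a)) (w (suc b))))
     (≈-trans (Σ∞-• (f (+ suc a)) (λ b → w (suc a) · (g (+ suc b) • w (suc b))))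
       (f (+ suc a) ⟨•⟩ Σ∞-·ˡ (w (suc a)) (λ b → g (+ suc b) • w (suc b)) (summable-moment g))))
  (moment-·ʳ f (moment g))

-- Weights `convolution` at n with h(n) and sums over n > 0. The pairs with sum n make up `φ₁`. The
-- pairs with difference n or -n make up `φ₂`, where evenness of h and F-neg identify the two signs.
module Quadratic (F : ℤ → ℤ → ℤ) (F-sym : ∀ a b → F a b ≡ F b a) (F-neg : ∀ a b → F (- a) (- b) ≡ F a b)
                 (h : ℤ → ℤ) (h-even : ∀ a → h (- a) ≡ h a) (h-0 : h 0ℤ ≡ 0ℤ) where
  open Convolution F F-sym

  private
    f0 : ℕ → ℕ → Series
    f0 k a = F (+ suc a) (+ suc (k ∸ suc a)) • ww a (k ∸ suc a)
    f2 : ℕ → ℕ → Series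
    f2 k d = F (+ (suc k ℕ.+ suc d)) (- + suc d) • (w (suc d) · w (suc k ℕ.+ suc d))

    φ₁ φ₂ : ℤ → ℤ → ℤ
    φ₁ a b = h (a + b) * F a b
    φ₂ a b = h (a - b) * F a (- b)

    sums : DS φ₁ ≈ Σ∞ (λ k → h (+ suc k) • Σˢ k (f0 k))
    sums =
      DS φ₁
        ≈⟨ Σ∞-triangle (λ a b → φ₁ (+ suc a) (+ suc b) • ww a b) (λ a b → Ord-• (φ₁ (+ suc a) (+ suc b))
             (Ord-≤ (ℕₚ.+-mono-≤ (ℕₚ.n≤1+n a) (ℕₚ.n≤1+n b)) (Ord-ww a b))) ⟩
      Σ∞ (λ j → Σˢ (suc j) (λ a → φ₁ (+ suc a) (+ suc (j ∸ a)) • ww a (j ∸ a)))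
        ≈⟨ Σ∞-cong (λ j → ≈-trans (Σˢ-cong< (suc j) λ a a≤j → pw λ n → trans
             (cong (λ m → h (+ m) * F (+ suc a) (+ suc (j ∸ a)) * ww a (j ∸ a) n) (∸-suc a≤j))
             (ℤₚ.*-assoc (h (+ suc (suc j))) (F (+ suc a) (+ suc (j ∸ a))) (ww a (j ∸ a) n)))
             (pw λ n → Σ-*ˡ (suc j) (h (+ suc (suc j))) (λ a → f0 (suc j) a n))) ⟩
      Σ∞ (λ j → G (suc j))
        -- No two positive integers add up to 1, so the empty term k = 0 can be put in front.
        ≈⟨ pw (λ n → sym (trans (cong (_+ Σ∞ (λ j → G (suc j)) n) (ℤₚ.*-zeroʳ (h (+ 1)))) (ℤₚ.+-identityˡ _))) ⟩
      G 0 ⊞ Σ∞ (λ j → G (suc j))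
        ≈⟨ ≈-sym (Σ∞-suc summable-G) ⟩
      Σ∞ G ∎ˢ
      where
      G : ℕ → Series
      G k = h (+ suc k) • Σˢ k (f0 k)
      summable-G : Summable G
      summable-G k = Ord-• (h (+ suc k)) (Ord-Σˢ k λ a a<k → Ord-• (F (+ suc a) (+ suc (k ∸ suc a)))
        (Ord-≤ (ℕₚ.≤-trans (ℕₚ.n≤1+n k) (ℕₚ.≤-reflexive (sym (∸-suc a<k)))) (Ord-ww a (k ∸ suc a))))

    differences : DS φ₂ ≈ Σ∞ (λ k → h (+ suc k) • (+ 2 • Σ∞ (f2 k)))
    differences =
      DS φ₂
        ≈⟨ Σ∞-diagonals H (λ a b → Ord-• (φ₂ (+ suc a) (+ suc b)) (Ord-≤ (ℕₚ.≤-trans (ℕₚ.n≤1+n a) (ℕₚ.m≤m+n (suc a) (suc b))) (Ord-ww a b)))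
             (λ a b → Ord-• (φ₂ (+ suc a) (+ suc b)) (Ord-≤ (ℕₚ.≤-trans (ℕₚ.n≤1+n b) (ℕₚ.m≤n+m (suc b) (suc a))) (Ord-ww a b))) ⟩
      Σ∞ (λ d → H d d) ⊞ Σ∞ (λ k → Σ∞ (λ d → H d (suc k ℕ.+ d) ⊞ H (suc k ℕ.+ d) d))
        -- The diagonal a = b vanishes by h(0) = 0; difference 0 has no counterpart in
        -- `convolution`.
        ≈⟨ ⊞-cong (pw λ n → Σ-zero (suc n) λ d _ → trans (cong (λ z → h z * F (+ suc d) (- + suc d) * ww d d n) (ℤₚ.+-inverseʳ (+ suc d)))
               (cong (λ z → z * F (+ suc d) (- + suc d) * ww d d n) h-0))
             (Σ∞-cong λ k → ≈-trans (Σ∞-cong (term k)) (≈-trans (Σ∞-• (h (+ suc k)) (λ d → + 2 • f2 k d)) (h (+ suc k) ⟨•⟩ Σ∞-• (+ 2) (f2 k)))) ⟩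
      𝟎 ⊞ Σ∞ (λ k → h (+ suc k) • (+ 2 • Σ∞ (f2 k)))
        ≈⟨ pw (λ n → ℤₚ.+-identityˡ _) ⟩
      Σ∞ (λ k → h (+ suc k) • (+ 2 • Σ∞ (f2 k))) ∎ˢ
      where
      H : ℕ → ℕ → Series
      H a b = φ₂ (+ suc a) (+ suc b) • ww a b
      term : ∀ k d → H d (suc k ℕ.+ d) ⊞ H (suc k ℕ.+ d) d ≈ h (+ suc k) • (+ 2 • f2 k d)
      term k d = pw λ n → begin
        H d (suc k ℕ.+ d) n + H (suc k ℕ.+ d) d n
          ≡⟨ cong₂ _+_ (cong₂ (λ c v → c * v) (value₁) refl) (cong₂ (λ c v → c * v) value₂ (at (·-comm (w b) (w (suc d))) n)) ⟩
        h (+ suc k) * F (+ b) (- + suc d) * (w (suc d) · w b) n + h (+ suc k) * F (+ b) (- + suc d) * (w (suc d) · w b) n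
          ≡⟨ double (h (+ suc k)) (F (+ b) (- + suc d)) ((w (suc d) · w b) n) ⟩
        h (+ suc k) * (+ 2 * (F (+ b) (- + suc d) * (w (suc d) · w b) n))
          ≡⟨ cong (λ m → h (+ suc k) * (+ 2 * (F (+ m) (- + suc d) * (w (suc d) · w m) n))) (sym (ℕₚ.+-suc (suc k) d)) ⟩
        h (+ suc k) * (+ 2 * f2 k d n) ∎
        where
        b = suc (suc k ℕ.+ d)
        b≡ : + b ≡ + suc k + + suc d
        b≡ = cong +_ (sym (ℕₚ.+-suc (suc k) d))
        double : ∀ x y z → x * y * z + x * y * z ≡ x * (+ 2 * (y * z))
        double = solve-∀
        lem₁ : ∀ x y → y - (x + y) ≡ - x
        lem₁ = solve-∀
        value₁ : φ₂ (+ suc d) (+ b) ≡ h (+ suc k) * F (+ b) (- + suc d)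
        value₁ = cong₂ _*_ (trans (cong (λ z → h (+ suc d - z)) b≡) (trans (cong h (lem₁ (+ suc k) (+ suc d))) (h-even (+ suc k))))
          (trans (sym (F-neg (+ suc d) (- + b))) (F-sym (- + suc d) (- - + b)))
        lem₂ : ∀ x y → (x + y) - y ≡ x
        lem₂ = solve-∀
        value₂ : φ₂ (+ b) (+ suc d) ≡ h (+ suc k) * F (+ b) (- + suc d)
        value₂ = cong (_* F (+ b) (- + suc d)) (trans (cong (λ z → h (z - + suc d)) b≡) (cong h (lem₂ (+ suc k) (+ suc d))))

  quadratic : DS (λ a b → φ₁ a b + - + 1 * φ₂ a b) ≈ Σ∞ (λ k → h (+ suc k) • (w (suc k) · bracket k))
  quadratic =
    DS (λ a b → φ₁ a b + - + 1 * φ₂ a b)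
      ≈⟨ ≈-trans (DS-+ φ₁ (λ a b → - + 1 * φ₂ a b)) (⊞-cong sums (≈-trans (DS-* (- + 1) φ₂) ((- + 1) ⟨•⟩ differences))) ⟩
    Σ∞ (λ k → h (+ suc k) • Σˢ k (f0 k)) ⊞ (- + 1) • Σ∞ (λ k → h (+ suc k) • (+ 2 • Σ∞ (f2 k)))
      ≈⟨ Σ∞ (λ k → h (+ suc k) • Σˢ k (f0 k)) ⟨⊞⟩ ≈-sym (Σ∞-• (- + 1) (λ k → h (+ suc k) • (+ 2 • Σ∞ (f2 k)))) ⟩
    Σ∞ (λ k → h (+ suc k) • Σˢ k (f0 k)) ⊞ Σ∞ (λ k → (- + 1) • (h (+ suc k) • (+ 2 • Σ∞ (f2 k))))
      ≈⟨ ≈-sym (Σ∞-⊞ (λ k → h (+ suc k) • Σˢ k (f0 k)) (λ k → (- + 1) • (h (+ suc k) • (+ 2 • Σ∞ (f2 k))))) ⟩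
    Σ∞ (λ k → h (+ suc k) • Σˢ k (f0 k) ⊞ (- + 1) • (h (+ suc k) • (+ 2 • Σ∞ (f2 k))))
      ≈⟨ Σ∞-cong (λ k → ≈-trans (pw λ n → collect (h (+ suc k)) (Σˢ k (f0 k) n) (Σ∞ (f2 k) n)) (h (+ suc k) ⟨•⟩ convolution k)) ⟩
    Σ∞ (λ k → h (+ suc k) • (w (suc k) · bracket k)) ∎ˢ
    where
    collect : ∀ h u v → h * u + - + 1 * (h * (+ 2 * v)) ≡ h * (u + - + 2 * v)
    collect = solve-∀

-- Moments and their recursion

oddPower : ℕ → ℤ → ℤ
oddPower l x = x * (x * x) ℤ.^ l

C : ℕ → Series
C l = moment (oddPower l)

-- (1 - E₂(q²)) / 24.
Y : Series
Y = Σ∞ (λ e → + suc e • y (suc e))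

convolution-total : ∀ k → + 6 * Σ k (λ a → + suc a * + suc (k ∸ suc a)) ≡ + suc k * (+ suc k * + suc k) - + suc k
convolution-total k = trans
  (cong (+ 6 *_) (Σ-cong< k λ a a<k → cong (+ suc a *_) (sym (suc-minus a<k))))
  (trans (go (+ suc k) k) (lem₁ (+ k)))
  where
  lem₁ : ∀ k → + 3 * (+ 1 + k) * k * (k + + 1) - k * (k + + 1) * (+ 2 * k + + 1) ≡ (+ 1 + k) * ((+ 1 + k) * (+ 1 + k)) - (+ 1 + k)
  lem₁ = solve-∀
  lem₂ : ∀ n m → (+ 3 * n * m * (m + + 1) - m * (m + + 1) * (+ 2 * m + + 1)) + + 6 * ((+ 1 + m) * (n - (+ 1 + m)))
    ≡ + 3 * n * (+ 1 + m) * ((+ 1 + m) + + 1) - (+ 1 + m) * ((+ 1 + m) + + 1) * (+ 2 * (+ 1 + m) + + 1)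
  lem₂ = solve-∀
  -- The summand depends on n = k + 1, so the induction runs on a separate upper limit m with n
  -- fixed.
  go : ∀ n m → + 6 * Σ m (λ a → + suc a * (n - + suc a)) ≡ + 3 * n * + m * (+ m + + 1) - + m * (+ m + + 1) * (+ 2 * + m + + 1)
  go n zero    = lem₀ n
    where
    lem₀ : ∀ n → + 6 * + 0 ≡ + 3 * n * + 0 * (+ 0 + + 1) - + 0 * (+ 0 + + 1) * (+ 2 * + 0 + + 1)
    lem₀ = solve-∀
  go n (suc m) = trans (cong (+ 6 *_) (Σ-last m (λ a → + suc a * (n - + suc a))))
    (trans (ℤₚ.*-distribˡ-+ (+ 6) (Σ m (λ a → + suc a * (n - + suc a))) (+ suc m * (n - + suc m)))
      (trans (cong (_+ + 6 * (+ suc m * (n - + suc m))) (go n m)) (lem₂ n (+ m))))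

evenPower : ℕ → ℤ → ℤ
evenPower l x = (x * x) ℤ.^ l

evenPower-neg : ∀ l x → evenPower l (- x) ≡ evenPower l x
evenPower-neg l x = cong (ℤ._^ l) (lem x)
  where
  lem : ∀ x → - x * - x ≡ x * x
  lem = solve-∀

private
  neg-*-neg : ∀ a b → - a * - b ≡ a * b
  neg-*-neg = solve-∀

module Products (l : ℕ) where
  open Quadratic _*_ ℤₚ.*-comm neg-*-neg (evenPower (suc l)) (evenPower-neg (suc l)) refl
  open Convolution _*_ ℤₚ.*-comm

  private
    h = evenPower (suc l)

    -- For the kernel a b the coefficient of `y e` is e (n - e) + (n + e) e = 2 n e, linear in e, so
    -- these terms add up to a multiple of `Y`. The 6 clears the denominator of the finite sum (n³ -
    -- n) / 6.
    bracket-value : ∀ k → + 6 • bracket k ≈ ι (+ suc k * (+ suc k * + suc k) - + suc k) ⊞ (+ 24 * + suc k) • Y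
    bracket-value k = pw λ n → trans
      (cong (λ z → + 6 * (ι P n + (+ 2 * z + - + 2 * (+ suc k * 0ℤ) * y (suc k) n)))
        (trans (Σ-cong (suc n) λ e → cong (_* y (suc e) n) (lem₁ (+ suc k) (+ suc e)))
          (trans (Σ-cong (suc n) λ e → ℤₚ.*-assoc (+ 2 * + suc k) (+ suc e) (y (suc e) n))
            (Σ-*ˡ (suc n) (+ 2 * + suc k) (λ e → + suc e * y (suc e) n)))))
      (trans (lem₂ (ι P n) (+ suc k) (Y n) (y (suc k) n))
        (cong (_+ + 24 * + suc k * Y n) (trans (ι-6 n) (cong (λ c → ι c n) (convolution-total k)))))
      where
      P = Σ k (λ a → + suc a * + suc (k ∸ suc a))
      lem₁ : ∀ n e → e * (n - e) - (n + e) * - e ≡ + 2 * n * e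
      lem₁ = solve-∀
      lem₂ : ∀ p n y v → + 6 * (p + (+ 2 * (+ 2 * n * y) + - + 2 * (n * + 0) * v)) ≡ + 6 * p + + 24 * n * y
      lem₂ = solve-∀
      ι-6 : ∀ n → + 6 * ι P n ≡ ι (+ 6 * P) n
      ι-6 zero    = refl
      ι-6 (suc n) = refl

  -- Against h(n) = n^(2l+2) the cubic n³ - n splits into moments of orders 2l + 5 and 2l + 3; the
  -- former is the new one that the recursion solves for.
  products : + 6 • DS (λ a b → h (a + b) * (a * b) + - + 1 * (h (a - b) * (a * - b))) ≈
             C (suc (suc l)) ⊞ (- + 1) • C (suc l) ⊞ + 24 • (C (suc l) · Y)
  products =
    + 6 • DS (λ a b → h (a + b) * (a * b) + - + 1 * (h (a - b) * (a * - b)))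
      ≈⟨ ≈-trans (+ 6 ⟨•⟩ quadratic) (≈-sym (Σ∞-• (+ 6) (λ k → h (+ suc k) • (w (suc k) · bracket k)))) ⟩
    Σ∞ (λ k → + 6 • (h (+ suc k) • (w (suc k) · bracket k)))
      ≈⟨ Σ∞-cong term ⟩
    Σ∞ (λ k → U k ⊞ V k ⊞ + 24 • W k)
      ≈⟨ ≈-trans (Σ∞-⊞ (λ k → U k ⊞ V k) (λ k → + 24 • W k)) (⊞-cong (Σ∞-⊞ U V) (Σ∞-• (+ 24) W)) ⟩
    Σ∞ U ⊞ Σ∞ V ⊞ + 24 • Σ∞ W
      ≈⟨ ⊞-cong (⊞-cong (≈-refl {Σ∞ U}) (Σ∞-• (- + 1) (λ k → oddPower (suc l) (+ suc k) • w (suc k)))) (+ 24 ⟨•⟩ moment-·ʳ (oddPower (suc l)) Y) ⟩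
    C (suc (suc l)) ⊞ (- + 1) • C (suc l) ⊞ + 24 • (C (suc l) · Y) ∎ˢ
    where
    U V W : ℕ → Series
    U k = oddPower (suc (suc l)) (+ suc k) • w (suc k)
    V k = (- + 1) • (oddPower (suc l) (+ suc k) • w (suc k))
    W k = oddPower (suc l) (+ suc k) • (w (suc k) · Y)
    term : ∀ k → + 6 • (h (+ suc k) • (w (suc k) · bracket k)) ≈ U k ⊞ V k ⊞ + 24 • W k
    term k =
      + 6 • (h (+ suc k) • (w (suc k) · bracket k))
        ≈⟨ pw (λ N → swap (h n) ((w (suc k) · bracket k) N)) ⟩
      h n • (+ 6 • (w (suc k) · bracket k))
        ≈⟨ h n ⟨•⟩ ≈-trans (•-·ʳ (+ 6) (w (suc k)) (bracket k)) (w (suc k) ⟨·⟩ bracket-value k) ⟩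
      h n • (w (suc k) · (ι (n * (n * n) - n) ⊞ (+ 24 * n) • Y))
        ≈⟨ h n ⟨•⟩ ≈-trans (·-distribˡ (w (suc k)) (ι (n * (n * n) - n)) ((+ 24 * n) • Y))
             (⊞-cong (≈-trans (·-comm (w (suc k)) (ι (n * (n * n) - n))) (≈-sym (•≈ι· (n * (n * n) - n) (w (suc k)))))
                     (≈-sym (•-·ʳ (+ 24 * n) (w (suc k)) Y))) ⟩
      h n • ((n * (n * n) - n) • w (suc k) ⊞ (+ 24 * n) • (w (suc k) · Y))
        ≈⟨ pw (λ N → expand (n) ((n * n) ℤ.^ l) (w (suc k) N) ((w (suc k) · Y) N)) ⟩
      U k ⊞ V k ⊞ + 24 • W k ∎ˢ
      where
      n = + suc k
      swap : ∀ h u → + 6 * (h * u) ≡ h * (+ 6 * u)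
      swap = solve-∀
      expand : ∀ n p u v → (n * n * p) * ((n * (n * n) - n) * u + + 24 * n * v)
        ≡ ((n * ((n * n) * ((n * n) * p))) * u + - + 1 * ((n * ((n * n) * p)) * u)) + + 24 * ((n * ((n * n) * p)) * v)
      expand = solve-∀

-- The derivation q d/dq

D : Series → Series
D f n = + n * f n

D-cong : ∀ {f g} → f ≈ g → D f ≈ D g
D-cong p = pw λ n → + n ⟨*⟩ at p n

D-⊞ : ∀ f g → D (f ⊞ g) ≈ D f ⊞ D g
D-⊞ f g = pw λ n → ℤₚ.*-distribˡ-+ (+ n) (f n) (g n)

D-⊟ : ∀ f → D (⊟ f) ≈ ⊟ D f
D-⊟ f = pw λ n → sym (ℤₚ.neg-distribʳ-* (+ n) (f n))

D-ι : ∀ c → D (ι c) ≈ 𝟎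
D-ι c = pw λ { zero → refl ; (suc n) → ℤₚ.*-zeroʳ (+ suc n) }

D-· : ∀ f g → D (f · g) ≈ D f · g ⊞ f · D g
D-· f g = pw λ n → trans (sym (Σ-*ˡ (suc n) (+ n) (λ i → f i * g (n ∸ i))))
  (trans (Σ-cong< (suc n) λ i i≤n → trans (cong (λ m → + m * (f i * g (n ∸ i))) (sym (ℕₚ.m+[n∸m]≡n (ℕₚ.≤-pred i≤n))))
      (lem (+ i) (+ (n ∸ i)) (f i) (g (n ∸ i))))
    (Σ-+ (suc n) (λ i → + i * f i * g (n ∸ i)) (λ i → f i * (+ (n ∸ i) * g (n ∸ i)))))
  where
  lem : ∀ i j f g → (i + j) * (f * g) ≡ i * f * g + f * (j * g)
  lem = solve-∀

D-X : ∀ e → D (X e) ≈ ι (+ e) · X e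
D-X e = pw λ n → trans (go e n) (sym (ι-· (+ e) (X e) n))
  where
  go : ∀ e n → + n * X e n ≡ + e * X e n
  go zero    zero    = refl
  go zero    (suc n) = ℤₚ.*-zeroʳ (+ suc n)
  go (suc e) zero    = sym (ℤₚ.*-zeroʳ (+ suc e))
  go (suc e) (suc n) = trans (suc-* n (X e n)) (trans (cong (_+_ (X e n)) (go e n)) (sym (suc-* e (X e n))))
    where
    suc-* : ∀ m z → + suc m * z ≡ z + + m * z
    suc-* m z = trans (ℤₚ.*-distribʳ-+ z (+ 1) (+ m)) (cong (_+ + m * z) (ℤₚ.*-identityˡ z))

𝟎≈ι : 𝟎 ≈ ι 0ℤ
𝟎≈ι = pw λ { zero → refl ; (suc n) → refl }

-- Differentiate g (1 - x) = 1 and multiply by g.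
D-geo : ∀ e → D (geo (suc e)) ≈ ι (+ suc e) · (geo (suc e) · (X (suc e) · geo (suc e)))
D-geo e =
  D g ≈⟨ ≈-sym (≈-trans (·-comm (D g) (ι 1ℤ)) (·-identityˡ (D g))) ⟩
  D g · ι 1ℤ ≈⟨ D g ⟨·⟩ ≈-sym (geo-recip e) ⟩
  D g · (g · (ι 1ℤ ⊞ ⊟ x)) ≈⟨ solveˢ 4 (λ dg g x dx → dg :* (g :* (con 1ℤ :- x)) := (dg :* (con 1ℤ :- x) :- g :* dx) :* g :+ dx :* g :* g) ≈-refl (D g) g x (D x) ⟩
  (D g · (ι 1ℤ ⊞ ⊟ x) ⊞ ⊟ (g · D x)) · g ⊞ D x · g · g
    ≈⟨ ⊞-cong (·-cong (≈-trans derivative 𝟎≈ι) (≈-refl {g})) (·-cong (·-cong (D-X (suc e)) (≈-refl {g})) (≈-refl {g})) ⟩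
  ι 0ℤ · g ⊞ ι (+ suc e) · x · g · g
    ≈⟨ solveˢ 3 (λ c g x → con 0ℤ :* g :+ c :* x :* g :* g := c :* (g :* (x :* g))) ≈-refl (ι (+ suc e)) g x ⟩
  ι (+ suc e) · (g · (x · g)) ∎ˢ
  where
  g = geo (suc e)
  x = X (suc e)
  derivative : D g · (ι 1ℤ ⊞ ⊟ x) ⊞ ⊟ (g · D x) ≈ 𝟎
  derivative =
    D g · (ι 1ℤ ⊞ ⊟ x) ⊞ ⊟ (g · D x)
      ≈⟨ solveˢ 4 (λ dg g x dx → dg :* (con 1ℤ :- x) :- g :* dx := dg :* (con 1ℤ :- x) :+ g :* (con 0ℤ :- dx)) ≈-refl (D g) g x (D x) ⟩
    D g · (ι 1ℤ ⊞ ⊟ x) ⊞ g · (ι 0ℤ ⊞ ⊟ D x)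
      ≈⟨ (D g · (ι 1ℤ ⊞ ⊟ x)) ⟨⊞⟩ (g ⟨·⟩ ≈-sym (≈-trans (D-⊞ (ι 1ℤ) (⊟ x)) (⊞-cong (≈-trans (D-ι 1ℤ) 𝟎≈ι) (D-⊟ x)))) ⟩
    D g · (ι 1ℤ ⊞ ⊟ x) ⊞ g · D (ι 1ℤ ⊞ ⊟ x)
      ≈⟨ ≈-sym (D-· g (ι 1ℤ ⊞ ⊟ x)) ⟩
    D (g · (ι 1ℤ ⊞ ⊟ x))
      ≈⟨ ≈-trans (D-cong (geo-recip e)) (D-ι 1ℤ) ⟩
    𝟎 ∎ˢ

D-w : ∀ a → D (w (suc a)) ≈ + suc a • (w (suc a) · (ι 1ℤ ⊞ + 2 • y (suc a)))
D-w a =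
  D (x · g) ≈⟨ D-· x g ⟩
  D x · g ⊞ x · D g ≈⟨ ⊞-cong (·-cong (D-X (suc a)) (≈-refl {g})) (x ⟨·⟩ ≈-trans (D-geo (a ℕ.+ suc a)) (·-cong (ι-+ (+ suc a) (+ suc a)) (≈-refl {g · (xx · g)}))) ⟩
  (n · x) · g ⊞ x · ((n ⊞ n) · (g · (xx · g)))
    ≈⟨ solveˢ 4 (λ n x g xx → (n :* x) :* g :+ x :* ((n :+ n) :* (g :* (xx :* g))) :=
         n :* ((x :* g) :* (con 1ℤ :+ con (+ 2) :* (xx :* g)))) ≈-refl n x g xx ⟩
  n · ((x · g) · (ι 1ℤ ⊞ ι (+ 2) · (xx · g)))
    ≈⟨ ≈-sym (≈-trans (•≈ι· (+ suc a) (w (suc a) · (ι 1ℤ ⊞ + 2 • y (suc a)))) (n ⟨·⟩ (w (suc a) ⟨·⟩ (ι 1ℤ ⟨⊞⟩ •≈ι· (+ 2) (y (suc a)))))) ⟩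
  + suc a • (w (suc a) · (ι 1ℤ ⊞ + 2 • y (suc a))) ∎ˢ
  where
  n = ι (+ suc a)
  x = X (suc a)
  xx = X (suc a ℕ.+ suc a)
  g = geo (suc a ℕ.+ suc a)

module _ where
  private
    one₂ : ℤ → ℤ → ℤ
    one₂ _ _ = 1ℤ
  open Quadratic one₂ (λ _ _ → refl) (λ _ _ → refl) (evenPower 2) (evenPower-neg 2) refl
  open Convolution one₂ (λ _ _ → refl)

  private
    h = evenPower 2

    bracket-value : ∀ k → bracket k ≈ ι (+ k) ⊞ (- + 2) • y (suc k)
    bracket-value k = pw λ n → trans (cong₂ (λ u v → ι u n + (+ 2 * v + - + 2 * y (suc k) n)) (ones k) (Σ-zero (suc n) (λ e _ → refl)))
      (ι (+ k) n ⟨+⟩ ℤₚ.+-identityˡ (- + 2 * y (suc k) n))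
      where
      ones : ∀ k → Σ k (λ _ → 1ℤ) ≡ + k
      ones zero    = refl
      ones (suc k) = cong (λ z → 1ℤ + z) (ones k)

  -- For the constant kernel the coefficients of `y e` cancel and only n - 1 - 2 `y n` remains. The
  -- derivative of `w n` is n (1 + 2 `y n`) `w n`; with h(n) = n⁴ against n³ the `y n` cancel and n⁵
  -- `w n` is left.
  cubes : DS (λ a b → h (a + b) * 1ℤ + - + 1 * (h (a - b) * 1ℤ)) ⊞ D (C 1) ≈ C 2
  cubes =
    DS (λ a b → h (a + b) * 1ℤ + - + 1 * (h (a - b) * 1ℤ)) ⊞ D (C 1)
      ≈⟨ ⊞-cong quadratic D-C ⟩
    Σ∞ U ⊞ Σ∞ V ≈⟨ ≈-sym (Σ∞-⊞ U V) ⟩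
    Σ∞ (λ k → U k ⊞ V k) ≈⟨ Σ∞-cong term ⟩
    C 2 ∎ˢ
    where
    U V : ℕ → Series
    U k = h (+ suc k) • (w (suc k) · bracket k)
    V k = oddPower 1 (+ suc k) • D (w (suc k))
    D-C : D (C 1) ≈ Σ∞ V
    D-C = pw λ n → trans (sym (Σ-*ˡ (suc n) (+ n) (λ k → oddPower 1 (+ suc k) * w (suc k) n)))
      (Σ-cong (suc n) λ k → swap (+ n) (oddPower 1 (+ suc k)) (w (suc k) n))
      where
      swap : ∀ a b c → a * (b * c) ≡ b * (a * c)
      swap = solve-∀
    term : ∀ k → U k ⊞ V k ≈ oddPower 2 (+ suc k) • w (suc k)
    term k =
      h n • (w (suc k) · bracket k) ⊞ oddPower 1 n • D (w (suc k))
        ≈⟨ ⊞-cong (h n ⟨•⟩ (w (suc k) ⟨·⟩ bracket-value k)) (≈-trans (oddPower 1 n ⟨•⟩ D-w k) (pw λ N → regroup n (Z N))) ⟩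
      h n • (w (suc k) · (ι (+ k) ⊞ (- + 2) • y (suc k))) ⊞ h n • Z
        ≈⟨ pw (λ N → sym (ℤₚ.*-distribˡ-+ (h n) ((w (suc k) · (ι (+ k) ⊞ (- + 2) • y (suc k))) N) (Z N))) ⟩
      h n • (w (suc k) · (ι (+ k) ⊞ (- + 2) • y (suc k)) ⊞ Z)
        ≈⟨ h n ⟨•⟩ ≈-trans (≈-sym (·-distribˡ (w (suc k)) (ι (+ k) ⊞ (- + 2) • y (suc k)) (ι 1ℤ ⊞ + 2 • y (suc k))))
             (w (suc k) ⟨·⟩ pw λ N → trans (cancel (ι (+ k) N) (ι 1ℤ N) (y (suc k) N)) (sym (at (ι-+ (+ 1) (+ k)) N))) ⟩
      h n • (w (suc k) · ι n)
        ≈⟨ h n ⟨•⟩ ≈-trans (·-comm (w (suc k)) (ι n)) (≈-sym (•≈ι· n (w (suc k)))) ⟩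
      h n • (n • w (suc k))
        ≈⟨ pw (λ N → power n (w (suc k) N)) ⟩
      oddPower 2 n • w (suc k) ∎ˢ
      where
      n = + suc k
      Z = w (suc k) · (ι 1ℤ ⊞ + 2 • y (suc k))
      regroup : ∀ n z → (n * (n * n * + 1)) * (n * z) ≡ (n * n * (n * n * + 1)) * z
      regroup = solve-∀
      cancel : ∀ u v z → (u + - + 2 * z) + (v + + 2 * z) ≡ v + u
      cancel = solve-∀
      power : ∀ n z → (n * n * (n * n * + 1)) * (n * z) ≡ (n * (n * n * (n * n * + 1))) * z
      power = solve-∀

-- (a + b)^(2l+2) = evenPart l a² b² + a b · oddPart l a² b², and
-- evenPart l x y = x^(l+1) + y^(l+1) + x y · mixed l x y.
oddPart mixed : ℕ → ℤ → ℤ → ℤ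
oddPart zero    x y = + 2
oddPart (suc l) x y = (x + y) * oddPart l x y + + 2 * (x * x ℤ.^ l + y * y ℤ.^ l + x * y * mixed l x y)
mixed zero    x y = 0ℤ
mixed (suc l) x y = x ℤ.^ l + y ℤ.^ l + (x + y) * mixed l x y + + 2 * oddPart l x y

evenPower-+ : ∀ l a b → evenPower (suc l) (a + b) ≡
  (a * a) * (a * a) ℤ.^ l + (b * b) * (b * b) ℤ.^ l + (a * a) * (b * b) * mixed l (a * a) (b * b) + a * b * oddPart l (a * a) (b * b)
evenPower-+ zero    a b = base a b
  where
  base : ∀ a b → (a + b) * (a + b) * + 1 ≡ a * a * + 1 + b * b * + 1 + a * a * (b * b) * + 0 + a * b * + 2
  base = solve-∀
evenPower-+ (suc l) a b = trans (cong ((a + b) * (a + b) *_) (evenPower-+ l a b))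
  (step a b ((a * a) ℤ.^ l) ((b * b) ℤ.^ l) (mixed l (a * a) (b * b)) (oddPart l (a * a) (b * b)))
  where
  step : ∀ a b p r q o → (a + b) * (a + b) * ((a * a) * p + (b * b) * r + (a * a) * (b * b) * q + a * b * o) ≡
    (a * a) * ((a * a) * p) + (b * b) * ((b * b) * r) + (a * a) * (b * b) * (p + r + (a * a + b * b) * q + + 2 * o)
    + a * b * ((a * a + b * b) * o + + 2 * ((a * a) * p + (b * b) * r + (a * a) * (b * b) * q))
  step = solve-∀

-- The part of a b · evenPart in which both exponents are at least 3; it expands into products of
-- moments `C i` with i ≥ 1.
remainder : ℕ → ℤ → ℤ → ℤ
remainder l a b = oddPower 1 a * oddPower 1 b * mixed l (a * a) (b * b)

-- 2 E₂(q²) - E₂(q), the Eisenstein series of weight 2 for Γ₀(2): `C 0` + `Y` is (1 - E₂(q)) / 24.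
A : Series
A = ι 1ℤ ⊞ + 24 • C 0 ⊞ (- + 24) • Y

-- The integrand is a b (h(a + b) + h(a - b)), in which `oddPart` cancels and the even part doubles.
-- The pure powers a^(2l+2) and b^(2l+2) yield the two products with `C 0`.
DS-products : ∀ l → DS (λ a b → evenPower (suc l) (a + b) * (a * b) + - + 1 * (evenPower (suc l) (a - b) * (a * - b))) ≈
  + 2 • (C (suc l) · C 0 ⊞ C 0 · C (suc l) ⊞ DS (remainder l))
DS-products l =
  DS (λ a b → evenPower (suc l) (a + b) * (a * b) + - + 1 * (evenPower (suc l) (a - b) * (a * - b)))
    ≈⟨ DS-cong expand ⟩
  DS (λ a b → + 2 * (oddPower (suc l) a * oddPower 0 b + oddPower 0 a * oddPower (suc l) b + remainder l a b))
    ≈⟨ DS-* (+ 2) (λ a b → oddPower (suc l) a * oddPower 0 b + oddPower 0 a * oddPower (suc l) b + remainder l a b) ⟩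
  + 2 • DS (λ a b → oddPower (suc l) a * oddPower 0 b + oddPower 0 a * oddPower (suc l) b + remainder l a b)
    ≈⟨ + 2 ⟨•⟩ ≈-trans (DS-+ (λ a b → oddPower (suc l) a * oddPower 0 b + oddPower 0 a * oddPower (suc l) b) (remainder l))
         (⊞-cong (≈-trans (DS-+ (λ a b → oddPower (suc l) a * oddPower 0 b) (λ a b → oddPower 0 a * oddPower (suc l) b))
            (⊞-cong (DS-product (oddPower (suc l)) (oddPower 0)) (DS-product (oddPower 0) (oddPower (suc l))))) (≈-refl {DS (remainder l)})) ⟩
  + 2 • (C (suc l) · C 0 ⊞ C 0 · C (suc l) ⊞ DS (remainder l)) ∎ˢ
  where
  expand : ∀ a b → evenPower (suc l) (a + b) * (a * b) + - + 1 * (evenPower (suc l) (a - b) * (a * - b)) ≡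
    + 2 * (oddPower (suc l) a * oddPower 0 b + oddPower 0 a * oddPower (suc l) b + remainder l a b)
  expand a b = trans (cong₂ (λ u v → u * (a * b) + - + 1 * (v * (a * - b))) (evenPower-+ l a b) minus)
    (lem a b ((a * a) ℤ.^ l) ((b * b) ℤ.^ l) (mixed l (a * a) (b * b)) (oddPart l (a * a) (b * b)))
    where
    sq : ∀ b → - b * - b ≡ b * b
    sq = solve-∀
    minus : evenPower (suc l) (a - b) ≡ (a * a) * (a * a) ℤ.^ l + (b * b) * (b * b) ℤ.^ l + (a * a) * (b * b) * mixed l (a * a) (b * b) + a * - b * oddPart l (a * a) (b * b)
    minus = trans (evenPower-+ l a (- b))
      (cong (λ y → (a * a) * (a * a) ℤ.^ l + y * y ℤ.^ l + (a * a) * y * mixed l (a * a) y + a * - b * oddPart l (a * a) y) (sq b))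
    lem : ∀ a b p r q o → ((a * a) * p + (b * b) * r + (a * a) * (b * b) * q + a * b * o) * (a * b)
      + - + 1 * (((a * a) * p + (b * b) * r + (a * a) * (b * b) * q + a * - b * o) * (a * - b)) ≡
      + 2 * ((a * ((a * a) * p)) * (b * + 1) + (a * + 1) * (b * ((b * b) * r)) + (a * (a * a * + 1)) * (b * (b * b * + 1)) * q)
    lem = solve-∀

-- Equates the two values of the double sum, `DS-products` and `products`. The terms in `C 0` and
-- `Y` both multiply `C (suc l)` and merge with it into `A`.
recurrence : ∀ l → C (suc (suc l)) ≈ A · C (suc l) ⊞ + 12 • DS (remainder l)
recurrence l = pw λ n → begin
  C (suc (suc l)) n
    ≡⟨ solve-for (C (suc (suc l)) n) (C (suc l) n) ((C (suc l) · Y) n) ((C (suc l) · C 0) n) ((C 0 · C (suc l)) n) (DS (remainder l) n)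
         (trans (sym (cong (+ 6 *_) (at (DS-products l) n))) (at (Products.products l) n)) ⟩
  + 6 * (+ 2 * ((C (suc l) · C 0) n + (C 0 · C (suc l)) n + DS (remainder l) n)) + C (suc l) n + - + 24 * (C (suc l) · Y) n
    ≡⟨ cong₂ (λ u v → + 6 * (+ 2 * (u + (C 0 · C (suc l)) n + DS (remainder l) n)) + C (suc l) n + - + 24 * v)
         (at (·-comm (C (suc l)) (C 0)) n) (at (·-comm (C (suc l)) Y) n) ⟩
  + 6 * (+ 2 * ((C 0 · C (suc l)) n + (C 0 · C (suc l)) n + DS (remainder l) n)) + C (suc l) n + - + 24 * (Y · C (suc l)) n
    ≡⟨ collect ((C 0 · C (suc l)) n) (DS (remainder l) n) (C (suc l) n) ((Y · C (suc l)) n) ⟩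
  (C (suc l) n + + 24 * (C 0 · C (suc l)) n + - + 24 * (Y · C (suc l)) n) + + 12 * DS (remainder l) n
    ≡⟨ cong (_+ + 12 * DS (remainder l) n) (sym (trans (at (·-distribʳ (C (suc l)) (ι 1ℤ ⊞ + 24 • C 0) ((- + 24) • Y)) n)
         (cong₂ _+_ (trans (at (·-distribʳ (C (suc l)) (ι 1ℤ) (+ 24 • C 0)) n)
            (cong₂ _+_ (at (·-identityˡ (C (suc l))) n) (at (•-·ˡ (+ 24) (C 0) (C (suc l))) n)))
            (at (•-·ˡ (- + 24) Y (C (suc l))) n)))) ⟩
  (A · C (suc l)) n + + 12 * DS (remainder l) n ∎
  where
  solve-for : ∀ c₂ c₁ cy u v r → + 6 * (+ 2 * (u + v + r)) ≡ (c₂ + - + 1 * c₁) + + 24 * cy → c₂ ≡ + 6 * (+ 2 * (u + v + r)) + c₁ + - + 24 * cy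
  solve-for c₂ c₁ cy u v r e = trans (lem c₂ c₁ cy) (cong (λ z → z + c₁ + - + 24 * cy) (sym e))
    where
    lem : ∀ c₂ c₁ cy → c₂ ≡ ((c₂ + - + 1 * c₁) + + 24 * cy) + c₁ + - + 24 * cy
    lem = solve-∀
  collect : ∀ u r c z → + 6 * (+ 2 * (u + u + r)) + c + - + 24 * z ≡ (c + + 24 * u + - + 24 * z) + + 12 * r
  collect = solve-∀

-- Since (a + b)⁴ - (a - b)⁴ = 8 (a³ b + a b³), `cubes` says D C₁ = C₂ - 16 C₀ C₁, and C₂ = A C₁
-- because `remainder 0` vanishes.
D-C₁ : D (C 1) ≈ (ι 1ℤ ⊞ + 8 • (C 0 ⊞ (- + 3) • Y)) · C 1
D-C₁ = pw λ n → begin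
  D (C 1) n
    ≡⟨ isolate (DS φ n) (D (C 1) n) (C 2 n) (at cubes n) ⟩
  C 2 n + - DS φ n
    ≡⟨ cong₂ (λ u v → u + - v) (trans (at (recurrence 0) n) (cong (λ z → (A · C 1) n + + 12 * z)
         (Σ-zero (suc n) λ a _ → Σ-zero (suc n) λ b _ → cong (_* ww a b n) (ℤₚ.*-zeroʳ (oddPower 1 (+ suc a) * oddPower 1 (+ suc b)))))) (at DS-φ n) ⟩
  (A · C 1) n + + 12 * 0ℤ + - (+ 16 * (C 0 · C 1) n)
    ≡⟨ cong (λ u → u + + 12 * 0ℤ + - (+ 16 * (C 0 · C 1) n)) (trans (at (·-cong A-ι (≈-refl {C 1})) n) refl) ⟩
  ((ι 1ℤ ⊞ ι (+ 24) · C 0 ⊞ ι (- + 24) · Y) · C 1) n + + 12 * 0ℤ + - (+ 16 * (C 0 · C 1) n)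
    ≡⟨ cong₂ (λ u v → ((ι 1ℤ ⊞ ι (+ 24) · C 0 ⊞ ι (- + 24) · Y) · C 1) n + u + - v) (ℤₚ.*-zeroʳ (+ 12)) (sym (ι-· (+ 16) (C 0 · C 1) n)) ⟩
  ((ι 1ℤ ⊞ ι (+ 24) · C 0 ⊞ ι (- + 24) · Y) · C 1) n + 0ℤ + - (ι (+ 16) · (C 0 · C 1)) n
    ≡⟨ cong (_+ - (ι (+ 16) · (C 0 · C 1)) n) (ℤₚ.+-identityʳ (((ι 1ℤ ⊞ ι (+ 24) · C 0 ⊞ ι (- + 24) · Y) · C 1) n)) ⟩
  ((ι 1ℤ ⊞ ι (+ 24) · C 0 ⊞ ι (- + 24) · Y) · C 1) n + - (ι (+ 16) · (C 0 · C 1)) n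
    ≡⟨ at (solveˢ 3 (λ c y b → (con 1ℤ :+ con (+ 24) :* c :+ con (- + 24) :* y) :* b :- con (+ 16) :* (c :* b) :=
         (con 1ℤ :+ con (+ 8) :* (c :+ con (- + 3) :* y)) :* b) ≈-refl (C 0) Y (C 1)) n ⟩
  ((ι 1ℤ ⊞ ι (+ 8) · (C 0 ⊞ ι (- + 3) · Y)) · C 1) n
    ≡⟨ sym (at (·-cong (ι 1ℤ ⟨⊞⟩ ≈-trans (•≈ι· (+ 8) (C 0 ⊞ (- + 3) • Y)) (ι (+ 8) ⟨·⟩ (C 0 ⟨⊞⟩ •≈ι· (- + 3) Y))) (≈-refl {C 1})) n) ⟩
  ((ι 1ℤ ⊞ + 8 • (C 0 ⊞ (- + 3) • Y)) · C 1) n ∎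
  where
  φ : ℤ → ℤ → ℤ
  φ a b = evenPower 2 (a + b) * 1ℤ + - + 1 * (evenPower 2 (a - b) * 1ℤ)
  isolate : ∀ a b c → a + b ≡ c → b ≡ c + - a
  isolate a b c refl = lem a b
    where
    lem : ∀ a b → b ≡ (a + b) + - a
    lem = solve-∀
  A-ι : A ≈ ι 1ℤ ⊞ ι (+ 24) · C 0 ⊞ ι (- + 24) · Y
  A-ι = ⊞-cong (ι 1ℤ ⟨⊞⟩ •≈ι· (+ 24) (C 0)) (•≈ι· (- + 24) Y)
  DS-φ : DS φ ≈ + 16 • (C 0 · C 1)
  DS-φ =
    DS φ ≈⟨ DS-cong expand ⟩
    DS (λ a b → + 8 * (oddPower 1 a * oddPower 0 b + oddPower 0 a * oddPower 1 b))
      ≈⟨ DS-* (+ 8) (λ a b → oddPower 1 a * oddPower 0 b + oddPower 0 a * oddPower 1 b) ⟩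
    + 8 • DS (λ a b → oddPower 1 a * oddPower 0 b + oddPower 0 a * oddPower 1 b)
      ≈⟨ + 8 ⟨•⟩ ≈-trans (DS-+ (λ a b → oddPower 1 a * oddPower 0 b) (λ a b → oddPower 0 a * oddPower 1 b))
           (⊞-cong (≈-trans (DS-product (oddPower 1) (oddPower 0)) (·-comm (C 1) (C 0))) (DS-product (oddPower 0) (oddPower 1))) ⟩
    + 8 • (C 0 · C 1 ⊞ C 0 · C 1)
      ≈⟨ pw (λ n → double ((C 0 · C 1) n)) ⟩
    + 16 • (C 0 · C 1) ∎ˢ
    where
    double : ∀ u → + 8 * (u + u) ≡ + 16 * u
    double = solve-∀
    expand : ∀ a b → φ a b ≡ + 8 * (oddPower 1 a * oddPower 0 b + oddPower 0 a * oddPower 1 b)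
    expand = lem
      where
      lem : ∀ a b → ((a + b) * (a + b) * ((a + b) * (a + b) * + 1)) * + 1 + - + 1 * (((a - b) * (a - b) * ((a - b) * (a - b) * + 1)) * + 1)
        ≡ + 8 * ((a * (a * a * + 1)) * (b * + 1) + (a * + 1) * (b * (b * b * + 1)))
      lem = solve-∀

-- Triangular numbers

T : ℕ → ℕ
T zero    = 0
T (suc n) = suc n ℕ.+ T n

-- z (z + 1) / 2 for all z : ℤ
Tz : ℤ → ℕ
Tz (+ n)    = T n
Tz -[1+ n ] = T n

t : ℤ → Series
t z = X (Tz z)

2*T : ∀ n → + 2 * + T n ≡ + n * (+ n + 1ℤ)
2*T zero    = refl
2*T (suc n) = trans (ℤₚ.*-distribˡ-+ (+ 2) (+ suc n) (+ T n)) (trans ((+ 2 * + suc n) ⟨+⟩ 2*T n) (lem (+ n)))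
  where
  lem : ∀ n → + 2 * (+ 1 + n) + n * (n + + 1) ≡ (+ 1 + n) * (+ 1 + n + + 1)
  lem = solve-∀

2*Tz : ∀ z → + 2 * + Tz z ≡ z * (z + 1ℤ)
2*Tz (+ n)    = 2*T n
2*Tz -[1+ n ] = trans (2*T n) (lem (+ n))
  where
  lem : ∀ n → n * (n + + 1) ≡ - (+ 1 + n) * (- (+ 1 + n) + + 1)
  lem = solve-∀

-- T(z + 1) = T(z) + (z + 1), with the possibly negative z + 1 written as m - r so that all
-- exponents of q are natural numbers.
Tz-suc : ∀ z r m → (z + 1ℤ) + + r ≡ + m → Tz (z + 1ℤ) ℕ.+ r ≡ Tz z ℕ.+ m
Tz-suc z r m e = ℤₚ.+-injective (ℤₚ.*-cancelˡ-≡ (+ 2) (+ (Tz (z + 1ℤ) ℕ.+ r)) (+ (Tz z ℕ.+ m)) (begin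
  + 2 * (+ Tz (z + 1ℤ) + + r)                        ≡⟨ ℤₚ.*-distribˡ-+ (+ 2) (+ Tz (z + 1ℤ)) (+ r) ⟩
  + 2 * + Tz (z + 1ℤ) + + 2 * + r                    ≡⟨ cong (_+ + 2 * + r) (2*Tz (z + 1ℤ)) ⟩
  (z + 1ℤ) * (z + 1ℤ + 1ℤ) + + 2 * + r               ≡⟨ lem z (+ r) ⟩
  z * (z + 1ℤ) + + 2 * ((z + 1ℤ) + + r)              ≡⟨ cong₂ (λ u v → u + + 2 * v) (sym (2*Tz z)) e ⟩
  + 2 * + Tz z + + 2 * + m                           ≡⟨ sym (ℤₚ.*-distribˡ-+ (+ 2) (+ Tz z) (+ m)) ⟩
  + 2 * (+ Tz z + + m) ∎))
  where
  lem : ∀ z r → (z + + 1) * (z + + 1 + + 1) + + 2 * r ≡ z * (z + + 1) + + 2 * ((z + + 1) + r)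
  lem = solve-∀

n≤T : ∀ n → n ≤ T n
n≤T zero    = z≤n
n≤T (suc n) = ℕₚ.m≤m+n (suc n) (T n)

-- Shows that the factor q^r makes t(n - r) summable over n; the next bound does the same over r
-- with the factor q^(n+1).
n≤r+Tz : ∀ n r → n ≤ r ℕ.+ Tz (+ n - + r)
n≤r+Tz n r = ℤₚ.drop‿+≤+ (ℤₚ.≤-trans (ℤₚ.≤-reflexive (lem (+ n) (+ r))) (ℤₚ.+-monoʳ-≤ (+ r) (z≤Tz (+ n - + r))))
  where
  z≤Tz : ∀ z → z ℤ.≤ + Tz z
  z≤Tz (+ n)    = ℤ.+≤+ (n≤T n)
  z≤Tz -[1+ n ] = ℤ.-≤+
  lem : ∀ n r → n ≡ r + (n - r)
  lem = solve-∀

r≤1+n+Tz : ∀ n r → r ≤ suc n ℕ.+ Tz (+ n - + r)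
r≤1+n+Tz n r = ℤₚ.drop‿+≤+ (ℤₚ.≤-trans (ℤₚ.≤-reflexive (lem (+ n) (+ r))) (ℤₚ.+-monoʳ-≤ (+ suc n) (-z≤Tz (+ n - + r))))
  where
  -z≤Tz : ∀ z → - z - + 1 ℤ.≤ + Tz z
  -z≤Tz (+ zero)  = ℤ.-≤+
  -z≤Tz (+ suc n) = ℤ.-≤+
  -z≤Tz -[1+ n ]  = ℤ.+≤+ (n≤T n)
  lem : ∀ n r → r ≡ + 1 + n + (- (n - r) - + 1)
  lem = solve-∀

Ord-X·t : ∀ a z i → i ≤ a ℕ.+ Tz z → Ord i (X a · t z)
Ord-X·t a z i le = Ord-≤ le (Ord-· (Ord-X a) (Ord-X (Tz z)))

X-t-suc : ∀ z r m → (z + 1ℤ) + + r ≡ + m → X r · t (z + 1ℤ) ≈ X m · t z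
X-t-suc z r m e =
  X r · t (z + 1ℤ)          ≈⟨ X-+ r (Tz (z + 1ℤ)) ⟩
  X (r ℕ.+ Tz (z + 1ℤ))     ≈⟨ ≡⇒≈ (cong X (trans (ℕₚ.+-comm r (Tz (z + 1ℤ))) (trans (Tz-suc z r m e) (ℕₚ.+-comm (Tz z) m)))) ⟩
  X (m ℕ.+ Tz z)            ≈⟨ ≈-sym (X-+ m (Tz z)) ⟩
  X m · t z                 ∎ˢ

-- The logarithmic derivative of the series of triangular numbers

sgn : ℕ → ℤ
sgn = minusOnePow

Σ∞-⊟ : ∀ F → Σ∞ (λ i → ⊟ F i) ≈ ⊟ Σ∞ F
Σ∞-⊟ F = pw λ n → trans (Σ-cong (suc n) λ i → sym (ℤₚ.-1*i≡-i (F i n)))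
  (trans (Σ-*ˡ (suc n) (- + 1) (λ i → F i n)) (ℤₚ.-1*i≡-i (Σ∞ F n)))

-- Σ_{r ∈ ℤ} (-1)^r q^{T (n + r)} = 0; the factor q^n makes the family summable.
alternating : ℕ → Series
alternating n = Σ∞ (λ i → sgn i • (X n · (t (+ n - + suc i) ⊞ t (+ n + + suc i))))

-- Behind it is the reflection T(-1 - z) = T(z), which changes the parity of z. At n = 0 the sum
-- telescopes; from n to n + 1 all terms move by one place and change sign, up to the two boundary
-- terms `P 0` and `W 0`.
alternating-t : ∀ n → alternating n ≈ X n · t (+ n)
alternating-t zero =
  Σ∞ (λ i → sgn i • (X 0 · (X (T i) ⊞ X (T (suc i)))))
    ≈⟨ Σ∞-cong (λ i → ≈-trans (sgn i ⟨•⟩ ≈-trans (·-cong X-0 (≈-refl {X (T i) ⊞ X (T (suc i))})) (·-identityˡ (X (T i) ⊞ X (T (suc i)))))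
         (pw λ n → expand (sgn i) (X (T i) n) (X (T (suc i)) n))) ⟩
  Σ∞ (λ i → Q i ⊞ ⊟ Q (suc i))
    ≈⟨ ≈-trans (Σ∞-⊞ Q (λ i → ⊟ Q (suc i))) (Σ∞ Q ⟨⊞⟩ Σ∞-⊟ (λ i → Q (suc i))) ⟩
  Σ∞ Q ⊞ ⊟ Σ∞ (λ i → Q (suc i))
    ≈⟨ ⊞-cong (Σ∞-suc {Q} (λ i → Ord-• (sgn i) (Ord-≤ (n≤T i) (Ord-X (T i))))) (≈-refl {⊟ Σ∞ (λ i → Q (suc i))}) ⟩
  Q 0 ⊞ Σ∞ (λ i → Q (suc i)) ⊞ ⊟ Σ∞ (λ i → Q (suc i))
    ≈⟨ pw (λ n → cancel (X 0 n) (Σ∞ (λ i → Q (suc i)) n)) ⟩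
  X 0
    ≈⟨ ≈-sym (≈-trans (·-cong X-0 (≈-refl {X 0})) (·-identityˡ (X 0))) ⟩
  X 0 · X 0 ∎ˢ
  where
  Q : ℕ → Series
  Q i = sgn i • X (T i)
  expand : ∀ s a b → s * (a + b) ≡ s * a + - (- s * b)
  expand = solve-∀
  cancel : ∀ a b → + 1 * a + b + - b ≡ a
  cancel = solve-∀
alternating-t (suc n) =
  Σ∞ (λ i → sgn i • (X (suc n) · (t (+ suc n - + suc i) ⊞ t (+ suc n + + suc i))))
    ≈⟨ Σ∞-cong split ⟩
  Σ∞ (λ i → P i ⊞ ⊟ W (suc i))
    ≈⟨ ≈-trans (Σ∞-⊞ P (λ i → ⊟ W (suc i))) (⊞-cong (Σ∞-suc summable-P) (Σ∞-⊟ (λ i → W (suc i)))) ⟩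
  P 0 ⊞ Σ∞ (λ i → P (suc i)) ⊞ ⊟ Σ∞ (λ i → W (suc i))
    ≈⟨ pw (λ k → rotate (P 0 k) (Σ∞ (λ i → P (suc i)) k) (W 0 k) (Σ∞ (λ i → W (suc i)) k)) ⟩
  P 0 ⊞ W 0 ⊞ (Σ∞ (λ i → P (suc i)) ⊞ ⊟ (W 0 ⊞ Σ∞ (λ i → W (suc i))))
    ≈⟨ (P 0 ⊞ W 0) ⟨⊞⟩ (Σ∞ (λ i → P (suc i)) ⟨⊞⟩ ⊟-cong (≈-sym (Σ∞-suc summable-W))) ⟩
  P 0 ⊞ W 0 ⊞ (Σ∞ (λ i → P (suc i)) ⊞ ⊟ Σ∞ W)
    ≈⟨ (P 0 ⊞ W 0) ⟨⊞⟩ ≈-trans (≈-trans (Σ∞ (λ i → P (suc i)) ⟨⊞⟩ ≈-sym (Σ∞-⊟ W)) (≈-sym (Σ∞-⊞ (λ i → P (suc i)) (λ i → ⊟ W i))))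
         (≈-trans (Σ∞-cong join) (≈-trans (Σ∞-⊟ (λ i → X 1 · S i)) (⊟-cong (≈-trans (Σ∞-·ˡ (X 1) S summable-S) (X 1 ⟨·⟩ alternating-t n))))) ⟩
  P 0 ⊞ W 0 ⊞ ⊟ (X 1 · (X n · t (+ n)))
    ≈⟨ (P 0 ⊞ W 0) ⟨⊞⟩ ⊟-cong (≈-trans (≈-sym (·-assoc (X 1) (X n) (t (+ n)))) (·-cong (X-+ 1 n) (≈-refl {t (+ n)}))) ⟩
  P 0 ⊞ W 0 ⊞ ⊟ (X (suc n) · t (+ n))
    ≈⟨ pw (λ k → trans (cong₂ (λ u v → + 1 * u + + 1 * v + - (X (suc n) · t (+ n)) k) (cong (λ z → (X (suc n) · t z) k) (ℤₚ.+-identityʳ (+ n)))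
                   (cong (λ z → (X (suc n) · t z) k) (ℤₚ.+-identityʳ (+ suc n)))) (cancel ((X (suc n) · t (+ n)) k) ((X (suc n) · t (+ suc n)) k))) ⟩
  X (suc n) · t (+ suc n) ∎ˢ
  where
  P W S : ℕ → Series
  P i = sgn i • (X (suc n) · t (+ n - + i))
  W i = sgn i • (X (suc n) · t (+ suc n + + i))
  S i = sgn i • (X n · (t (+ n - + suc i) ⊞ t (+ n + + suc i)))
  summable-P : Summable P
  summable-P i = Ord-• (sgn i) (Ord-X·t (suc n) (+ n - + i) i (r≤1+n+Tz n i))
  i≤Tz : ∀ m i → i ≤ Tz (+ m + + i)
  i≤Tz m i = ℕₚ.≤-trans (ℕₚ.m≤n+m i m) (n≤T (m ℕ.+ i))
  summable-W : Summable W
  summable-W i = Ord-• (sgn i) (Ord-X·t (suc n) (+ suc n + + i) i (ℕₚ.≤-trans (i≤Tz (suc n) i) (ℕₚ.m≤n+m _ (suc n))))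
  summable-S : Summable S
  summable-S i = Ord-• (sgn i) (Ord-resp (≈-sym (·-distribˡ (X n) (t (+ n - + suc i)) (t (+ n + + suc i))))
    (Ord-⊞ (Ord-X·t n (+ n - + suc i) i (ℕₚ.≤-pred (r≤1+n+Tz n (suc i))))
           (Ord-X·t n (+ n + + suc i) i (ℕₚ.≤-trans (ℕₚ.≤-trans (ℕₚ.n≤1+n i) (i≤Tz n (suc i))) (ℕₚ.m≤n+m _ n)))))
  split : ∀ i → sgn i • (X (suc n) · (t (+ suc n - + suc i) ⊞ t (+ suc n + + suc i))) ≈ P i ⊞ ⊟ W (suc i)
  split i = pw λ k → trans (cong (sgn i *_) (at (·-distribˡ (X (suc n)) (t (+ suc n - + suc i)) (t (+ suc n + + suc i))) k))
    (trans (cong (λ z → sgn i * ((X (suc n) · t z) k + (X (suc n) · t (+ suc n + + suc i)) k)) (lem (+ n) (+ i)))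
      (expand (sgn i) ((X (suc n) · t (+ n - + i)) k) ((X (suc n) · t (+ suc n + + suc i)) k)))
    where
    lem : ∀ n i → + 1 + n - (+ 1 + i) ≡ n - i
    lem = solve-∀
    expand : ∀ s a b → s * (a + b) ≡ s * a + - (- s * b)
    expand = solve-∀
  join : ∀ i → P (suc i) ⊞ ⊟ W i ≈ ⊟ (X 1 · S i)
  join i = pw λ k → trans (cong (λ z → - sgn i * (X (suc n) · t (+ n - + suc i)) k + - (sgn i * (X (suc n) · t z) k)) (lem (+ n) (+ i)))
      (trans (expand (sgn i) ((X (suc n) · t (+ n - + suc i)) k) ((X (suc n) · t (+ n + + suc i)) k))
        (cong -_ (sym (at (≈-trans (≈-sym (•-·ʳ (sgn i) (X 1) (X n · R))) (sgn i ⟨•⟩ (≈-trans (≈-sym (·-assoc (X 1) (X n) R))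
           (≈-trans (·-cong (X-+ 1 n) (≈-refl {R})) (·-distribˡ (X (suc n)) (t (+ n - + suc i)) (t (+ n + + suc i))))))) k))))
    where
    R = t (+ n - + suc i) ⊞ t (+ n + + suc i)
    lem : ∀ n i → + 1 + n + i ≡ n + (+ 1 + i)
    lem = solve-∀
    expand : ∀ s a b → - s * a + - (s * b) ≡ - (s * (a + b))
    expand = solve-∀
  rotate : ∀ p a w b → p + a + - b ≡ p + w + (a + - (w + b))
  rotate = solve-∀
  cancel : ∀ a b → + 1 * a + + 1 * b + - a ≡ b
  cancel = solve-∀

-- With r = i + 1 this is (-1)^(r-1) (q^r t(n - r) - t(n + r)) / (1 - q^r).
vterm : ℕ → ℕ → Series
vterm n i = sgn i • (geo (suc i) · (X (suc i) · t (+ n - + suc i) ⊞ ⊟ t (+ n + + suc i)))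

Ord-t-far : ∀ n i → Ord i (t (+ n + + suc i))
Ord-t-far n i = Ord-≤ (ℕₚ.≤-trans (ℕₚ.≤-trans (ℕₚ.n≤1+n i) (ℕₚ.m≤n+m (suc i) n)) (n≤T (n ℕ.+ suc i))) (Ord-X (Tz (+ n + + suc i)))

summable-vterm : ∀ n → Summable (vterm n)
summable-vterm n i = Ord-• (sgn i) (Ord-resp (·-comm u (geo (suc i))) (Ord-·ʳ (geo (suc i))
  (Ord-⊞ (Ord-≤ (ℕₚ.n≤1+n i) (Ord-·ʳ (t (+ n - + suc i)) (Ord-X (suc i)))) (Ord-⊟ (Ord-t-far n i)))))
  where
  u = X (suc i) · t (+ n - + suc i) ⊞ ⊟ t (+ n + + suc i)

-- At n = 0 each term vanishes, as q^r t(-r) = t(r). Replacing n by n + 1 multiplies a term by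
-- q^(n+1) up to an error with the factor 1 - q^r. This cancels the denominator, and the errors form
-- the alternating sum, which contributes one more t(n + 1).
vsum : ∀ n → Σ∞ (vterm n) ≈ + n • t (+ n)
vsum zero = pw λ n → Σ-zero (suc n) λ i _ → trans (cong (sgn i *_) (trans (at (geo (suc i) ⟨·⟩ vanish i) n) (at (zeroʳ (geo (suc i))) n))) (ℤₚ.*-zeroʳ (sgn i))
  where
  zeroʳ : ∀ f → f · 𝟎 ≈ 𝟎
  zeroʳ f = pw λ n → Σ-zero (suc n) λ i _ → ℤₚ.*-zeroʳ (f i)
  vanish : ∀ i → X (suc i) · X (T i) ⊞ ⊟ X (T (suc i)) ≈ 𝟎
  vanish i = pw λ n → trans (cong (_+ - X (T (suc i)) n) (at (X-+ (suc i) (T i)) n)) (ℤₚ.+-inverseʳ (X (T (suc i)) n))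
vsum (suc n) =
  Σ∞ (vterm (suc n))
    ≈⟨ Σ∞-cong step ⟩
  Σ∞ (λ i → N · vterm n i ⊞ X 1 · S i)
    ≈⟨ ≈-trans (Σ∞-⊞ (λ i → N · vterm n i) (λ i → X 1 · S i)) (⊞-cong (Σ∞-·ˡ N (vterm n) (summable-vterm n)) (Σ∞-·ˡ (X 1) S summable-S)) ⟩
  N · Σ∞ (vterm n) ⊞ X 1 · alternating n
    ≈⟨ ⊞-cong (N ⟨·⟩ ≈-trans (vsum n) (•≈ι· (+ n) (t (+ n)))) (≈-trans (X 1 ⟨·⟩ alternating-t n) (≈-trans (≈-sym (·-assoc (X 1) (X n) (t (+ n)))) (·-cong (X-+ 1 n) (≈-refl {t (+ n)})))) ⟩
  N · (ι (+ n) · t (+ n)) ⊞ N · t (+ n)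
    ≈⟨ solveˢ 3 (λ N c t → N :* (c :* t) :+ N :* t := (con 1ℤ :+ c) :* (N :* t)) ≈-refl N (ι (+ n)) (t (+ n)) ⟩
  (ι 1ℤ ⊞ ι (+ n)) · (N · t (+ n))
    ≈⟨ ·-cong (≈-sym (ι-+ (+ 1) (+ n))) (X-+ (suc n) (T n)) ⟩
  ι (+ suc n) · t (+ suc n)
    ≈⟨ ≈-sym (•≈ι· (+ suc n) (t (+ suc n))) ⟩
  + suc n • t (+ suc n) ∎ˢ
  where
  N = X (suc n)
  S : ℕ → Series
  S i = sgn i • (X n · (t (+ n - + suc i) ⊞ t (+ n + + suc i)))
  summable-S : Summable S
  summable-S i = Ord-• (sgn i) (Ord-resp (≈-sym (·-distribˡ (X n) (t (+ n - + suc i)) (t (+ n + + suc i))))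
    (Ord-⊞ (Ord-X·t n (+ n - + suc i) i (ℕₚ.≤-pred (r≤1+n+Tz n (suc i))))
           (Ord-≤ (ℕₚ.m≤n+m i n) (Ord-· {f = X n} {g = t (+ n + + suc i)} (Ord-X n) (Ord-t-far n i)))))
  step : ∀ i → vterm (suc n) i ≈ N · vterm n i ⊞ X 1 · S i
  step i =
    sgn i • (g · (x · t (+ suc n - + suc i) ⊞ ⊟ t (+ suc n + + suc i)))
      ≈⟨ ≈-trans (•≈ι· (sgn i) (g · (x · t (+ suc n - + suc i) ⊞ ⊟ t (+ suc n + + suc i)))) (s ⟨·⟩ (g ⟨·⟩ ⊞-cong near (⊟-cong far))) ⟩
    s · (g · (N · a ⊞ ⊟ ((N · x) · b)))
      ≈⟨ solveˢ 6 (λ s g N x a b → s :* (g :* (N :* a :- (N :* x) :* b)) :=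
           N :* (s :* (g :* (x :* a :- b))) :+ N :* (s :* ((g :* (con 1ℤ :- x)) :* (a :+ b)))) ≈-refl s g N x a b ⟩
    N · (s · (g · (x · a ⊞ ⊟ b))) ⊞ N · (s · ((g · (ι 1ℤ ⊞ ⊟ x)) · (a ⊞ b)))
      ≈⟨ ⊞-cong (N ⟨·⟩ ≈-sym (•≈ι· (sgn i) (g · (x · a ⊞ ⊟ b)))) (·-cong (≈-sym (X-+ 1 n)) (s ⟨·⟩ ≈-trans (·-cong (geo-recip i) (≈-refl {a ⊞ b})) (·-identityˡ (a ⊞ b)))) ⟩
    N · vterm n i ⊞ (X 1 · X n) · (s · (a ⊞ b))
      ≈⟨ (N · vterm n i) ⟨⊞⟩ solveˢ 4 (λ u v s c → (u :* v) :* (s :* c) := u :* (s :* (v :* c))) ≈-refl (X 1) (X n) s (a ⊞ b) ⟩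
    N · vterm n i ⊞ X 1 · (s · (X n · (a ⊞ b)))
      ≈⟨ (N · vterm n i) ⟨⊞⟩ (X 1 ⟨·⟩ ≈-sym (•≈ι· (sgn i) (X n · (a ⊞ b)))) ⟩
    N · vterm n i ⊞ X 1 · S i ∎ˢ
    where
    s = ι (sgn i)
    g = geo (suc i)
    x = X (suc i)
    a = t (+ n - + suc i)
    b = t (+ n + + suc i)
    lem₁ : ∀ n i → + 1 + n - (+ 1 + i) ≡ n - (+ 1 + i) + + 1
    lem₁ = solve-∀
    lem₂ : ∀ n i → n - (+ 1 + i) + + 1 + (+ 1 + i) ≡ + 1 + n
    lem₂ = solve-∀
    lem₃ : ∀ n i → + 1 + n + (+ 1 + i) ≡ (n + (+ 1 + i)) + + 1
    lem₃ = solve-∀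
    lem₄ : ∀ n i → n + (+ 1 + i) + + 1 + + 0 ≡ + 1 + n + (+ 1 + i)
    lem₄ = solve-∀
    near : x · t (+ suc n - + suc i) ≈ N · a
    near = ≈-trans (x ⟨·⟩ ≡⇒≈ (cong t (lem₁ (+ n) (+ i)))) (X-t-suc (+ n - + suc i) (suc i) (suc n) (lem₂ (+ n) (+ i)))
    far : t (+ suc n + + suc i) ≈ (N · x) · b
    far =
      t (+ suc n + + suc i) ≈⟨ ≡⇒≈ (cong t (lem₃ (+ n) (+ i))) ⟩
      t (+ n + + suc i + 1ℤ) ≈⟨ ≈-sym (≈-trans (·-cong X-0 (≈-refl {t (+ n + + suc i + 1ℤ)})) (·-identityˡ (t (+ n + + suc i + 1ℤ)))) ⟩
      X 0 · t (+ n + + suc i + 1ℤ) ≈⟨ X-t-suc (+ n + + suc i) 0 (suc n ℕ.+ suc i) (lem₄ (+ n) (+ i)) ⟩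
      X (suc n ℕ.+ suc i) · b ≈⟨ ·-cong (≈-sym (X-+ (suc n) (suc i))) (≈-refl {b}) ⟩
      (N · x) · b ∎ˢ

△ : Series
△ = Σ∞ (λ n → t (+ n))

summable-△ : Summable (λ n → t (+ n))
summable-△ n = Ord-≤ (n≤T n) (Ord-X (T n))

odd : ℕ → ℤ
odd n = + 2 * + n + 1ℤ

module _ (r : ℕ) where
  private
    near far : ℕ → Series
    near n = X r · t (+ n - + r)
    far n  = X r · t (+ n + + r)

  summable-near : Summable near
  summable-near n = Ord-X·t r (+ n - + r) n (n≤r+Tz n r)
  summable-far : Summable far
  summable-far n = Ord-X·t r (+ n + + r) n (ℕₚ.≤-trans (ℕₚ.≤-trans (ℕₚ.m≤m+n n r) (n≤T (n ℕ.+ r))) (ℕₚ.m≤n+m _ r))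

  nearSum farSum oddNear oddFar : Series
  nearSum = Σ∞ near
  farSum  = Σ∞ far
  oddNear = Σ∞ (λ n → odd n • near n)
  oddFar  = Σ∞ (λ n → odd n • far n)

private
  odd-suc : ∀ n z → odd (suc n) * z ≡ odd n * z + + 2 * z
  odd-suc n z = lem (+ n) z
    where
    lem : ∀ n z → (+ 2 * (+ 1 + n) + + 1) * z ≡ (+ 2 * n + + 1) * z + + 2 * z
    lem = solve-∀

  odd-shift : ∀ {F} → Summable F → Σ∞ (λ n → odd n • F n) ≈ F 0 ⊞ (Σ∞ (λ n → odd n • F (suc n)) ⊞ + 2 • Σ∞ (λ n → F (suc n)))
  odd-shift {F} s = ≈-trans (Σ∞-suc (λ n → Ord-• (odd n) (s n))) (⊞-cong (pw λ n → ℤₚ.*-identityˡ (F 0 n))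
    (≈-trans (Σ∞-cong λ n → pw λ k → odd-suc n (F (suc n) k)) (≈-trans (Σ∞-⊞ (λ n → odd n • F (suc n)) (λ n → + 2 • F (suc n)))
      (Σ∞ (λ n → odd n • F (suc n)) ⟨⊞⟩ Σ∞-• (+ 2) (λ n → F (suc n))))))

  edge : ℕ → Series
  edge r = X (suc r) · X (T r)

  module _ (r : ℕ) where
    lower : ∀ n → X (suc r) · t (+ suc n - + suc r) ≈ X 1 · (X r · t (+ n - + r))
    lower n = ≈-trans (·-cong (≈-sym (X-+ 1 r)) (≡⇒≈ (cong t (lem (+ n) (+ r))))) (·-assoc (X 1) (X r) (t (+ n - + r)))
      where
      lem : ∀ n r → + 1 + n - (+ 1 + r) ≡ n - r
      lem = solve-∀
    upper : ∀ n → X 1 · (X r · t (+ suc n + + r)) ≈ X (suc r) · t (+ n + + suc r)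
    upper n = ≈-trans (≈-sym (·-assoc (X 1) (X r) (t (+ suc n + + r)))) (·-cong (X-+ 1 r) (≡⇒≈ (cong t (cong +_ (sym (ℕₚ.+-suc n r))))))
    first : X 1 · (X r · t (+ 0 + + r)) ≈ edge r
    first = ≈-trans (≈-sym (·-assoc (X 1) (X r) (X (T r)))) (·-cong (X-+ 1 r) (≈-refl {X (T r)}))

    scaled : ∀ (c : ℕ → ℤ) F → Summable F → X 1 · Σ∞ (λ n → c n • F n) ≈ Σ∞ (λ n → c n • (X 1 · F n))
    scaled c F s = ≈-trans (≈-sym (Σ∞-·ˡ (X 1) (λ n → c n • F n) (λ n → Ord-• (c n) (s n)))) (Σ∞-cong λ n → ≈-sym (•-·ʳ (c n) (X 1) (F n)))

    nearSum-suc : nearSum (suc r) ≈ edge r ⊞ X 1 · nearSum r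
    nearSum-suc = ≈-trans (Σ∞-suc (summable-near (suc r))) (⊞-cong (≈-refl {edge r}) (≈-trans (Σ∞-cong lower) (Σ∞-·ˡ (X 1) (λ n → X r · t (+ n - + r)) (summable-near r))))

    farSum-suc : X 1 · farSum r ≈ edge r ⊞ farSum (suc r)
    farSum-suc = ≈-trans (≈-sym (Σ∞-·ˡ (X 1) (λ n → X r · t (+ n + + r)) (summable-far r)))
      (≈-trans (Σ∞-suc {λ n → X 1 · (X r · t (+ n + + r))} sum1) (⊞-cong first (Σ∞-cong upper)))
      where
      sum1 : Summable (λ n → X 1 · (X r · t (+ n + + r)))
      sum1 n = Ord-≤ (ℕₚ.n≤1+n n) (Ord-· {1} {n} {X 1} {X r · t (+ n + + r)} (Ord-X 1) (summable-far r n))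

    oddNear-suc : oddNear (suc r) ≈ edge r ⊞ X 1 · (oddNear r ⊞ + 2 • nearSum r)
    oddNear-suc = ≈-trans (odd-shift (summable-near (suc r))) (edge r ⟨⊞⟩
      ≈-trans (⊞-cong (≈-trans (Σ∞-cong λ n → odd n ⟨•⟩ lower n) (≈-sym (scaled odd (λ n → X r · t (+ n - + r)) (summable-near r))))
          (≈-trans (+ 2 ⟨•⟩ ≈-trans (Σ∞-cong lower) (Σ∞-·ˡ (X 1) (λ n → X r · t (+ n - + r)) (summable-near r))) (•-·ʳ (+ 2) (X 1) (nearSum r))))
        (≈-sym (·-distribˡ (X 1) (oddNear r) (+ 2 • nearSum r))))

    oddFar-suc : X 1 · oddFar r ≈ edge r ⊞ (oddFar (suc r) ⊞ + 2 • farSum (suc r))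
    oddFar-suc = ≈-trans (scaled odd (λ n → X r · t (+ n + + r)) (summable-far r))
      (≈-trans (odd-shift {λ n → X 1 · (X r · t (+ n + + r))} sum1) (⊞-cong first (⊞-cong (Σ∞-cong λ n → odd n ⟨•⟩ upper n) (+ 2 ⟨•⟩ Σ∞-cong upper))))
      where
      sum1 : Summable (λ n → X 1 · (X r · t (+ n + + r)))
      sum1 n = Ord-≤ (ℕₚ.n≤1+n n) (Ord-· {1} {n} {X 1} {X r · t (+ n + + r)} (Ord-X 1) (summable-far r n))

-- By T(-1 - z) = T(z) the extra terms t(z), -r ≤ z < 0, of the one sum equal the missing terms 0 ≤
-- z < r of the other. In the induction each step moves one such term, `edge r`, across.
near+far : ∀ r → nearSum r ⊞ farSum r ≈ ι (+ 2) · (X r · △)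
near+far zero = ≈-trans (⊞-cong (n0 (λ n → + n - + 0) (λ n → ℤₚ.+-identityʳ (+ n))) (n0 (λ n → + n + + 0) (λ n → ℤₚ.+-identityʳ (+ n))))
  (solveˢ 1 (λ d → d :+ d := con (+ 2) :* d) ≈-refl (X 0 · △))
  where
  n0 : ∀ (f : ℕ → ℤ) → (∀ n → f n ≡ + n) → Σ∞ (λ n → X 0 · t (f n)) ≈ X 0 · △
  n0 f e = ≈-trans (Σ∞-cong λ n → X 0 ⟨·⟩ ≡⇒≈ (cong t (e n))) (Σ∞-·ˡ (X 0) (λ n → t (+ n)) summable-△)
near+far (suc r) =
  nearSum (suc r) ⊞ farSum (suc r) ≈⟨ ⊞-cong (nearSum-suc r) (≈-refl {farSum (suc r)}) ⟩
  edge r ⊞ X 1 · nearSum r ⊞ farSum (suc r)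
    ≈⟨ solveˢ 3 (λ e n f → e :+ n :+ f := n :+ (e :+ f)) ≈-refl (edge r) (X 1 · nearSum r) (farSum (suc r)) ⟩
  X 1 · nearSum r ⊞ (edge r ⊞ farSum (suc r)) ≈⟨ (X 1 · nearSum r) ⟨⊞⟩ ≈-sym (farSum-suc r) ⟩
  X 1 · nearSum r ⊞ X 1 · farSum r ≈⟨ ≈-sym (·-distribˡ (X 1) (nearSum r) (farSum r)) ⟩
  X 1 · (nearSum r ⊞ farSum r) ≈⟨ X 1 ⟨·⟩ near+far r ⟩
  X 1 · (ι (+ 2) · (X r · △)) ≈⟨ solveˢ 3 (λ x y d → x :* (con (+ 2) :* (y :* d)) := con (+ 2) :* ((x :* y) :* d)) ≈-refl (X 1) (X r) △ ⟩
  ι (+ 2) · ((X 1 · X r) · △) ≈⟨ ι (+ 2) ⟨·⟩ ·-cong (X-+ 1 r) (≈-refl {△}) ⟩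
  ι (+ 2) · (X (suc r) · △) ∎ˢ

-- In terms of z = n - r and z = n + r the weight 2n + 1 is 2z + 1 + 2r and 2z + 1 - 2r. The part 2z
-- + 1 is odd under z ↦ -1 - z and cancels; the part 2r multiplies the sum in `near+far`.
near-far : ∀ r → oddNear r ⊞ ⊟ oddFar r ≈ (ι (+ 4) · ι (+ r)) · (X r · △)
near-far zero =
  oddNear 0 ⊞ ⊟ oddNear 0   ≈⟨ pw (λ k → ℤₚ.+-inverseʳ (oddNear 0 k)) ⟩
  𝟎                         ≈⟨ 𝟎≈ι ⟩
  ι 0ℤ                      ≈⟨ solveˢ 1 (λ d → con 0ℤ := con (+ 4) :* con 0ℤ :* d) ≈-refl (X 0 · △) ⟩
  (ι (+ 4) · ι (+ 0)) · (X 0 · △) ∎ˢ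
near-far (suc r) =
  oddNear (suc r) ⊞ ⊟ oddFar (suc r)
    ≈⟨ ⊞-cong (oddNear-suc r) (≈-refl {⊟ oddFar (suc r)}) ⟩
  e ⊞ X 1 · (oN ⊞ + 2 • n) ⊞ ⊟ oddFar (suc r)
    ≈⟨ ⊞-cong (e ⟨⊞⟩ (X 1 ⟨·⟩ (oN ⟨⊞⟩ •≈ι· (+ 2) n))) (≈-refl {⊟ oddFar (suc r)}) ⟩
  e ⊞ X 1 · (oN ⊞ ι (+ 2) · n) ⊞ ⊟ oddFar (suc r)
    ≈⟨ solveˢ 6 (λ e x oN n f′ oF′ → e :+ x :* (oN :+ con (+ 2) :* n) :- oF′ :=
         x :* oN :+ con (+ 2) :* (x :* n) :+ con (+ 2) :* (e :+ f′) :- (e :+ (oF′ :+ con (+ 2) :* f′))) ≈-refl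
         e (X 1) oN n (farSum (suc r)) (oddFar (suc r)) ⟩
  X 1 · oN ⊞ ι (+ 2) · (X 1 · n) ⊞ ι (+ 2) · (e ⊞ farSum (suc r)) ⊞ ⊟ (e ⊞ (oddFar (suc r) ⊞ ι (+ 2) · farSum (suc r)))
    ≈⟨ ⊞-cong ((X 1 · oN ⊞ ι (+ 2) · (X 1 · n)) ⟨⊞⟩ (ι (+ 2) ⟨·⟩ ≈-sym (farSum-suc r)))
         (⊟-cong (≈-trans (e ⟨⊞⟩ (oddFar (suc r) ⟨⊞⟩ ≈-sym (•≈ι· (+ 2) (farSum (suc r))))) (≈-sym (oddFar-suc r)))) ⟩
  X 1 · oN ⊞ ι (+ 2) · (X 1 · n) ⊞ ι (+ 2) · (X 1 · f) ⊞ ⊟ (X 1 · oF)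
    ≈⟨ solveˢ 5 (λ x oN n f oF → x :* oN :+ con (+ 2) :* (x :* n) :+ con (+ 2) :* (x :* f) :- x :* oF :=
         x :* ((oN :- oF) :+ con (+ 2) :* (n :+ f))) ≈-refl (X 1) oN n f oF ⟩
  X 1 · ((oN ⊞ ⊟ oF) ⊞ ι (+ 2) · (n ⊞ f))
    ≈⟨ X 1 ⟨·⟩ ⊞-cong (near-far r) (ι (+ 2) ⟨·⟩ near+far r) ⟩
  X 1 · ((ι (+ 4) · ι (+ r)) · (X r · △) ⊞ ι (+ 2) · (ι (+ 2) · (X r · △)))
    ≈⟨ solveˢ 4 (λ x c y d → x :* ((con (+ 4) :* c) :* (y :* d) :+ con (+ 2) :* (con (+ 2) :* (y :* d))) :=
         (con (+ 4) :* (con 1ℤ :+ c)) :* ((x :* y) :* d)) ≈-refl (X 1) (ι (+ r)) (X r) △ ⟩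
  (ι (+ 4) · (ι 1ℤ ⊞ ι (+ r))) · ((X 1 · X r) · △)
    ≈⟨ ·-cong (ι (+ 4) ⟨·⟩ ≈-sym (ι-+ (+ 1) (+ r))) (·-cong (X-+ 1 r) (≈-refl {△})) ⟩
  (ι (+ 4) · ι (+ suc r)) · (X (suc r) · △) ∎ˢ
  where
  e = edge r
  oN = oddNear r
  oF = oddFar r
  n = nearSum r
  f = farSum r

z : ℕ → Series
z r = X r · geo r

L′ : Series
L′ = Σ∞ (λ i → sgn i • (+ suc i • z (suc i)))

Ord-z : ∀ r → Ord r (z r)
Ord-z r = Ord-·ʳ (geo r) (Ord-X r)

alternating-odds : ∀ j → Σ (suc j) (λ n → odd n * sgn (j ∸ n)) ≡ + suc j
alternating-odds zero    = refl
alternating-odds (suc j) = begin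
  Σ (suc (suc j)) (λ n → odd n * sgn (suc j ∸ n))
    ≡⟨ Σ-last (suc j) (λ n → odd n * sgn (suc j ∸ n)) ⟩
  Σ (suc j) (λ n → odd n * sgn (suc j ∸ n)) + odd (suc j) * sgn (j ∸ j)
    ≡⟨ cong₂ _+_ (trans (Σ-cong< (suc j) λ n n≤j → trans (cong (λ m → odd n * sgn m) (ℕₚ.+-∸-assoc 1 (ℕₚ.≤-pred n≤j)))
                      (neg (odd n) (sgn (j ∸ n)))) (Σ-*ˡ (suc j) (- + 1) (λ n → odd n * sgn (j ∸ n))))
                 (cong (λ m → odd (suc j) * sgn m) (ℕₚ.n∸n≡0 j)) ⟩
  - + 1 * Σ (suc j) (λ n → odd n * sgn (j ∸ n)) + odd (suc j) * 1ℤ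
    ≡⟨ cong (λ u → - + 1 * u + odd (suc j) * 1ℤ) (alternating-odds j) ⟩
  - + 1 * + suc j + odd (suc j) * 1ℤ
    ≡⟨ lem (+ j) ⟩
  + suc (suc j) ∎
  where
  neg : ∀ a b → a * - b ≡ - + 1 * (a * b)
  neg = solve-∀
  lem : ∀ j → - + 1 * (+ 1 + j) + (+ 2 * (+ 1 + j) + + 1) * + 1 ≡ + 1 + (+ 1 + j)
  lem = solve-∀

-- Expands n t(n) by `vsum` and exchanges the sums over n and r. The weight 2n + 1 is the one for
-- which the inner sum over n is a multiple of △.
weighted-sum : Σ∞ (λ n → odd n • (+ n • t (+ n))) ≈ + 4 • (L′ · △) ⊞ ⊟ Σ∞ (λ n → + n • t (+ n))
weighted-sum =
  Σ∞ (λ n → odd n • (+ n • t (+ n)))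
    ≈⟨ Σ∞-cong (λ n → ≈-trans (odd n ⟨•⟩ ≈-sym (vsum n)) (≈-sym (Σ∞-• (odd n) (vterm n)))) ⟩
  Σ∞ (λ n → Σ∞ (λ i → odd n • vterm n i))
    ≈⟨ Σ∞-cong (λ n → ≈-trans (Σ∞-cong (λ i → split n i)) (Σ∞-⊞ (U n) (V n))) ⟩
  Σ∞ (λ n → Σ∞ (U n) ⊞ Σ∞ (V n))
    ≈⟨ Σ∞-⊞ (λ n → Σ∞ (U n)) (λ n → Σ∞ (V n)) ⟩
  Σ∞ (λ n → Σ∞ (U n)) ⊞ Σ∞ (λ n → Σ∞ (V n))
    ≈⟨ ⊞-cong (≈-trans (Σ∞-swap U) (≈-trans (Σ∞-cong main) collect)) boundary ⟩
  + 4 • (L′ · △) ⊞ ⊟ Σ∞ (λ n → + n • t (+ n)) ∎ˢ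
  where
  near far : ℕ → ℕ → Series
  near r n = X r · t (+ n - + r)
  far r n  = X r · t (+ n + + r)
  -- Writing t(n + r) = q^r t(n + r) + (1 - q^r) t(n + r) leaves the difference of `near` and `far`
  -- over 1 - q^r in U, and in V a term without denominator.
  U V : ℕ → ℕ → Series
  U n i = sgn i • (geo (suc i) · (odd n • (near (suc i) n ⊞ ⊟ far (suc i) n)))
  V n i = (- (odd n * sgn i)) • t (+ n + + suc i)
  split : ∀ n i → odd n • vterm n i ≈ U n i ⊞ V n i
  split n i =
    odd n • (sgn i • (g · (a ⊞ ⊟ b)))
      ≈⟨ ≈-trans (•≈ι· (odd n) (sgn i • (g · (a ⊞ ⊟ b)))) (ι (odd n) ⟨·⟩ •≈ι· (sgn i) (g · (a ⊞ ⊟ b))) ⟩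
    ι (odd n) · (ι (sgn i) · (g · (a ⊞ ⊟ b)))
      ≈⟨ solveˢ 6 (λ o s g a b x → o :* (s :* (g :* (a :- b))) := s :* (g :* (o :* (a :- x :* b))) :+ (:- (o :* s :* (g :* (con 1ℤ :- x))) :* b)) ≈-refl (ι (odd n)) (ι (sgn i)) g a b (X (suc i)) ⟩
    ι (sgn i) · (g · (ι (odd n) · (a ⊞ ⊟ (X (suc i) · b)))) ⊞ (⊟ (ι (odd n) · ι (sgn i) · (g · (ι 1ℤ ⊞ ⊟ X (suc i)))) · b)
      ≈⟨ ⊞-cong (≈-sym (≈-trans (•≈ι· (sgn i) (g · (odd n • (a ⊞ ⊟ (X (suc i) · b))))) (ι (sgn i) ⟨·⟩ (g ⟨·⟩ •≈ι· (odd n) (a ⊞ ⊟ (X (suc i) · b))))))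
           (≈-sym (≈-trans (•≈ι· (- (odd n * sgn i)) b) (·-cong (≈-trans (ι-neg (odd n * sgn i)) (⊟-cong (≈-trans (ι-* (odd n) (sgn i))
             (≈-trans (solveˢ 1 (λ u → u := u :* con 1ℤ) ≈-refl (ι (odd n) · ι (sgn i))) ((ι (odd n) · ι (sgn i)) ⟨·⟩ ≈-sym (geo-recip i)))))) (≈-refl {b})))) ⟩
    U n i ⊞ V n i ∎ˢ
    where
    g = geo (suc i)
    a = near (suc i) n
    b = t (+ n + + suc i)
  main : ∀ i → Σ∞ (λ n → U n i) ≈ + 4 • ((sgn i • (+ suc i • z (suc i))) · △)
  main i =
    Σ∞ (λ n → U n i)
      ≈⟨ ≈-trans (Σ∞-• (sgn i) (λ n → g · (odd n • (near r n ⊞ ⊟ far r n)))) (sgn i ⟨•⟩ (Σ∞-·ˡ g (λ n → odd n • (near r n ⊞ ⊟ far r n))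
           (λ n → Ord-• (odd n) (Ord-⊞ (summable-near r n) (Ord-⊟ (summable-far r n)))))) ⟩
    sgn i • (g · Σ∞ (λ n → odd n • (near r n ⊞ ⊟ far r n)))
      ≈⟨ sgn i ⟨•⟩ (g ⟨·⟩ ≈-trans (Σ∞-cong (λ n → pw λ k → distribute (odd n) (near r n k) (far r n k)))
           (≈-trans (Σ∞-⊞ (λ n → odd n • near r n) (λ n → ⊟ (odd n • far r n))) (oddNear r ⟨⊞⟩ Σ∞-⊟ (λ n → odd n • far r n)))) ⟩
    sgn i • (g · (oddNear r ⊞ ⊟ oddFar r))
      ≈⟨ sgn i ⟨•⟩ (g ⟨·⟩ near-far r) ⟩
    sgn i • (g · ((ι (+ 4) · ι (+ r)) · (X r · △)))
      ≈⟨ •≈ι· (sgn i) (g · ((ι (+ 4) · ι (+ r)) · (X r · △))) ⟩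
    ι (sgn i) · (g · ((ι (+ 4) · ι (+ r)) · (X r · △)))
      ≈⟨ solveˢ 5 (λ s g c x d → s :* (g :* ((con (+ 4) :* c) :* (x :* d))) := con (+ 4) :* ((s :* (c :* (x :* g))) :* d)) ≈-refl (ι (sgn i)) g (ι (+ r)) (X r) △ ⟩
    ι (+ 4) · ((ι (sgn i) · (ι (+ r) · z r)) · △)
      ≈⟨ ≈-sym (≈-trans (•≈ι· (+ 4) ((sgn i • (+ r • z r)) · △)) (ι (+ 4) ⟨·⟩ ·-cong (≈-trans (•≈ι· (sgn i) (+ r • z r)) (ι (sgn i) ⟨·⟩ •≈ι· (+ r) (z r))) (≈-refl {△}))) ⟩
    + 4 • ((sgn i • (+ suc i • z (suc i))) · △) ∎ˢ
    where
    r = suc i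
    g = geo r
    distribute : ∀ c a b → c * (a + - b) ≡ c * a + - (c * b)
    distribute = solve-∀
  collect : Σ∞ (λ i → + 4 • ((sgn i • (+ suc i • z (suc i))) · △)) ≈ + 4 • (L′ · △)
  collect = ≈-trans (Σ∞-• (+ 4) (λ i → F i · △)) (+ 4 ⟨•⟩ ≈-trans (Σ∞-cong λ i → ·-comm (F i) △)
    (≈-trans (Σ∞-·ˡ △ F (λ i → Ord-• (sgn i) (Ord-• (+ suc i) (Ord-≤ (ℕₚ.n≤1+n i) (Ord-z (suc i)))))) (·-comm △ L′)))
    where
    F : ℕ → Series
    F i = sgn i • (+ suc i • z (suc i))
  -- On the antidiagonal n + r = j + 1 all terms are multiples of t(j + 1), and the odd numbers with
  -- alternating signs add up to j + 1.
  boundary : Σ∞ (λ n → Σ∞ (V n)) ≈ ⊟ Σ∞ (λ n → + n • t (+ n))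
  boundary =
    Σ∞ (λ n → Σ∞ (V n))
      ≈⟨ Σ∞-triangle V (λ n i → Ord-• (- (odd n * sgn i)) (Ord-≤ (ℕₚ.≤-trans (ℕₚ.+-monoʳ-≤ n (ℕₚ.n≤1+n i)) (n≤T (n ℕ.+ suc i))) (Ord-X (T (n ℕ.+ suc i))))) ⟩
    Σ∞ (λ j → Σˢ (suc j) (λ n → V n (j ∸ n)))
      ≈⟨ Σ∞-cong diagonal ⟩
    Σ∞ (λ j → ⊟ M (suc j))
      ≈⟨ Σ∞-⊟ (λ j → M (suc j)) ⟩
    ⊟ Σ∞ (λ j → M (suc j))
      ≈⟨ ⊟-cong (pw λ k → sym (trans (at (Σ∞-suc {M} λ n → Ord-• (+ n) (summable-△ n)) k) (ℤₚ.+-identityˡ (Σ∞ (λ j → M (suc j)) k)))) ⟩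
    ⊟ Σ∞ M ∎ˢ
    where
    M : ℕ → Series
    M n = + n • t (+ n)
    diagonal : ∀ j → Σˢ (suc j) (λ n → V n (j ∸ n)) ≈ ⊟ M (suc j)
    diagonal j = pw λ k → begin
      Σ (suc j) (λ n → - (odd n * sgn (j ∸ n)) * t (+ n + + suc (j ∸ n)) k)
        ≡⟨ Σ-cong< (suc j) (λ n n≤j → trans (cong (λ m → - (odd n * sgn (j ∸ n)) * X (T m) k)
             (trans (ℕₚ.+-suc n (j ∸ n)) (cong suc (ℕₚ.m+[n∸m]≡n (ℕₚ.≤-pred n≤j))))) (neg (odd n * sgn (j ∸ n)) (t (+ suc j) k))) ⟩
      Σ (suc j) (λ n → odd n * sgn (j ∸ n) * - t (+ suc j) k)
        ≡⟨ Σ-*ʳ (suc j) (- t (+ suc j) k) (λ n → odd n * sgn (j ∸ n)) ⟩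
      Σ (suc j) (λ n → odd n * sgn (j ∸ n)) * - t (+ suc j) k
        ≡⟨ cong (_* - t (+ suc j) k) (alternating-odds j) ⟩
      + suc j * - t (+ suc j) k
        ≡⟨ sym (ℤₚ.neg-distribʳ-* (+ suc j) (t (+ suc j) k)) ⟩
      - (+ suc j * t (+ suc j) k) ∎
      where
      neg : ∀ a b → - a * b ≡ a * - b
      neg = solve-∀

4*-cancel : ∀ {f g} → + 4 • f ≈ + 4 • g → f ≈ g
4*-cancel {f} {g} p = pw λ n → ℤₚ.*-cancelˡ-≡ (+ 4) (f n) (g n) (at p n)

-- 4 T(m) = (2m + 1) m + m; the second part cancels the last sum in `weighted-sum`.
D-△ : D △ ≈ L′ · △
D-△ = 4*-cancel (pw λ n → begin
  + 4 * D △ n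
    ≡⟨ trans (cong (+ 4 *_) (sym (Σ-*ˡ (suc n) (+ n) (λ m → t (+ m) n)))) (sym (Σ-*ˡ (suc n) (+ 4) (λ m → + n * t (+ m) n))) ⟩
  Σ (suc n) (λ m → + 4 * D (X (T m)) n)
    ≡⟨ Σ-cong (suc n) (λ m → trans (cong (+ 4 *_) (trans (at (D-X (T m)) n) (ι-· (+ T m) (X (T m)) n))) (four m (t (+ m) n))) ⟩
  Σ (suc n) (λ m → odd m * (+ m * t (+ m) n) + + m * t (+ m) n)
    ≡⟨ Σ-+ (suc n) (λ m → odd m * (+ m * t (+ m) n)) (λ m → + m * t (+ m) n) ⟩
  Σ∞ (λ m → odd m • (+ m • t (+ m))) n + Σ∞ (λ m → + m • t (+ m)) n
    ≡⟨ cong (_+ Σ∞ (λ m → + m • t (+ m)) n) (at weighted-sum n) ⟩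
  + 4 * (L′ · △) n + - Σ∞ (λ m → + m • t (+ m)) n + Σ∞ (λ m → + m • t (+ m)) n
    ≡⟨ cancel (+ 4 * (L′ · △) n) (Σ∞ (λ m → + m • t (+ m)) n) ⟩
  + 4 * (L′ · △) n ∎)
  where
  cancel : ∀ a b → a + - b + b ≡ a
  cancel = solve-∀
  four : ∀ m u → + 4 * (+ T m * u) ≡ odd m * (+ m * u) + + m * u
  four m u = trans (lem₁ (+ T m) u) (trans (cong (λ v → + 2 * v * u) (2*T m)) (lem₂ (+ m) u))
    where
    lem₁ : ∀ t u → + 4 * (t * u) ≡ + 2 * (+ 2 * t) * u
    lem₁ = solve-∀
    lem₂ : ∀ m u → + 2 * (m * (m + + 1)) * u ≡ (+ 2 * m + + 1) * (m * u) + m * u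
    lem₂ = solve-∀

z≈w+y : ∀ r → z (suc r) ≈ w (suc r) ⊞ y (suc r)
z≈w+y r =
  x · g
    ≈⟨ x ⟨·⟩ ≈-trans (solveˢ 1 (λ g → g := g :* con 1ℤ) ≈-refl g) (g ⟨·⟩ ≈-sym (≈-trans (G ⟨·⟩ (ι 1ℤ ⟨⊞⟩ ⊟-cong (X-+ (suc r) (suc r)))) (geo-recip (r ℕ.+ suc r)))) ⟩
  x · (g · (G · (ι 1ℤ ⊞ ⊟ (x · x))))
    ≈⟨ solveˢ 3 (λ x g G → x :* (g :* (G :* (con 1ℤ :- x :* x))) := x :* ((g :* (con 1ℤ :- x)) :* (G :* (con 1ℤ :+ x)))) ≈-refl x g G ⟩
  x · ((g · (ι 1ℤ ⊞ ⊟ x)) · (G · (ι 1ℤ ⊞ x)))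
    ≈⟨ x ⟨·⟩ ·-cong (geo-recip r) (≈-refl {G · (ι 1ℤ ⊞ x)}) ⟩
  x · (ι 1ℤ · (G · (ι 1ℤ ⊞ x)))
    ≈⟨ solveˢ 2 (λ x G → x :* (con 1ℤ :* (G :* (con 1ℤ :+ x))) := x :* G :+ (x :* x) :* G) ≈-refl x G ⟩
  x · G ⊞ (x · x) · G
    ≈⟨ (x · G) ⟨⊞⟩ ·-cong (X-+ (suc r) (suc r)) (≈-refl {G}) ⟩
  w (suc r) ⊞ y (suc r) ∎ˢ
  where
  x = X (suc r)
  g = geo (suc r)
  G = geo (suc r ℕ.+ suc r)

Σ-pairs : ∀ k (f : ℕ → ℤ) → Σ (k ℕ.+ k) f ≡ Σ k (λ j → f (j ℕ.+ j) + f (suc (j ℕ.+ j)))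
Σ-pairs zero    f = refl
Σ-pairs (suc k) f = begin
  f 0 + Σ (k ℕ.+ suc k) (f ∘ suc)                ≡⟨ f 0 ⟨+⟩ cong (λ m → Σ m (f ∘ suc)) (ℕₚ.+-suc k k) ⟩
  f 0 + (f 1 + Σ (k ℕ.+ k) (f ∘ suc ∘ suc))      ≡⟨ sym (ℤₚ.+-assoc (f 0) (f 1) _) ⟩
  f 0 + f 1 + Σ (k ℕ.+ k) (f ∘ suc ∘ suc)        ≡⟨ (f 0 + f 1) ⟨+⟩ trans (Σ-pairs k (f ∘ suc ∘ suc))
       (Σ-cong k λ j → cong (λ m → f (suc m) + f (suc (suc m))) (sym (ℕₚ.+-suc j j))) ⟩
  Σ (suc k) (λ j → f (j ℕ.+ j) + f (suc (j ℕ.+ j))) ∎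

sgn-even : ∀ j → sgn (j ℕ.+ j) ≡ 1ℤ
sgn-even zero    = refl
sgn-even (suc j) = trans (cong (λ m → - sgn m) (ℕₚ.+-suc j j)) (trans (ℤₚ.neg-involutive (sgn (j ℕ.+ j))) (sgn-even j))

sgn-split : ∀ {F} → Summable F → Σ∞ F ≈ Σ∞ (λ i → sgn i • F i) ⊞ + 2 • Σ∞ (λ j → F (suc (j ℕ.+ j)))
sgn-split {F} s = pw λ n → begin
  Σ∞ F n
    ≡⟨ Σ-cong (suc n) (λ i → lem₁ (sgn i) (F i n)) ⟩
  Σ (suc n) (λ i → sgn i * F i n + (1ℤ + - sgn i) * F i n)
    ≡⟨ Σ-+ (suc n) (λ i → sgn i * F i n) (λ i → (1ℤ + - sgn i) * F i n) ⟩
  Σ∞ (λ i → sgn i • F i) n + Σ (suc n) (λ i → (1ℤ + - sgn i) * F i n)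
    ≡⟨ Σ∞ (λ i → sgn i • F i) n ⟨+⟩ sym (Σ-extend (λ i → (1ℤ + - sgn i) * F i n) (ℕₚ.m≤m+n (suc n) (suc n))
         (λ i n<i → trans (cong ((1ℤ + - sgn i) *_) (s i n n<i)) (ℤₚ.*-zeroʳ (1ℤ + - sgn i)))) ⟩
  Σ∞ (λ i → sgn i • F i) n + Σ (suc n ℕ.+ suc n) (λ i → (1ℤ + - sgn i) * F i n)
    ≡⟨ Σ∞ (λ i → sgn i • F i) n ⟨+⟩ trans (Σ-pairs (suc n) (λ i → (1ℤ + - sgn i) * F i n))
         (trans (Σ-cong (suc n) λ j → trans (cong (λ u → (1ℤ + - u) * F (j ℕ.+ j) n + (1ℤ + - - u) * F (suc (j ℕ.+ j)) n) (sgn-even j))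
                    (lem₂ (F (j ℕ.+ j) n) (F (suc (j ℕ.+ j)) n)))
           (Σ-*ˡ (suc n) (+ 2) (λ j → F (suc (j ℕ.+ j)) n))) ⟩
  Σ∞ (λ i → sgn i • F i) n + + 2 * Σ∞ (λ j → F (suc (j ℕ.+ j))) n ∎
  where
  lem₁ : ∀ s u → u ≡ s * u + (+ 1 + - s) * u
  lem₁ = solve-∀
  lem₂ : ∀ u v → (+ 1 + - + 1) * u + (+ 1 + - - + 1) * v ≡ + 2 * v
  lem₂ = solve-∀

-- Without signs the sum over r is C₀ + Y, and its terms with even r = 2e add up to 2 Y, since
-- `z (2e)` = `y e`. Reversing their sign subtracts 4 Y.
L′-value : L′ ≈ C 0 ⊞ (- + 3) • Y
L′-value = pw λ n → solve-for (L′ n) (C 0 n) (Y n) (trans (sym (at all n)) (trans (at (sgn-split {F} summable-F) n) (cong (λ u → L′ n + + 2 * u) (at evens n))))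
  where
  F : ℕ → Series
  F i = + suc i • z (suc i)
  summable-F : Summable F
  summable-F i = Ord-• (+ suc i) (Ord-≤ (ℕₚ.n≤1+n i) (Ord-z (suc i)))
  evens : Σ∞ (λ j → F (suc (j ℕ.+ j))) ≈ + 2 • Y
  evens = ≈-trans (Σ∞-cong λ j → pw λ n → trans (cong (λ m → + m * z m n) (cong suc (sym (ℕₚ.+-suc j j)))) (lem (+ suc j) (y (suc j) n)))
    (Σ∞-• (+ 2) (λ j → + suc j • y (suc j)))
    where
    lem : ∀ a u → (a + a) * u ≡ + 2 * (a * u)
    lem = solve-∀
  all : Σ∞ F ≈ C 0 ⊞ Y
  all = ≈-trans (Σ∞-cong λ i → pw λ n → trans (cong (+ suc i *_) (at (z≈w+y i) n)) (lem (+ suc i) (w (suc i) n) (y (suc i) n)))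
    (Σ∞-⊞ (λ i → oddPower 0 (+ suc i) • w (suc i)) (λ i → + suc i • y (suc i)))
    where
    lem : ∀ a u v → a * (u + v) ≡ (a * + 1) * u + a * v
    lem = solve-∀
  solve-for : ∀ l c y → c + y ≡ l + + 2 * (+ 2 * y) → l ≡ c + - + 3 * y
  solve-for l c y e = trans (lem₁ l y) (trans (cong (_+ - + 4 * y) (sym e)) (lem₂ c y))
    where
    lem₁ : ∀ l y → l ≡ l + + 2 * (+ 2 * y) + - + 4 * y
    lem₁ = solve-∀
    lem₂ : ∀ c y → c + y + - + 4 * y ≡ c + - + 3 * y
    lem₂ = solve-∀

-- Powers, and `C 1` as q △⁸

pow : Series → ℕ → Series
pow f zero    = ι 1ℤ
pow f (suc k) = f · pow f k

D-pow : ∀ f l → D f ≈ l · f → ∀ k → D (pow f k) ≈ (ι (+ k) · l) · pow f k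
D-pow f l p zero    = ≈-trans (D-ι 1ℤ) (≈-trans 𝟎≈ι (solveˢ 1 (λ l → con 0ℤ := (con 0ℤ :* l) :* con 1ℤ) ≈-refl l))
D-pow f l p (suc k) =
  D (f · pow f k) ≈⟨ D-· f (pow f k) ⟩
  D f · pow f k ⊞ f · D (pow f k) ≈⟨ ⊞-cong (·-cong p (≈-refl {pow f k})) (f ⟨·⟩ D-pow f l p k) ⟩
  (l · f) · pow f k ⊞ f · ((ι (+ k) · l) · pow f k)
    ≈⟨ solveˢ 4 (λ l f q c → (l :* f) :* q :+ f :* ((c :* l) :* q) := ((con 1ℤ :+ c) :* l) :* (f :* q)) ≈-refl l f (pow f k) (ι (+ k)) ⟩
  ((ι 1ℤ ⊞ ι (+ k)) · l) · (f · pow f k) ≈⟨ ·-cong (·-cong (≈-sym (ι-+ (+ 1) (+ k))) (≈-refl {l})) (≈-refl {f · pow f k}) ⟩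
  (ι (+ suc k) · l) · pow f (suc k) ∎ˢ

-- The coefficient of q^n in D h = P h reads (n - 1) h n = 0 once h vanishes below n.
uniqueness : ∀ {h P} → D h ≈ P · h → P 0 ≡ 1ℤ → h 0 ≡ 0ℤ → h 1 ≡ 0ℤ → ∀ k → Ord k h
uniqueness         e P0 h0 h1 zero    n ()
uniqueness {h} {P} e P0 h0 h1 (suc k) = Ord-suc below (top k below)
  where
  below : Ord k h
  below = uniqueness {h} {P} e P0 h0 h1 k
  top : ∀ k → Ord k h → h k ≡ 0ℤ
  top zero          o = h0
  top (suc zero)    o = h1
  top (suc (suc k)) o = ℤₚ.*-cancelˡ-≡ (+ suc k) (h (suc (suc k))) 0ℤ (begin
    + suc k * h (suc (suc k))                                ≡⟨ lem (+ suc k) (h (suc (suc k))) ⟩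
    + suc (suc k) * h (suc (suc k)) + - h (suc (suc k))      ≡⟨ cong (_+ - h (suc (suc k))) (trans (at e (suc (suc k))) (at (·-comm P h) (suc (suc k)))) ⟩
    (h · P) (suc (suc k)) + - h (suc (suc k))                ≡⟨ cong (_+ - h (suc (suc k))) (trans (·-top P o) (trans (cong (h (suc (suc k)) *_) P0) (ℤₚ.*-identityʳ (h (suc (suc k)))))) ⟩
    h (suc (suc k)) + - h (suc (suc k))                      ≡⟨ trans (ℤₚ.+-inverseʳ (h (suc (suc k)))) (sym (ℤₚ.*-zeroʳ (+ suc k))) ⟩
    + suc k * 0ℤ                                             ∎)
    where
    lem : ∀ c u → c * u ≡ (+ 1 + c) * u + - u
    lem = solve-∀

pow-at-0 : ∀ {f} → f 0 ≡ 1ℤ → ∀ k → pow f k 0 ≡ 1ℤ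
pow-at-0         e zero    = refl
pow-at-0 {f} e (suc k) = trans (ℤₚ.+-identityʳ (f 0 * pow f k 0)) (cong₂ _*_ e (pow-at-0 {f} e k))

C₁-at-1 : C 1 1 ≡ 1ℤ
C₁-at-1 = refl

Ord-C : ∀ l → Ord 1 (C l)
Ord-C l zero (s≤s z≤n) = Σ-zero 1 {λ i → oddPower l (+ suc i) * w (suc i) 0} λ { zero _ → ℤₚ.*-zeroʳ (oddPower l (+ 1)) ; (suc i) (s≤s ()) }

-- A factor q adds 1 to the logarithmic derivative, so `C 1` and q p solve the same equation D h =
-- (1 + 8 L′) h. Both begin with q, so their difference vanishes in degrees 0 and 1.
C₁-unique : ∀ p → D p ≈ (ι (+ 8) · L′) · p → p 0 ≡ 1ℤ → C 1 ≈ X 1 · p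
C₁-unique p Dp p0 = pw λ n → ℤₚ.i-j≡0⇒i≡j (C 1 n) ((X 1 · p) n) (uniqueness {h} {P} equation refl h0 h1 (suc n) n ℕₚ.≤-refl)
  where
  h P : Series
  h = C 1 ⊞ ⊟ (X 1 · p)
  P = ι 1ℤ ⊞ + 8 • (C 0 ⊞ (- + 3) • Y)
  h0 : h 0 ≡ 0ℤ
  h0 = cong (_+ 0ℤ) (Ord-C 1 0 (s≤s z≤n))
  h1 : h 1 ≡ 0ℤ
  h1 = cong₂ (λ u v → u + - v) C₁-at-1 (trans (X-·-at 1 p 0) p0)
  P≈ : P ≈ ι 1ℤ ⊞ ι (+ 8) · L′
  P≈ = ι 1ℤ ⟨⊞⟩ ≈-trans (•≈ι· (+ 8) (C 0 ⊞ (- + 3) • Y)) (ι (+ 8) ⟨·⟩ ≈-sym L′-value)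
  equation : D h ≈ P · h
  equation =
    D (C 1 ⊞ ⊟ (X 1 · p))
      ≈⟨ ≈-trans (D-⊞ (C 1) (⊟ (X 1 · p))) (⊞-cong D-C₁ (≈-trans (D-⊟ (X 1 · p)) (⊟-cong (≈-trans (D-· (X 1) p)
           (⊞-cong (·-cong (D-X 1) (≈-refl {p})) (X 1 ⟨·⟩ Dp)))))) ⟩
    P · C 1 ⊞ ⊟ ((ι (+ 1) · X 1) · p ⊞ X 1 · ((ι (+ 8) · L′) · p))
      ≈⟨ (P · C 1) ⟨⊞⟩ ⊟-cong (solveˢ 3 (λ x p l → (con (+ 1) :* x) :* p :+ x :* (l :* p) := (con 1ℤ :+ l) :* (x :* p)) ≈-refl (X 1) p (ι (+ 8) · L′)) ⟩
    P · C 1 ⊞ ⊟ ((ι 1ℤ ⊞ ι (+ 8) · L′) · (X 1 · p))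
      ≈⟨ (P · C 1) ⟨⊞⟩ ⊟-cong (·-cong (≈-sym P≈) (≈-refl {X 1 · p})) ⟩
    P · C 1 ⊞ ⊟ (P · (X 1 · p))
      ≈⟨ solveˢ 3 (λ P c q → P :* c :- P :* q := P :* (c :- q)) ≈-refl P (C 1) (X 1 · p) ⟩
    P · (C 1 ⊞ ⊟ (X 1 · p)) ∎ˢ

C₁≈q△⁸ : C 1 ≈ X 1 · pow △ 8
C₁≈q△⁸ = C₁-unique (pow △ 8) (D-pow △ L′ D-△ 8) (pow-at-0 {△} refl 8)

-- Graded forms

𝟎-· : ∀ {f} g → f ≈ 𝟎 → f · g ≈ 𝟎
𝟎-· g p = pw λ n → Σ-zero (suc n) λ i _ → cong (_* g (n ∸ i)) (at p i)

pow-+ : ∀ f a b → pow f (a ℕ.+ b) ≈ pow f a · pow f b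
pow-+ f zero    b = ≈-sym (·-identityˡ (pow f b))
pow-+ f (suc a) b = ≈-trans (f ⟨·⟩ pow-+ f a b) (≈-sym (·-assoc f (pow f a) (pow f b)))

module Graded (a̲ b̲ : Series) where

  -- Polynomials in a̲ and b̲, homogeneous for the grading with deg a̲ = 1 and
  -- deg b̲ = 2.
  data Form : ℕ → Series → Set where
    form-0 : ∀ h → Form h 𝟎
    form-1 : Form 0 (ι 1ℤ)
    form-a : Form 1 a̲
    form-b : Form 2 (b̲)
    form-+ : ∀ {h f g} → Form h f → Form h g → Form h (f ⊞ g)
    form-• : ∀ {h f} c → Form h f → Form h (c • f)
    form-· : ∀ {h k f g} → Form h f → Form k g → Form (h ℕ.+ k) (f · g)
    form-≈ : ∀ {h f g} → f ≈ g → Form h f → Form h g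

  form-deg : ∀ {h k f} → h ≡ k → Form h f → Form k f
  form-deg refl p = p

  -- The possible cofactors of `b̲` in degree h: forms of degree h - 2, hence only zero when h < 2.
  Down : ℕ → Series → Set
  Down zero          g = g ≈ 𝟎
  Down (suc zero)    g = g ≈ 𝟎
  Down (suc (suc h)) g = Form h g

  down-0 : ∀ h {g} → g ≈ 𝟎 → Down h g
  down-0 zero          p = p
  down-0 (suc zero)    p = p
  down-0 (suc (suc h)) p = form-≈ (≈-sym p) (form-0 h)

  down-+ : ∀ h {f g} → Down h f → Down h g → Down h (f ⊞ g)
  down-+ zero          p q = ⊞-cong p q
  down-+ (suc zero)    p q = ⊞-cong p q
  down-+ (suc (suc h)) p q = form-+ p q

  down-• : ∀ h c {f} → Down h f → Down h (c • f)
  down-• zero          c p = ≈-trans (c ⟨•⟩ p) (pw λ _ → ℤₚ.*-zeroʳ c)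
  down-• (suc zero)    c p = ≈-trans (c ⟨•⟩ p) (pw λ _ → ℤₚ.*-zeroʳ c)
  down-• (suc (suc h)) c p = form-• c p

  down-· : ∀ h {k f g} → Down h f → Form k g → Down (h ℕ.+ k) (f · g)
  down-· zero          {k} {g = g} p q = down-0 k (𝟎-· g p)
  down-· (suc zero)    {k} {g = g} p q = down-0 (suc k) (𝟎-· g p)
  down-· (suc (suc h)) p q = form-· p q

  form-a^ : ∀ h → Form h (pow a̲ h)
  form-a^ zero    = form-1
  form-a^ (suc h) = form-· form-a (form-a^ h)

  -- Division by `b̲`: the only monomial of degree h free of `b̲` is the power of `a̲`. For a
  -- product the cofactor g · f′ is left unexpanded, so only the pure power of the first factor
  -- meets the decomposition of the second.
  decompose : ∀ {h f} → Form h f → Σ[ c ∈ ℤ ] Σ[ g ∈ Series ] (f ≈ ι c · pow a̲ h ⊞ b̲ · g) × Down h g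
  decompose (form-0 h) = 0ℤ , 𝟎 , ≈-trans 𝟎≈ι (≈-trans (solveˢ 2 (λ p b → con 0ℤ := con 0ℤ :* p :+ b :* con 0ℤ) ≈-refl (pow a̲ h) (b̲))
    ((ι 0ℤ · pow a̲ h) ⟨⊞⟩ (b̲ ⟨·⟩ ≈-sym 𝟎≈ι))) , down-0 h ≈-refl
  decompose form-1 = 1ℤ , 𝟎 , ≈-trans (solveˢ 1 (λ b → con 1ℤ := con 1ℤ :* con 1ℤ :+ b :* con 0ℤ) ≈-refl (b̲)) ((ι 1ℤ · ι 1ℤ) ⟨⊞⟩ (b̲ ⟨·⟩ ≈-sym 𝟎≈ι)) , ≈-refl
  decompose form-a = 1ℤ , 𝟎 , ≈-trans (solveˢ 2 (λ a b → a := con 1ℤ :* (a :* con 1ℤ) :+ b :* con 0ℤ) ≈-refl a̲ (b̲)) ((ι 1ℤ · (a̲ · ι 1ℤ)) ⟨⊞⟩ (b̲ ⟨·⟩ ≈-sym 𝟎≈ι)) , ≈-refl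
  decompose form-b = 0ℤ , ι 1ℤ , solveˢ 2 (λ p b → b := con 0ℤ :* p :+ b :* con 1ℤ) ≈-refl (pow a̲ 2) (b̲) , form-1
  decompose (form-+ {h} p q) with decompose p | decompose q
  ... | c , g , e , d | c′ , g′ , e′ , d′ = c + c′ , g ⊞ g′ ,
    ≈-trans (⊞-cong e e′) (≈-trans (solveˢ 6 (λ c g c′ g′ p b → (c :* p :+ b :* g) :+ (c′ :* p :+ b :* g′) := (c :+ c′) :* p :+ b :* (g :+ g′)) ≈-refl (ι c) g (ι c′) g′ (pow a̲ h) (b̲))
      (⊞-cong (·-cong (≈-sym (ι-+ c c′)) (≈-refl {pow a̲ h})) (≈-refl {b̲ · (g ⊞ g′)}))) , down-+ h d d′
  decompose (form-• {h} {f} k p) with decompose p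
  ... | c , g , e , d = k * c , k • g ,
    ≈-trans (•≈ι· k f) (≈-trans (ι k ⟨·⟩ e) (≈-trans (solveˢ 5 (λ k c g p b → k :* (c :* p :+ b :* g) := (k :* c) :* p :+ b :* (k :* g)) ≈-refl (ι k) (ι c) g (pow a̲ h) (b̲))
      (⊞-cong (·-cong (≈-sym (ι-* k c)) (≈-refl {pow a̲ h})) (b̲ ⟨·⟩ ≈-sym (•≈ι· k g))))) , down-• h k d
  decompose (form-· {h} {k} {f} {f′} p q) with decompose p | decompose q
  ... | c , g , e , d | c′ , g′ , e′ , d′ = c * c′ , c • (g′ · pow a̲ h) ⊞ g · f′ ,
    (f · f′ ≈⟨ ·-cong e (≈-refl {f′}) ⟩
     (ι c · pow a̲ h ⊞ b̲ · g) · f′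
       ≈⟨ solveˢ 5 (λ c p b g f′ → (c :* p :+ b :* g) :* f′ := (c :* p) :* f′ :+ b :* (g :* f′)) ≈-refl (ι c) (pow a̲ h) (b̲) g f′ ⟩
     (ι c · pow a̲ h) · f′ ⊞ b̲ · (g · f′)
       ≈⟨ ⊞-cong ((ι c · pow a̲ h) ⟨·⟩ e′) (≈-refl {b̲ · (g · f′)}) ⟩
     (ι c · pow a̲ h) · (ι c′ · pow a̲ k ⊞ b̲ · g′) ⊞ b̲ · (g · f′)
       ≈⟨ solveˢ 7 (λ c p c′ p′ b g′ u → (c :* p) :* (c′ :* p′ :+ b :* g′) :+ b :* u := (c :* c′) :* (p :* p′) :+ b :* (c :* (g′ :* p) :+ u)) ≈-refl
            (ι c) (pow a̲ h) (ι c′) (pow a̲ k) (b̲) g′ (g · f′) ⟩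
     (ι c · ι c′) · (pow a̲ h · pow a̲ k) ⊞ b̲ · (ι c · (g′ · pow a̲ h) ⊞ g · f′)
       ≈⟨ ⊞-cong (·-cong (≈-sym (ι-* c c′)) (≈-sym (pow-+ a̲ h k))) (b̲ ⟨·⟩ ⊞-cong (≈-sym (•≈ι· c (g′ · pow a̲ h))) (≈-refl {g · f′})) ⟩
     ι (c * c′) · pow a̲ (h ℕ.+ k) ⊞ b̲ · (c • (g′ · pow a̲ h) ⊞ g · f′) ∎ˢ) ,
    down-+ (h ℕ.+ k) (down-• (h ℕ.+ k) c (subst (λ m → Down m (g′ · pow a̲ h)) (ℕₚ.+-comm k h) (down-· k d′ (form-a^ h)))) (down-· h d q)
  decompose (form-≈ p q) with decompose q
  ... | c , g , e , d = c , g , ≈-trans (≈-sym p) e , d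

Ord-unit : ∀ {f g} k → g 0 ≡ 1ℤ → Ord k (f · g) → Ord k f
Ord-unit zero    g0 o n ()
Ord-unit {f} {g} (suc k) g0 o = Ord-suc below (trans (sym (trans (·-top g below) (trans (cong (f k *_) g0) (ℤₚ.*-identityʳ (f k))))) (o k ℕₚ.≤-refl))
  where
  below : Ord k f
  below = Ord-unit {f} {g} k g0 (Ord-≤ (ℕₚ.n≤1+n k) o)

module Extraction (a b u : Series) (a0 : a 0 ≡ 1ℤ) (b≈ : b ≈ X 1 · u) (u0 : u 0 ≡ 1ℤ) where
  open Graded a b

  Ord-b : Ord 1 b
  Ord-b = Ord-resp (≈-sym b≈) (Ord-·ʳ u (Ord-X 1))

  Ord-b-cancel : ∀ k g → Ord (suc k) (b · g) → Ord k g
  Ord-b-cancel k g o = Ord-unit {g} {u} k u0 λ n n<k → trans (sym (X-·-at 1 (g · u) n)) (trans (at rearrange (suc n)) (o (suc n) (s≤s n<k)))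
    where
    rearrange : X 1 · (g · u) ≈ b · g
    rearrange = ≈-trans (solveˢ 3 (λ x g p → x :* (g :* p) := (x :* p) :* g) ≈-refl (X 1) g u) (·-cong (≈-sym b≈) (≈-refl {g}))

  -- As a = 1 + O(q) and b = O(q), the constant term of f is the coefficient of the pure power of a.
  -- For j > 0 it is zero, so b divides f; the quotient has degree two less and order one less.
  form-monomial : ∀ j {f} → Form (j ℕ.+ j) f → Ord j f → Σ[ c ∈ ℤ ] f ≈ ι c · pow b j
  descend : ∀ j {f} c g → f ≈ ι c · pow a (2 ℕ.+ (j ℕ.+ j)) ⊞ b · g → Form (j ℕ.+ j) g → Ord (suc j) f → Σ[ c ∈ ℤ ] f ≈ ι c · pow b (suc j)

  form-monomial zero p o with decompose p
  ... | c , g , e , d = c , ≈-trans e (≈-trans ((ι c · ι 1ℤ) ⟨⊞⟩ ≈-trans (b ⟨·⟩ d) (≈-trans (·-comm b 𝟎) (𝟎-· b (≈-refl {𝟎}))))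
    (pw λ n → ℤₚ.+-identityʳ ((ι c · ι 1ℤ) n)))
  form-monomial (suc j) p o with decompose (form-deg (cong suc (ℕₚ.+-suc j j)) p)
  ... | c , g , e , d = descend j c g e d o

  descend j {f} c g e d o = proj₁ rec , ≈-trans f≈ (≈-trans (b ⟨·⟩ proj₂ rec)
      (solveˢ 3 (λ b c p → b :* (c :* p) := c :* (b :* p)) ≈-refl b (ι (proj₁ rec)) (pow b j)))
    where
    p = pow a (2 ℕ.+ (j ℕ.+ j))
    c≡0 : c ≡ 0ℤ
    c≡0 = begin
      c                          ≡⟨ sym (ℤₚ.*-identityʳ c) ⟩
      c * 1ℤ                     ≡⟨ cong (c *_) (sym (pow-at-0 {a} a0 (2 ℕ.+ (j ℕ.+ j)))) ⟩
      c * p 0                    ≡⟨ sym (ι-· c p 0) ⟩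
      (ι c · p) 0                ≡⟨ sym (ℤₚ.+-identityʳ ((ι c · p) 0)) ⟩
      (ι c · p) 0 + 0ℤ           ≡⟨ (ι c · p) 0 ⟨+⟩ sym (Ord-·ʳ g Ord-b 0 (s≤s z≤n)) ⟩
      (ι c · p) 0 + (b · g) 0    ≡⟨ sym (at e 0) ⟩
      f 0                        ≡⟨ o 0 (s≤s z≤n) ⟩
      0ℤ                         ∎
    f≈ : f ≈ b · g
    f≈ = ≈-trans e (pw λ n → trans (cong (_+ (b · g) n) (trans (ι-· c p n) (cong (_* p n) c≡0))) (ℤₚ.+-identityˡ ((b · g) n)))
    rec : Σ[ c ∈ ℤ ] g ≈ ι c · pow b j
    rec = form-monomial j d (Ord-b-cancel j g (Ord-resp f≈ o))

  pow-b : ∀ j → pow b j ≈ X j · pow u j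
  pow-b zero    = ≈-sym (≈-trans (·-cong X-0 (≈-refl {ι 1ℤ})) (·-identityˡ (ι 1ℤ)))
  pow-b (suc j) = ≈-trans (·-cong b≈ (pow-b j)) (≈-trans
    (solveˢ 4 (λ x u y v → (x :* u) :* (y :* v) := (x :* y) :* (u :* v)) ≈-refl (X 1) u (X j) (pow u j)) (·-cong (X-+ 1 j) (≈-refl {u · pow u j})))

  form-leading : ∀ j {f} → Form (j ℕ.+ j) f → Ord j f → f ≈ f j • (X j · pow u j)
  form-leading j {f} p o with form-monomial j p o
  ... | c , e = ≈-trans f≈ (pw λ n → cong (_* (X j · pow u j) n) (sym fj))
    where
    f≈ : f ≈ c • (X j · pow u j)
    f≈ = ≈-trans e (≈-trans (ι c ⟨·⟩ pow-b j) (≈-sym (•≈ι· c (X j · pow u j))))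
    fj : f j ≡ c
    fj = trans (at f≈ j) (trans (cong (c *_) (trans (cong (X j · pow u j) (sym (ℕₚ.+-identityʳ j))) (trans (X-·-at j (pow u j) 0) (pow-at-0 {u} u0 j)))) (ℤₚ.*-identityʳ c))

-- Degrees are half the modular weights.
open Graded A (C 1)

-- The moments `C l`, l ≥ 1, as forms

module DoubleForms (L : ℕ) (H : ∀ i → i ≤ L → Form (2 ℕ.+ i) (C (suc i))) where

  -- Stands for: q is homogeneous of degree d, tested only through the double sums it produces. The
  -- arbitrary i and j make the property stable under multiplication by x and y. The bound e ≤ L
  -- keeps the moments involved within the range of H, as strong induction requires.
  record DForm (d : ℕ) (q : ℤ → ℤ → ℤ) : Set where
    constructor dform
    field use : ∀ i j e → i ℕ.+ j ℕ.+ d ≡ e → e ≤ L →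
            Form (4 ℕ.+ e) (DS (λ a b → oddPower (suc i) a * oddPower (suc j) b * q (a * a) (b * b)))
  open DForm

  dform-≡ : ∀ {d q r} → (∀ x y → q x y ≡ r x y) → DForm d q → DForm d r
  dform-≡ p K = dform λ i j e ije e≤L → form-≈ (DS-cong λ a b → cong (oddPower (suc i) a * oddPower (suc j) b *_) (p (a * a) (b * b))) (use K i j e ije e≤L)

  dform-0 : ∀ d → DForm d (λ _ _ → 0ℤ)
  dform-0 d = dform λ i j e _ _ → form-≈ (pw λ n → sym (Σ-zero (suc n) λ a _ → Σ-zero (suc n) λ b _ →
    cong (_* ww a b n) (ℤₚ.*-zeroʳ (oddPower (suc i) (+ suc a) * oddPower (suc j) (+ suc b))))) (form-0 (4 ℕ.+ e))

  dform-1 : DForm 0 (λ _ _ → 1ℤ)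
  dform-1 = dform λ i j e ije e≤L → form-≈
    (≈-sym (≈-trans (DS-cong λ a b → ℤₚ.*-identityʳ (oddPower (suc i) a * oddPower (suc j) b)) (DS-product (oddPower (suc i)) (oddPower (suc j)))))
    (form-deg (trans (lem i j) (cong (4 ℕ.+_) ije)) (form-· (H i (ℕₚ.≤-trans (ℕₚ.m≤m+n i j) (i+j≤L i j ije e≤L))) (H j (ℕₚ.≤-trans (ℕₚ.m≤n+m j i) (i+j≤L i j ije e≤L)))))
    where
    i+j≤L : ∀ i j {e} → i ℕ.+ j ℕ.+ 0 ≡ e → e ≤ L → i ℕ.+ j ≤ L
    i+j≤L i j ije e≤L = ℕₚ.≤-trans (ℕₚ.≤-reflexive (trans (sym (ℕₚ.+-identityʳ (i ℕ.+ j))) ije)) e≤L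
    lem : ∀ i j → (2 ℕ.+ i) ℕ.+ (2 ℕ.+ j) ≡ 4 ℕ.+ (i ℕ.+ j ℕ.+ 0)
    lem = ℕS.solve-∀

  dform-+ : ∀ {d q r} → DForm d q → DForm d r → DForm d (λ x y → q x y + r x y)
  dform-+ {q = q} {r} K M = dform λ i j e ije e≤L → form-≈
    (≈-sym (≈-trans (DS-cong λ a b → ℤₚ.*-distribˡ-+ (oddPower (suc i) a * oddPower (suc j) b) (q (a * a) (b * b)) (r (a * a) (b * b)))
      (DS-+ (λ a b → oddPower (suc i) a * oddPower (suc j) b * q (a * a) (b * b)) (λ a b → oddPower (suc i) a * oddPower (suc j) b * r (a * a) (b * b)))))
    (form-+ (use K i j e ije e≤L) (use M i j e ije e≤L))

  dform-* : ∀ {d q} c → DForm d q → DForm d (λ x y → c * q x y)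
  dform-* {q = q} c K = dform λ i j e ije e≤L → form-≈
    (≈-sym (≈-trans (DS-cong λ a b → lem (oddPower (suc i) a * oddPower (suc j) b) c (q (a * a) (b * b)))
      (DS-* c (λ a b → oddPower (suc i) a * oddPower (suc j) b * q (a * a) (b * b)))))
    (form-• c (use K i j e ije e≤L))
    where
    lem : ∀ u c v → u * (c * v) ≡ c * (u * v)
    lem = solve-∀

  -- A factor x = a² raises the exponent of a: one unit moves from d to i, and e stays the same.
  dform-x : ∀ {d q} → DForm d q → DForm (suc d) (λ x y → x * q x y)
  dform-x {d} {q} K = dform λ i j e ije e≤L → form-≈ (DS-cong λ a b → lem a ((a * a) ℤ.^ i) (oddPower (suc j) b) (q (a * a) (b * b)))
    (use K (suc i) j e (trans (sym (ℕₚ.+-suc (i ℕ.+ j) d)) ije) e≤L)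
    where
    lem : ∀ a p o v → a * (a * a * (a * a * p)) * o * v ≡ a * (a * a * p) * o * (a * a * v)
    lem = solve-∀

  dform-y : ∀ {d q} → DForm d q → DForm (suc d) (λ x y → y * q x y)
  dform-y {d} {q} K = dform λ i j e ije e≤L → form-≈ (DS-cong λ a b → lem b ((b * b) ℤ.^ j) (oddPower (suc i) a) (q (a * a) (b * b)))
    (use K i (suc j) e (trans (trans (cong (ℕ._+ d) (ℕₚ.+-suc i j)) (sym (ℕₚ.+-suc (i ℕ.+ j) d))) ije) e≤L)
    where
    lem : ∀ b p o v → o * (b * (b * b * (b * b * p))) * v ≡ o * (b * (b * b * p)) * (b * b * v)
    lem = solve-∀

  dform-x^ : ∀ l → DForm l (λ x _ → x ℤ.^ l)
  dform-x^ zero    = dform-1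
  dform-x^ (suc l) = dform-x (dform-x^ l)

  dform-y^ : ∀ l → DForm l (λ _ y → y ℤ.^ l)
  dform-y^ zero    = dform-1
  dform-y^ (suc l) = dform-y (dform-y^ l)

  dform-x+y : ∀ {d q} → DForm d q → DForm (suc d) (λ x y → (x + y) * q x y)
  dform-x+y {q = q} K = dform-≡ (λ x y → sym (ℤₚ.*-distribʳ-+ (q x y) x y)) (dform-+ (dform-x K) (dform-y K))

  dform-oddPart : ∀ l → DForm l (oddPart l)
  -- The index is shifted because `mixed 0` is zero and `mixed (suc l)` has degree l. `oddPart` and
  -- `mixed` refer to each other, so both are treated together.
  dform-mixed   : ∀ l → DForm l (mixed (suc l))

  dform-xy-mixed : ∀ l → DForm (suc l) (λ x y → x * y * mixed l x y)
  dform-xy-mixed zero    = dform-≡ (λ x y → sym (ℤₚ.*-zeroʳ (x * y))) (dform-0 1)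
  dform-xy-mixed (suc l) = dform-≡ (λ x y → sym (ℤₚ.*-assoc x y (mixed (suc l) x y))) (dform-x (dform-y (dform-mixed l)))

  dform-x+y-mixed : ∀ l → DForm l (λ x y → (x + y) * mixed l x y)
  dform-x+y-mixed zero    = dform-≡ (λ x y → sym (ℤₚ.*-zeroʳ (x + y))) (dform-0 0)
  dform-x+y-mixed (suc l) = dform-x+y (dform-mixed l)

  dform-oddPart zero    = dform-≡ (λ x y → refl) (dform-* (+ 2) dform-1)
  dform-oddPart (suc l) = dform-+ (dform-x+y (dform-oddPart l))
    (dform-* (+ 2) (dform-+ (dform-+ (dform-x (dform-x^ l)) (dform-y (dform-y^ l))) (dform-xy-mixed l)))

  dform-mixed l = dform-+ (dform-+ (dform-+ (dform-x^ l) (dform-y^ l)) (dform-x+y-mixed l)) (dform-* (+ 2) (dform-oddPart l))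

  form-remainder : Form (4 ℕ.+ L) (DS (remainder (suc L)))
  form-remainder = use (dform-mixed L) 0 0 L refl ℕₚ.≤-refl

remainder-0 : DS (remainder 0) ≈ 𝟎
remainder-0 = pw λ n → Σ-zero (suc n) λ a _ → Σ-zero (suc n) λ b _ → cong (_* ww a b n) (ℤₚ.*-zeroʳ (oddPower 1 (+ suc a) * oddPower 1 (+ suc b)))

-- Strong induction with n as the bound: the remainder for `C (3 + l)` reaches down to all of `C 1`,
-- ..., `C (1 + l)`.
form-C≤ : ∀ n l → l ≤ n → Form (2 ℕ.+ l) (C (suc l))
form-C≤ n zero _ = form-b
form-C≤ (suc n) (suc zero) _ = form-≈ (≈-sym (recurrence 0)) (form-+ (form-· form-a form-b) (form-• (+ 12) (form-≈ (≈-sym remainder-0) (form-0 3))))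
form-C≤ (suc n) (suc (suc l)) (s≤s l<n) = form-≈ (≈-sym (recurrence (suc l)))
  (form-+ (form-· form-a (form-C≤ n (suc l) l<n))
          (form-• (+ 12) (DoubleForms.form-remainder l λ i i≤l → form-C≤ n i (ℕₚ.≤-trans i≤l (ℕₚ.≤-trans (ℕₚ.n≤1+n l) l<n)))))

form-C : ∀ l → Form (2 ℕ.+ l) (C (suc l))
form-C l = form-C≤ l l ℕₚ.≤-refl

pow-pow : ∀ f a b → pow (pow f a) b ≈ pow f (b ℕ.* a)
pow-pow f a zero    = ≈-refl
pow-pow f a (suc b) = ≈-trans (pow f a ⟨·⟩ pow-pow f a b) (≈-sym (pow-+ f a (b ℕ.* a)))

form-△ : ∀ j {f} → Form (j ℕ.+ j) f → Ord j f → f ≈ f j • (X j · pow △ (j ℕ.* 8))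
form-△ j {f} p o = ≈-trans (Extraction.form-leading A (C 1) (pow △ 8) refl C₁≈q△⁸ (pow-at-0 {△} refl 8) j p o) (f j ⟨•⟩ (X j ⟨·⟩ pow-pow △ 8 j))

-- Sums over boxes

SZ : ℕ → (ℤ → ℤ) → ℤ
SZ B f = f 0ℤ + Σ B (λ k → f (+ suc k) + f -[1+ k ])

SZ-cong : ∀ B {f g : ℤ → ℤ} → (∀ x → f x ≡ g x) → SZ B f ≡ SZ B g
SZ-cong B e = cong₂ _+_ (e 0ℤ) (Σ-cong B λ k → cong₂ _+_ (e (+ suc k)) (e -[1+ k ]))

SZ-zero : ∀ B {f : ℤ → ℤ} → (∀ x → f x ≡ 0ℤ) → SZ B f ≡ 0ℤ
SZ-zero B e = cong₂ _+_ (e 0ℤ) (Σ-zero B λ k _ → cong₂ _+_ (e (+ suc k)) (e -[1+ k ]))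

SZ-+ : ∀ B (f g : ℤ → ℤ) → SZ B (λ x → f x + g x) ≡ SZ B f + SZ B g
SZ-+ B f g = trans ((f 0ℤ + g 0ℤ) ⟨+⟩ trans (Σ-cong B λ k → lem (f (+ suc k)) (g (+ suc k)) (f -[1+ k ]) (g -[1+ k ]))
    (Σ-+ B (λ k → f (+ suc k) + f -[1+ k ]) (λ k → g (+ suc k) + g -[1+ k ])))
  (lem (f 0ℤ) (g 0ℤ) (Σ B (λ k → f (+ suc k) + f -[1+ k ])) (Σ B (λ k → g (+ suc k) + g -[1+ k ])))
  where
  lem : ∀ a b c d → (a + b) + (c + d) ≡ (a + c) + (b + d)
  lem = solve-∀

SZ-*ˡ : ∀ B c (f : ℤ → ℤ) → SZ B (λ x → c * f x) ≡ c * SZ B f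
SZ-*ˡ B c f = trans ((c * f 0ℤ) ⟨+⟩ trans (Σ-cong B λ k → sym (ℤₚ.*-distribˡ-+ c (f (+ suc k)) (f -[1+ k ])))
    (Σ-*ˡ B c (λ k → f (+ suc k) + f -[1+ k ]))) (sym (ℤₚ.*-distribˡ-+ c (f 0ℤ) (Σ B (λ k → f (+ suc k) + f -[1+ k ]))))

SZ-Σ : ∀ B n (f : ℤ → ℕ → ℤ) → SZ B (λ x → Σ n (f x)) ≡ Σ n (λ i → SZ B (λ x → f x i))
SZ-Σ B zero    f = SZ-zero B λ _ → refl
SZ-Σ B (suc n) f = trans (SZ-+ B (λ x → f x 0) (λ x → Σ n (f x ∘ suc))) (SZ B (λ x → f x 0) ⟨+⟩ SZ-Σ B n (λ x → f x ∘ suc))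

SZ-swap : ∀ B B′ (f : ℤ → ℤ → ℤ) → SZ B (λ x → SZ B′ (f x)) ≡ SZ B′ (λ y → SZ B (λ x → f x y))
SZ-swap B B′ f = trans (SZ-+ B (λ x → f x 0ℤ) (λ x → Σ B′ (λ k → f x (+ suc k) + f x -[1+ k ])))
  (SZ B (λ x → f x 0ℤ) ⟨+⟩ trans (SZ-Σ B B′ (λ x k → f x (+ suc k) + f x -[1+ k ]))
    (Σ-cong B′ λ k → SZ-+ B (λ x → f x (+ suc k)) (λ x → f x -[1+ k ])))

SZ-extend : ∀ {S B} (f : ℤ → ℤ) → S ≤ B → (∀ x → S < ∣ x ∣ → f x ≡ 0ℤ) → SZ B f ≡ SZ S f
SZ-extend f S≤B e = f 0ℤ ⟨+⟩ Σ-extend (λ k → f (+ suc k) + f -[1+ k ]) S≤B λ k S≤k → cong₂ _+_ (e (+ suc k) (s≤s S≤k)) (e -[1+ k ] (s≤s S≤k))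

bs : ∀ n → ℕ → (Vec ℤ n → ℤ) → ℤ
bs zero    B f = f []
bs (suc n) B f = SZ B (λ x → bs n B (λ v → f (x ∷ v)))

bs-cong : ∀ n B {f g : Vec ℤ n → ℤ} → (∀ v → f v ≡ g v) → bs n B f ≡ bs n B g
bs-cong zero    B e = e []
bs-cong (suc n) B e = SZ-cong B λ x → bs-cong n B λ v → e (x ∷ v)

bs-zero : ∀ n B {f : Vec ℤ n → ℤ} → (∀ v → f v ≡ 0ℤ) → bs n B f ≡ 0ℤ
bs-zero zero    B e = e []
bs-zero (suc n) B e = SZ-zero B λ x → bs-zero n B λ v → e (x ∷ v)

bs-+ : ∀ n B (f g : Vec ℤ n → ℤ) → bs n B (λ v → f v + g v) ≡ bs n B f + bs n B g
bs-+ zero    B f g = refl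
bs-+ (suc n) B f g = trans (SZ-cong B λ x → bs-+ n B (λ v → f (x ∷ v)) (λ v → g (x ∷ v)))
  (SZ-+ B (λ x → bs n B (λ v → f (x ∷ v))) (λ x → bs n B (λ v → g (x ∷ v))))

bs-*ˡ : ∀ n B c (f : Vec ℤ n → ℤ) → bs n B (λ v → c * f v) ≡ c * bs n B f
bs-*ˡ zero    B c f = refl
bs-*ˡ (suc n) B c f = trans (SZ-cong B λ x → bs-*ˡ n B c (λ v → f (x ∷ v))) (SZ-*ˡ B c (λ x → bs n B (λ v → f (x ∷ v))))

bs-Σ : ∀ n B m (f : Vec ℤ n → ℕ → ℤ) → bs n B (λ v → Σ m (f v)) ≡ Σ m (λ i → bs n B (λ v → f v i))
bs-Σ n B zero    f = bs-zero n B λ _ → refl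
bs-Σ n B (suc m) f = trans (bs-+ n B (λ v → f v 0) (λ v → Σ m (f v ∘ suc))) (bs n B (λ v → f v 0) ⟨+⟩ bs-Σ n B m (λ v → f v ∘ suc))

Supported : ∀ {n} → ℕ → (Vec ℤ n → ℤ) → Set
Supported S f = ∀ v → ¬ All (λ x → ∣ x ∣ ≤ S) v → f v ≡ 0ℤ

supported-tail : ∀ {n S} {f : Vec ℤ (suc n) → ℤ} x → Supported S f → Supported S (λ v → f (x ∷ v))
supported-tail x s v ¬all = s (x ∷ v) λ { (_ ∷ all) → ¬all all }

supported-head : ∀ {n S} B {f : Vec ℤ (suc n) → ℤ} x → Supported S f → S < ∣ x ∣ → bs n B (λ v → f (x ∷ v)) ≡ 0ℤ
supported-head {n} B x s S<x = bs-zero n B λ v → s (x ∷ v) λ { (x≤S ∷ _) → ℕₚ.<⇒≱ S<x x≤S }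

bs-extend : ∀ n {S B} (f : Vec ℤ n → ℤ) → S ≤ B → Supported S f → bs n B f ≡ bs n S f
bs-extend zero    f S≤B s = refl
bs-extend (suc n) {S} {B} f S≤B s = trans (SZ-cong B λ x → bs-extend n (λ v → f (x ∷ v)) S≤B (supported-tail {f = f} x s))
  (SZ-extend (λ x → bs n S (λ v → f (x ∷ v))) S≤B (λ x → supported-head S {f} x s))

-- sgn x · q^|x| / (1 - q^(2|x|)) for x ≠ 0; the value at 0 is irrelevant
-- for the moments of positive order.
ŵ : ℤ → Series
ŵ (+ zero)  = ι 1ℤ
ŵ (+ suc a) = w (suc a)
ŵ -[1+ a ]  = ⊟ w (suc a)

Ord-ŵ : ∀ x → Ord ∣ x ∣ (ŵ x)
Ord-ŵ (+ zero)  n ()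
Ord-ŵ (+ suc a) = Ord-w (suc a)
Ord-ŵ -[1+ a ]  = Ord-⊟ (Ord-w (suc a))

W : ∀ {n} → Vec ℤ n → Series
W []      = ι 1ℤ
W (x ∷ v) = ŵ x · W v

absSum : ∀ {n} → Vec ℤ n → ℕ
absSum []      = 0
absSum (x ∷ v) = ∣ x ∣ ℕ.+ absSum v

Ord-W : ∀ {n} (v : Vec ℤ n) → Ord (absSum v) (W v)
Ord-W []      n ()
Ord-W (x ∷ v) = Ord-· {f = ŵ x} {g = W v} (Ord-ŵ x) (Ord-W v)

all≤absSum : ∀ {n} (v : Vec ℤ n) → All (λ x → ∣ x ∣ ≤ absSum v) v
all≤absSum v = go v (absSum v) ℕₚ.≤-refl
  where
  go : ∀ {n} (v : Vec ℤ n) N → absSum v ≤ N → All (λ x → ∣ x ∣ ≤ N) v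
  go []      N _  = []
  go (x ∷ v) N le = ℕₚ.≤-trans (ℕₚ.m≤m+n ∣ x ∣ (absSum v)) le ∷ go v N (ℕₚ.≤-trans (ℕₚ.m≤n+m (absSum v) ∣ x ∣) le)

all-≤ : ∀ {n} {v : Vec ℤ n} {M N} → M ≤ N → All (λ x → ∣ x ∣ ≤ M) v → All (λ x → ∣ x ∣ ≤ N) v
all-≤ M≤N []         = []
all-≤ M≤N (p ∷ all)  = ℕₚ.≤-trans p M≤N ∷ all-≤ M≤N all

supported-W : ∀ {n} (p : Vec ℤ n → ℤ) N → Supported N (λ v → p v * W v N)
supported-W p N v ¬all with N ℕ.<? absSum v
... | yes N< = trans (cong (p v *_) (Ord-W v N N<)) (ℤₚ.*-zeroʳ (p v))
... | no N≮  = ⊥-elim (¬all (all-≤ (ℕₚ.≮⇒≥ N≮) (all≤absSum v)))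

-- Σ over r ∈ ℤ^n of p(r) Π ŵ(rᵢ); in degree N the entries beyond N do not
-- contribute.
Tn : ∀ n → (Vec ℤ n → ℤ) → Series
Tn n p N = bs n N (λ v → p v * W v N)

Tn-at : ∀ n p {N B} → N ≤ B → bs n B (λ v → p v * W v N) ≡ Tn n p N
Tn-at n p {N} N≤B = bs-extend n (λ v → p v * W v N) N≤B (supported-W p N)

Tn-cong : ∀ n {p q} → (∀ v → p v ≡ q v) → Tn n p ≈ Tn n q
Tn-cong n e = pw λ N → bs-cong n N λ v → cong (_* W v N) (e v)

Tn-+ : ∀ n p q → Tn n (λ v → p v + q v) ≈ Tn n p ⊞ Tn n q
Tn-+ n p q = pw λ N → trans (bs-cong n N λ v → ℤₚ.*-distribʳ-+ (W v N) (p v) (q v)) (bs-+ n N (λ v → p v * W v N) (λ v → q v * W v N))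

Tn-* : ∀ n c p → Tn n (λ v → c * p v) ≈ c • Tn n p
Tn-* n c p = pw λ N → trans (bs-cong n N λ v → ℤₚ.*-assoc c (p v) (W v N)) (bs-*ˡ n N c (λ v → p v * W v N))

-- Moments over the nonzero integers

Mz : (ℤ → ℤ) → Series
Mz a N = SZ N (λ x → a x * ŵ x N)

Mz-at : ∀ a {N B} → N ≤ B → SZ B (λ x → a x * ŵ x N) ≡ Mz a N
Mz-at a {N} N≤B = SZ-extend (λ x → a x * ŵ x N) N≤B λ x N<x → trans (cong (a x *_) (Ord-ŵ x N N<x)) (ℤₚ.*-zeroʳ (a x))

-- A Cauchy product: in degree N the box of size N is large enough for the degrees i and N - i of
-- both factors.
Tn-product : ∀ n a p → Tn (suc n) (λ { (x ∷ v) → a x * p v }) ≈ Mz a · Tn n p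
Tn-product n a p = pw λ N → begin
  SZ N (λ x → bs n N (λ v → a x * p v * Σ (suc N) (λ i → ŵ x i * W v (N ∸ i))))
    ≡⟨ SZ-cong N (λ x → trans (bs-cong n N λ v → trans (sym (Σ-*ˡ (suc N) (a x * p v) (λ i → ŵ x i * W v (N ∸ i))))
           (Σ-cong (suc N) λ i → lem (a x) (p v) (ŵ x i) (W v (N ∸ i))))
         (trans (bs-Σ n N (suc N) (λ v i → a x * ŵ x i * (p v * W v (N ∸ i))))
           (Σ-cong (suc N) λ i → trans (bs-*ˡ n N (a x * ŵ x i) (λ v → p v * W v (N ∸ i))) (cong (a x * ŵ x i *_) (Tn-at n p (ℕₚ.m∸n≤m N i)))))) ⟩
  SZ N (λ x → Σ (suc N) (λ i → a x * ŵ x i * Tn n p (N ∸ i)))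
    ≡⟨ SZ-Σ N (suc N) (λ x i → a x * ŵ x i * Tn n p (N ∸ i)) ⟩
  Σ (suc N) (λ i → SZ N (λ x → a x * ŵ x i * Tn n p (N ∸ i)))
    ≡⟨ Σ-cong< (suc N) (λ i i≤N → trans (SZ-cong N λ x → ℤₚ.*-comm (a x * ŵ x i) (Tn n p (N ∸ i)))
         (trans (SZ-*ˡ N (Tn n p (N ∸ i)) (λ x → a x * ŵ x i)) (trans (ℤₚ.*-comm (Tn n p (N ∸ i)) _) (cong (_* Tn n p (N ∸ i)) (Mz-at a (ℕₚ.≤-pred i≤N)))))) ⟩
  (Mz a · Tn n p) N ∎
  where
  lem : ∀ a p u v → a * p * (u * v) ≡ a * u * (p * v)
  lem = solve-∀

-- `ŵ` is odd away from 0, so k and -k combine to a(k) - a(-k); a(0) = 0 removes its conventional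
-- value at 0.
Mz-signed : ∀ a → a 0ℤ ≡ 0ℤ → Mz a ≈ Σ∞ (λ k → (a (+ suc k) + - a -[1+ k ]) • w (suc k))
Mz-signed a a0 = pw λ N → trans (cong₂ _+_ (cong (_* ι 1ℤ N) a0) (Σ-cong N λ k → lem (a (+ suc k)) (a -[1+ k ]) (w (suc k) N)))
  (trans (ℤₚ.+-identityˡ _) (sym (Σ-extend (λ k → (a (+ suc k) + - a -[1+ k ]) * w (suc k) N) (ℕₚ.n≤1+n N)
    λ k N≤k → trans (cong ((a (+ suc k) + - a -[1+ k ]) *_) (Ord-w (suc k) N (s≤s N≤k))) (ℤₚ.*-zeroʳ (a (+ suc k) + - a -[1+ k ])))))
  where
  lem : ∀ a b w → a * w + b * - w ≡ (a + - b) * w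
  lem = solve-∀

^-double : ∀ x l → x ℤ.^ (l ℕ.+ l) ≡ (x * x) ℤ.^ l
^-double x zero    = refl
^-double x (suc l) = trans (cong (λ m → x * x ℤ.^ m) (ℕₚ.+-suc l l)) (trans (cong (λ u → x * (x * u)) (^-double x l)) (sym (ℤₚ.*-assoc x x ((x * x) ℤ.^ l))))

parity : ∀ e → (Σ[ l ∈ ℕ ] e ≡ l ℕ.+ l) ⊎ (Σ[ l ∈ ℕ ] e ≡ suc (l ℕ.+ l))
parity zero = inj₁ (0 , refl)
parity (suc e) with parity e
... | inj₁ (l , refl) = inj₂ (l , refl)
... | inj₂ (l , refl) = inj₁ (suc l , cong suc (sym (ℕₚ.+-suc l l)))

-- The exponent starts at 2, the contribution of (0 - x)² in Δ(0, r)². The lowest odd order is then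
-- 3, so `C 0` cannot appear.
power : ℕ → ℤ → ℤ
power e x = x ℤ.^ (2 ℕ.+ e)

Mz-even : ∀ l → Mz (power (l ℕ.+ l)) ≈ 𝟎
Mz-even l = ≈-trans (Mz-signed (power (l ℕ.+ l)) refl) (pw λ n → Σ-zero (suc n) λ k _ →
  cong (_* w (suc k) n) (trans (cong₂ (λ u v → u + - v) (square (+ suc k)) (trans (square -[1+ k ]) (evenPower-neg (suc l) (+ suc k)))) (ℤₚ.+-inverseʳ (evenPower (suc l) (+ suc k)))))
  where
  square : ∀ x → power (l ℕ.+ l) x ≡ evenPower (suc l) x
  square x = trans (cong (λ u → x * (x * u)) (^-double x l)) (sym (ℤₚ.*-assoc x x ((x * x) ℤ.^ l)))

Mz-odd : ∀ l → Mz (power (suc (l ℕ.+ l))) ≈ + 2 • C (suc l)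
Mz-odd l = ≈-trans (Mz-signed (power (suc (l ℕ.+ l))) refl) (≈-trans (Σ∞-cong λ k → pw λ n →
  trans (cong (_* w (suc k) n) (cong₂ (λ u v → u + - v) (odd-power (+ suc k)) (trans (odd-power -[1+ k ]) (cong (-[1+ k ] *_) (evenPower-neg (suc l) (+ suc k))))))
    (lem (+ suc k) (evenPower (suc l) (+ suc k)) (w (suc k) n)))
  (Σ∞-• (+ 2) (λ k → oddPower (suc l) (+ suc k) • w (suc k))))
  where
  odd-power : ∀ x → power (suc (l ℕ.+ l)) x ≡ x * evenPower (suc l) x
  odd-power x = cong (x *_) (trans (cong (λ u → x * (x * u)) (^-double x l)) (sym (ℤₚ.*-assoc x x ((x * x) ℤ.^ l))))
  lem : ∀ x p u → (x * p + - (- x * p)) * u ≡ + 2 * (x * p * u)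
  lem = solve-∀

-- Moments of even order vanish, so in odd weight there is only zero.
WeightForm : ℕ → Series → Set
WeightForm k f = (Σ[ h ∈ ℕ ] k ≡ h ℕ.+ h × Form h f) ⊎ f ≈ 𝟎

wf-power : ∀ e → WeightForm (3 ℕ.+ e) (Mz (power e))
wf-power e with parity e
... | inj₁ (l , refl) = inj₂ (Mz-even l)
... | inj₂ (l , refl) = inj₁ (2 ℕ.+ l , lem l , form-≈ (≈-sym (Mz-odd l)) (form-• (+ 2) (form-C l)))
  where
  lem : ∀ l → 4 ℕ.+ (l ℕ.+ l) ≡ (2 ℕ.+ l) ℕ.+ (2 ℕ.+ l)
  lem = ℕS.solve-∀

wf-· : ∀ {j k f g} → WeightForm j f → WeightForm k g → WeightForm (j ℕ.+ k) (f · g)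
wf-· (inj₁ (h , refl , p)) (inj₁ (i , refl , q)) = inj₁ (h ℕ.+ i , lem h i , form-· p q)
  where
  lem : ∀ h i → (h ℕ.+ h) ℕ.+ (i ℕ.+ i) ≡ (h ℕ.+ i) ℕ.+ (h ℕ.+ i)
  lem = ℕS.solve-∀
wf-· {g = g} (inj₂ z) _ = inj₂ (𝟎-· g z)
wf-· {f = f} {g} (inj₁ _) (inj₂ z) = inj₂ (≈-trans (·-comm f g) (𝟎-· f z))

double-injective : ∀ h i → h ℕ.+ h ≡ i ℕ.+ i → h ≡ i
double-injective zero    zero    e = refl
double-injective (suc h) (suc i) e = cong suc (double-injective h i (ℕₚ.suc-injective (trans (sym (ℕₚ.+-suc h h)) (trans (ℕₚ.suc-injective e) (ℕₚ.+-suc i i)))))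

wf-form : ∀ h {f} → WeightForm (h ℕ.+ h) f → Form h f
wf-form h (inj₁ (i , e , p)) = form-deg (sym (double-injective h i e)) p
wf-form h (inj₂ z) = form-≈ (≈-sym z) (form-0 h)

-- The sum over Δ(0, r)² as a form

mono : ∀ {n} → Vec ℕ n → Vec ℤ n → ℤ
mono []       []      = 1ℤ
mono (e ∷ es) (x ∷ v) = power e x * mono es v

-- The moment of order e + 2 has modular weight e + 3.
weight : ∀ {n} → Vec ℕ n → ℕ
weight []       = 0
weight (e ∷ es) = (3 ℕ.+ e) ℕ.+ weight es

wf-mono : ∀ {n} (es : Vec ℕ n) → WeightForm (weight es) (Tn n (mono es))
wf-mono []       = inj₁ (0 , refl , form-≈ (pw λ N → sym (ℤₚ.*-identityˡ (ι 1ℤ N))) form-1)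
wf-mono {suc n} (e ∷ es) = subst-wf (wf-· (wf-power e) (wf-mono es))
  where
  step : Tn (suc n) (mono (e ∷ es)) ≈ Mz (power e) · Tn n (mono es)
  step = ≈-trans (Tn-cong (suc n) {mono (e ∷ es)} {λ { (x ∷ v) → power e x * mono es v }} λ { (x ∷ v) → refl }) (Tn-product n (power e) (mono es))
  subst-wf : ∀ {k} → WeightForm k (Mz (power e) · Tn n (mono es)) → WeightForm k (Tn (suc n) (mono (e ∷ es)))
  subst-wf (inj₁ (h , eq , p)) = inj₁ (h , eq , form-≈ (≈-sym step) p)
  subst-wf (inj₂ z)            = inj₂ (≈-trans step z)

-- Homogeneity of p, tested through Tn.
record Homogeneous {n : ℕ} (d : ℕ) (p : Vec ℤ n → ℤ) : Set where
  constructor homogeneous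
  field form-at : ∀ es h → weight es ℕ.+ d ≡ h ℕ.+ h → Form h (Tn n (λ v → mono es v * p v))
open Homogeneous

hom-≡ : ∀ {n d} {p q : Vec ℤ n → ℤ} → (∀ v → p v ≡ q v) → Homogeneous d p → Homogeneous d q
hom-≡ {n} e H = homogeneous λ es h eq → form-≈ (Tn-cong n λ v → cong (mono es v *_) (e v)) (form-at H es h eq)

hom-1 : ∀ {n} → Homogeneous {n} 0 (λ _ → 1ℤ)
hom-1 {n} = homogeneous λ es h eq → form-≈ (Tn-cong n λ v → sym (ℤₚ.*-identityʳ (mono es v)))
  (wf-form h (subst (λ k → WeightForm k (Tn n (mono es))) (trans (sym (ℕₚ.+-identityʳ (weight es))) eq) (wf-mono es)))

hom-+ : ∀ {n d} {p q : Vec ℤ n → ℤ} → Homogeneous d p → Homogeneous d q → Homogeneous d (λ v → p v + q v)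
hom-+ {n} {p = p} {q} H K = homogeneous λ es h eq → form-≈
  (≈-sym (≈-trans (Tn-cong n λ v → ℤₚ.*-distribˡ-+ (mono es v) (p v) (q v)) (Tn-+ n (λ v → mono es v * p v) (λ v → mono es v * q v))))
  (form-+ (form-at H es h eq) (form-at K es h eq))

hom-* : ∀ {n d} {p : Vec ℤ n → ℤ} c → Homogeneous d p → Homogeneous d (λ v → c * p v)
hom-* {n} {p = p} c H = homogeneous λ es h eq → form-≈
  (≈-sym (≈-trans (Tn-cong n λ v → lem (mono es v) c (p v)) (Tn-* n c (λ v → mono es v * p v))))
  (form-• c (form-at H es h eq))
  where
  lem : ∀ u c v → u * (c * v) ≡ c * (u * v)
  lem = solve-∀

mono-update : ∀ {n} (es : Vec ℕ n) i v → mono (updateAt es i suc) v ≡ mono es v * lookup v i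
mono-update (e ∷ es) Fin.zero (x ∷ v) = lem x (x ℤ.^ e) (mono es v)
  where
  lem : ∀ x p m → x * (x * (x * p)) * m ≡ x * (x * p) * m * x
  lem = solve-∀
mono-update (e ∷ es) (Fin.suc i) (x ∷ v) = trans (cong (power e x *_) (mono-update es i v)) (sym (ℤₚ.*-assoc (power e x) (mono es v) (lookup v i)))

weight-update : ∀ {n} (es : Vec ℕ n) i → weight (updateAt es i suc) ≡ suc (weight es)
weight-update (e ∷ es) Fin.zero    = refl
weight-update (e ∷ es) (Fin.suc i) = trans (cong (3 ℕ.+ e ℕ.+_) (weight-update es i)) (ℕₚ.+-suc (3 ℕ.+ e) (weight es))

-- The variable is absorbed into the exponents of `mono`; for this `form-at` admits every `es`.
hom-var : ∀ {n d} {p : Vec ℤ n → ℤ} i → Homogeneous d p → Homogeneous (suc d) (λ v → lookup v i * p v)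
hom-var {n} {d} {p} i H = homogeneous λ es h eq → form-≈
  (Tn-cong n λ v → trans (cong (_* p v) (mono-update es i v)) (ℤₚ.*-assoc (mono es v) (lookup v i) (p v)))
  (form-at H (updateAt es i suc) h (trans (cong (ℕ._+ d) (weight-update es i)) (trans (sym (ℕₚ.+-suc (weight es) d)) eq)))

hom-diff : ∀ {n d} {p : Vec ℤ n → ℤ} i j → Homogeneous d p → Homogeneous (suc d) (λ v → (lookup v i - lookup v j) * p v)
hom-diff {p = p} i j H = hom-≡ (λ v → lem (lookup v i) (lookup v j) (p v)) (hom-+ (hom-var i H) (hom-* (- + 1) (hom-var j H)))
  where
  lem : ∀ a b c → a * c + - + 1 * (b * c) ≡ (a - b) * c
  lem = solve-∀

vdmDegree : ℕ → ℕ
vdmDegree zero    = 0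
vdmDegree (suc k) = (k ℕ.+ k) ℕ.+ vdmDegree k

vdmRow : ∀ {n} → ℤ → Vec ℤ n → ℤ
vdmRow x = Vec.foldr _ (λ y acc → ((x - y) * (x - y)) * acc) 1ℤ

hom-row : ∀ {n d k} {p : Vec ℤ n → ℤ} i (js : Vec (Fin n) k) → Homogeneous d p →
  Homogeneous ((k ℕ.+ k) ℕ.+ d) (λ v → vdmRow (lookup v i) (Vec.map (lookup v) js) * p v)
hom-row {p = p} i [] H = hom-≡ (λ v → sym (ℤₚ.*-identityˡ (p v))) H
hom-row {n} {d} {suc k} {p} i (j ∷ js) H = subst (λ m → Homogeneous m row) (cong (λ m → suc m ℕ.+ d) (sym (ℕₚ.+-suc k k)))
  (hom-≡ {p = λ v → δ v * (δ v * (rest v * p v))} (λ v → lem (δ v) (rest v) (p v))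
    (hom-diff {p = λ v → δ v * (rest v * p v)} i j (hom-diff {p = λ v → rest v * p v} i j (hom-row i js H))))
  where
  δ rest row : Vec ℤ n → ℤ
  δ v = lookup v i - lookup v j
  rest v = vdmRow (lookup v i) (Vec.map (lookup v) js)
  row v = vdmRow (lookup v i) (Vec.map (lookup v) (j ∷ js)) * p v
  lem : ∀ a b c → a * (a * (b * c)) ≡ a * a * b * c
  lem = solve-∀

-- `Homogeneous` speaks of functions of the full vector, so the induction runs over a vector of
-- positions, not over the entries.
hom-vdm : ∀ {n k} (js : Vec (Fin n) k) → Homogeneous (vdmDegree k) (λ v → vdm2 (Vec.map (lookup v) js))
hom-vdm []       = hom-1
hom-vdm (j ∷ js) = hom-row j js (hom-vdm js)

hom-vdm2 : ∀ n → Homogeneous {n} (vdmDegree n) vdm2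
hom-vdm2 n = hom-≡ (λ v → cong vdm2 (Vecₚ.map-lookup-allFin v)) (hom-vdm (allFin n))

vdmRow-0 : ∀ {n} (v : Vec ℤ n) → vdmRow 0ℤ v ≡ mono (replicate n 0) v
vdmRow-0 []      = refl
vdmRow-0 (x ∷ v) = cong₂ _*_ (lem x) (vdmRow-0 v)
  where
  lem : ∀ x → (+ 0 - x) * (+ 0 - x) ≡ x * (x * + 1)
  lem = solve-∀

weight-total : ∀ n → weight (replicate n 0) ℕ.+ vdmDegree n ≡ n ℕ.* n ℕ.+ (n ℕ.+ n)
weight-total zero    = refl
weight-total (suc n) = trans (lem₁ (weight (replicate n 0)) n (vdmDegree n)) (trans (cong (3 ℕ.+ (n ℕ.+ n) ℕ.+_) (weight-total n)) (lem₂ n))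
  where
  lem₁ : ∀ w n v → (3 ℕ.+ w) ℕ.+ ((n ℕ.+ n) ℕ.+ v) ≡ 3 ℕ.+ (n ℕ.+ n) ℕ.+ (w ℕ.+ v)
  lem₁ = ℕS.solve-∀
  lem₂ : ∀ n → 3 ℕ.+ (n ℕ.+ n) ℕ.+ (n ℕ.* n ℕ.+ (n ℕ.+ n)) ≡ suc n ℕ.* suc n ℕ.+ (suc n ℕ.+ suc n)
  lem₂ = ℕS.solve-∀

vandermondeSum : ℕ → Series
vandermondeSum n = Tn n (λ v → vdm2 (0ℤ ∷ v))

-- The total weight is 3n from the base exponents plus n (n - 1) from the Vandermonde square; for n
-- = 2s this is 4 s (s + 1), twice the degree.
form-vandermondeSum : ∀ s → Form (s ℕ.* suc s ℕ.+ s ℕ.* suc s) (vandermondeSum (s ℕ.+ s))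
form-vandermondeSum s = form-≈ (Tn-cong n λ v → cong (_* vdm2 v) (sym (vdmRow-0 v)))
  (form-at (hom-vdm2 n) (replicate n 0) (s ℕ.* suc s ℕ.+ s ℕ.* suc s) (trans (weight-total n) (lem s)))
  where
  n = s ℕ.+ s
  lem : ∀ s → (s ℕ.+ s) ℕ.* (s ℕ.+ s) ℕ.+ ((s ℕ.+ s) ℕ.+ (s ℕ.+ s)) ≡ (s ℕ.* suc s ℕ.+ s ℕ.* suc s) ℕ.+ (s ℕ.* suc s ℕ.+ s ℕ.* suc s)
  lem = ℕS.solve-∀

-- The leading coefficient

lsum : ∀ {I : Set} → List I → (I → ℤ) → ℤ
lsum []      f = 0ℤ
lsum (x ∷ l) f = f x + lsum l f

lsum-cong : ∀ l {f g : ℤ → ℤ} → (∀ x → x ∈ l → f x ≡ g x) → lsum l f ≡ lsum l g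
lsum-cong []      e = refl
lsum-cong (x ∷ l) e = cong₂ _+_ (e x (here refl)) (lsum-cong l λ y y∈l → e y (there y∈l))

lsum-++ : ∀ (l k : List ℤ) f → lsum (l ++ k) f ≡ lsum l f + lsum k f
lsum-++ []      k f = sym (ℤₚ.+-identityˡ (lsum k f))
lsum-++ (x ∷ l) k f = trans (f x ⟨+⟩ lsum-++ l k f) (sym (ℤₚ.+-assoc (f x) (lsum l f) (lsum k f)))

lsum-↭ : ∀ {I : Set} {l k : List I} f → l ↭ k → lsum l f ≡ lsum k f
lsum-↭ f ↭.refl = refl
lsum-↭ f (↭.prep x p) = f x ⟨+⟩ lsum-↭ f p
lsum-↭ {l = _ ∷ _ ∷ l} {_ ∷ _ ∷ k} f (↭.swap x y p) = trans (f x ⟨+⟩ (f y ⟨+⟩ lsum-↭ f p)) (lem (f x) (f y) (lsum k f))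
  where
  lem : ∀ a b c → a + (b + c) ≡ b + (a + c)
  lem = solve-∀
lsum-↭ f (↭.trans p q) = trans (lsum-↭ f p) (lsum-↭ f q)

lsum-zero : ∀ l {f : ℤ → ℤ} → (∀ x → x ∈ l → f x ≡ 0ℤ) → lsum l f ≡ 0ℤ
lsum-zero []      e = refl
lsum-zero (x ∷ l) e = cong₂ _+_ (e x (here refl)) (lsum-zero l λ y y∈l → e y (there y∈l))

lsum-const : ∀ (l : List ℤ) c → lsum l (λ _ → c) ≡ + List.length l * c
lsum-const []      c = refl
lsum-const (x ∷ l) c = trans (c ⟨+⟩ lsum-const l c) (lem c (+ List.length l))
  where
  lem : ∀ c n → c + n * c ≡ (+ 1 + n) * c
  lem = solve-∀

words : ℕ → List ℤ → (List ℤ → ℤ) → ℤ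
words zero    l F = F []
words (suc n) l F = lsum l (λ x → words n l (λ r → F (x ∷ r)))

words-cong : ∀ n l {F G : List ℤ → ℤ} → (∀ r → F r ≡ G r) → words n l F ≡ words n l G
words-cong zero    l e = e []
words-cong (suc n) l e = lsum-cong l λ x _ → words-cong n l λ r → e (x ∷ r)

words-zero : ∀ n l {F : List ℤ → ℤ} → (∀ r → F r ≡ 0ℤ) → words n l F ≡ 0ℤ
words-zero zero    l e = e []
words-zero (suc n) l e = lsum-zero l λ x _ → words-zero n l λ r → e (x ∷ r)

words-↭ : ∀ n {l k} F → l ↭ k → words n l F ≡ words n k F
words-↭ zero        F p = refl
words-↭ (suc n) {l} {k} F p = trans (lsum-cong l λ x _ → words-↭ n (λ r → F (x ∷ r)) p) (lsum-↭ (λ x → words n k (λ r → F (x ∷ r))) p)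

-- As q vanishes on repetitions, only the rearrangements of Y contribute.
words-symmetric : ∀ (q : List ℤ → ℤ) → (∀ {l k} → l ↭ k → q l ≡ q k) → (∀ x l → q (x ∷ x ∷ l) ≡ 0ℤ) →
  ∀ n P Y → List.length Y ≡ n → words n (P ++ Y) (λ r → q (P ++ r)) ≡ + (n !) * q (P ++ Y)
words-symmetric q q-↭ q-rep zero    P []      _ = sym (ℤₚ.*-identityˡ (q (P ++ [])))
words-symmetric q q-↭ q-rep (suc n) P Y len = begin
  lsum (P ++ Y) (λ x → words n (P ++ Y) (λ r → q (P ++ x ∷ r)))
    ≡⟨ lsum-++ P Y (λ x → words n (P ++ Y) (λ r → q (P ++ x ∷ r))) ⟩
  lsum P (λ x → words n (P ++ Y) (λ r → q (P ++ x ∷ r))) + lsum Y (λ x → words n (P ++ Y) (λ r → q (P ++ x ∷ r)))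
    ≡⟨ cong₂ _+_ (lsum-zero P λ x x∈P → words-zero n (P ++ Y) λ r → repeated x r x∈P) (lsum-cong Y fresh) ⟩
  0ℤ + lsum Y (λ _ → + (n !) * q (P ++ Y))
    ≡⟨ ℤₚ.+-identityˡ (lsum Y (λ _ → + (n !) * q (P ++ Y))) ⟩
  lsum Y (λ _ → + (n !) * q (P ++ Y))
    ≡⟨ lsum-const Y (+ (n !) * q (P ++ Y)) ⟩
  + List.length Y * (+ (n !) * q (P ++ Y))
    ≡⟨ cong (λ m → + m * (+ (n !) * q (P ++ Y))) len ⟩
  + suc n * (+ (n !) * q (P ++ Y))
    ≡⟨ sym (trans (cong (_* q (P ++ Y)) (ℤₚ.pos-* (suc n) (n !))) (ℤₚ.*-assoc (+ suc n) (+ (n !)) (q (P ++ Y)))) ⟩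
  + (suc n !) * q (P ++ Y) ∎
  where
  repeated : ∀ x r → x ∈ P → q (P ++ x ∷ r) ≡ 0ℤ
  repeated x r x∈P with ∈-∃++ x∈P
  ... | ys , zs , refl = trans (q-↭ (↭-trans (shift x (ys ++ x ∷ zs) r) (↭.prep x (++⁺ʳ r (shift x ys zs))))) (q-rep x ((ys ++ zs) ++ r))
  fresh : ∀ x → x ∈ Y → words n (P ++ Y) (λ r → q (P ++ x ∷ r)) ≡ + (n !) * q (P ++ Y)
  fresh x x∈Y with ∈-∃++ x∈Y
  ... | ys , zs , refl = begin
    words n (P ++ ys ++ x ∷ zs) (λ r → q (P ++ x ∷ r))
      ≡⟨ words-↭ n (λ r → q (P ++ x ∷ r)) reorder ⟩
    words n (x ∷ P ++ ys ++ zs) (λ r → q (P ++ x ∷ r))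
      ≡⟨ words-cong n (x ∷ P ++ ys ++ zs) (λ r → q-↭ (shift x P r)) ⟩
    words n (x ∷ P ++ ys ++ zs) (λ r → q (x ∷ P ++ r))
      ≡⟨ words-symmetric q q-↭ q-rep n (x ∷ P) (ys ++ zs) (ℕₚ.suc-injective (trans (sym (trans (Listₚ.length-++ ys) (trans (ℕₚ.+-suc (List.length ys) (List.length zs)) (cong suc (sym (Listₚ.length-++ ys)))))) len)) ⟩
    + (n !) * q (x ∷ P ++ ys ++ zs)
      ≡⟨ cong (+ (n !) *_) (q-↭ (↭-sym reorder)) ⟩
    + (n !) * q (P ++ ys ++ x ∷ zs) ∎
    where
    reorder : P ++ ys ++ x ∷ zs ↭ x ∷ P ++ ys ++ zs
    reorder = ↭-trans (++⁺ˡ P (shift x ys zs)) (shift x P (ys ++ zs))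

rowL : ℤ → List ℤ → ℤ
rowL x []      = 1ℤ
rowL x (y ∷ l) = ((x - y) * (x - y)) * rowL x l

vdmL : List ℤ → ℤ
vdmL []      = 1ℤ
vdmL (x ∷ l) = rowL x l * vdmL l

rowL-↭ : ∀ x {l k} → l ↭ k → rowL x l ≡ rowL x k
rowL-↭ x ↭.refl = refl
rowL-↭ x (↭.prep y p) = cong ((x - y) * (x - y) *_) (rowL-↭ x p)
rowL-↭ x {_ ∷ _ ∷ l} {_ ∷ _ ∷ k} (↭.swap y z p) = trans (cong (λ u → (x - y) * (x - y) * ((x - z) * (x - z) * u)) (rowL-↭ x p)) (lem ((x - y) * (x - y)) ((x - z) * (x - z)) (rowL x k))
  where
  lem : ∀ a b c → a * (b * c) ≡ b * (a * c)
  lem = solve-∀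
rowL-↭ x (↭.trans p q) = trans (rowL-↭ x p) (rowL-↭ x q)

vdmL-↭ : ∀ {l k} → l ↭ k → vdmL l ≡ vdmL k
vdmL-↭ ↭.refl = refl
vdmL-↭ (↭.prep x p) = cong₂ _*_ (rowL-↭ x p) (vdmL-↭ p)
vdmL-↭ {_ ∷ _ ∷ l} {_ ∷ _ ∷ k} (↭.swap x y p) = trans
  (cong₂ (λ u v → (x - y) * (x - y) * u * v) (rowL-↭ x p) (cong₂ _*_ (rowL-↭ y p) (vdmL-↭ p))) (lem x y (rowL x k) (rowL y k) (vdmL k))
  where
  lem : ∀ x y a b c → (x - y) * (x - y) * a * (b * c) ≡ (y - x) * (y - x) * b * (a * c)
  lem = solve-∀
vdmL-↭ (↭.trans p q) = trans (vdmL-↭ p) (vdmL-↭ q)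

vdmL-repeat : ∀ x l → vdmL (x ∷ x ∷ l) ≡ 0ℤ
vdmL-repeat x l = lem x (rowL x l) (vdmL (x ∷ l))
  where
  lem : ∀ x a b → (x - x) * (x - x) * a * b ≡ + 0
  lem = solve-∀

vdm2≡vdmL : ∀ {n} (v : Vec ℤ n) → vdm2 v ≡ vdmL (toList v)
vdm2≡vdmL []      = refl
vdm2≡vdmL (x ∷ v) = cong₂ _*_ (row v) (vdm2≡vdmL v)
  where
  row : ∀ {n} (v : Vec ℤ n) → vdmRow x v ≡ rowL x (toList v)
  row []      = refl
  row (y ∷ v) = cong ((x - y) * (x - y) *_) (row v)

WL : List ℤ → Series
WL []      = ι 1ℤ
WL (x ∷ l) = ŵ x · WL l

W≡WL : ∀ {n} (v : Vec ℤ n) → W v ≡ WL (toList v)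
W≡WL []      = refl
W≡WL (x ∷ v) = cong (ŵ x ·_) (W≡WL v)

WL-↭ : ∀ {l k} → l ↭ k → WL l ≈ WL k
WL-↭ ↭.refl = ≈-refl
WL-↭ (↭.prep x p) = ŵ x ⟨·⟩ WL-↭ p
WL-↭ {_ ∷ _ ∷ l} {_ ∷ _ ∷ k} (↭.swap x y p) = ≈-trans (ŵ x ⟨·⟩ (ŵ y ⟨·⟩ WL-↭ p)) (solveˢ 3 (λ a b c → a :* (b :* c) := b :* (a :* c)) ≈-refl (ŵ x) (ŵ y) (WL k))
WL-↭ (↭.trans p q) = ≈-trans (WL-↭ p) (WL-↭ q)

punctured : ℕ → List ℤ
punctured zero    = []
punctured (suc s) = + suc s ∷ -[1+ s ] ∷ punctured s

length-punctured : ∀ s → List.length (punctured s) ≡ s ℕ.+ s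
length-punctured zero    = refl
length-punctured (suc s) = trans (cong (suc ∘ suc) (length-punctured s)) (cong suc (sym (ℕₚ.+-suc s s)))

SZ-list : ∀ s f → SZ s f ≡ lsum (0ℤ ∷ punctured s) f
SZ-list s f = f 0ℤ ⟨+⟩ go s
  where
  go : ∀ s → Σ s (λ k → f (+ suc k) + f -[1+ k ]) ≡ lsum (punctured s) f
  go zero    = refl
  go (suc s) = trans (Σ-last s (λ k → f (+ suc k) + f -[1+ k ])) (trans (cong (_+ (f (+ suc s) + f -[1+ s ])) (go s))
    (lem (lsum (punctured s) f) (f (+ suc s)) (f -[1+ s ])))
    where
    lem : ∀ a b c → a + (b + c) ≡ b + (c + a)
    lem = solve-∀

bs-words : ∀ n s (F : List ℤ → ℤ) → bs n s (λ v → F (toList v)) ≡ words n (0ℤ ∷ punctured s) F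
bs-words zero    s F = refl
bs-words (suc n) s F = trans (SZ-cong s λ x → bs-words n s (λ r → F (x ∷ r))) (SZ-list s (λ x → words n (0ℤ ∷ punctured s) (λ r → F (x ∷ r))))

rowL-neg : ∀ a s → rowL (- a) (0ℤ ∷ punctured s) ≡ rowL a (0ℤ ∷ punctured s)
rowL-neg a s = cong₂ _*_ (lem₀ a) (go s)
  where
  lem₀ : ∀ a → (- a - + 0) * (- a - + 0) ≡ (a - + 0) * (a - + 0)
  lem₀ = solve-∀
  lem : ∀ a b r → (- a - b) * (- a - b) * ((- a - - b) * (- a - - b) * r) ≡ (a - b) * (a - b) * ((a - - b) * (a - - b) * r)
  lem = solve-∀
  go : ∀ s → rowL (- a) (punctured s) ≡ rowL a (punctured s)
  go zero    = refl
  go (suc s) = trans (cong (λ r → (- a - + suc s) * (- a - + suc s) * ((- a - -[1+ s ]) * (- a - -[1+ s ]) * r)) (go s)) (lem a (+ suc s) (rowL a (punctured s)))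

square : ℤ → ℤ
square x = x * x

-- For a = s + 1 + d the product of a - x over -s ≤ x ≤ s is (2s + 1 + d)! / d!. Only d = 0 is used
-- later, but enlarging s with a fixed lowers d.
rowL-factorial : ∀ s d → rowL (+ (suc s ℕ.+ d)) (0ℤ ∷ punctured s) * square (+ (d !)) ≡ square (+ ((suc (s ℕ.+ s) ℕ.+ d) !))
rowL-factorial zero d = trans (lem (+ suc d) (+ (d !))) (cong square (sym (ℤₚ.pos-* (suc d) (d !))))
  where
  lem : ∀ a f → (a - + 0) * (a - + 0) * + 1 * (f * f) ≡ (a * f) * (a * f)
  lem = solve-∀
rowL-factorial (suc s) d = begin
  (a - + 0) * (a - + 0) * ((a - + suc s) * (a - + suc s) * ((a - -[1+ s ]) * (a - -[1+ s ]) * R)) * square (+ (d !))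
    ≡⟨ cong₂ (λ u v → (a - + 0) * (a - + 0) * (u * u * (v * v * R)) * square (+ (d !))) (minus (+ s) (+ d)) (plus (+ s) (+ d)) ⟩
  (a - + 0) * (a - + 0) * (+ suc d * + suc d * (b * b * R)) * square (+ (d !))
    ≡⟨ regroup ((a - + 0) * (a - + 0)) (+ suc d) b R (+ (d !)) ⟩
  b * b * ((a - + 0) * (a - + 0) * R * (+ suc d * + (d !) * (+ suc d * + (d !))))
    ≡⟨ cong (b * b *_) (trans (cong₂ (λ u v → rowL u (0ℤ ∷ punctured s) * (v * v)) (cong +_ (sym (ℕₚ.+-suc (suc s) d))) (sym (ℤₚ.pos-* (suc d) (d !)))) (rowL-factorial s (suc d))) ⟩
  b * b * square (+ ((suc (s ℕ.+ s) ℕ.+ suc d) !))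
    ≡⟨ combine b (+ ((suc (s ℕ.+ s) ℕ.+ suc d) !)) ⟩
  square (b * + ((suc (s ℕ.+ s) ℕ.+ suc d) !))
    ≡⟨ cong square (trans (cong (_* + ((suc (s ℕ.+ s) ℕ.+ suc d) !)) b≡) (sym (ℤₚ.pos-* (suc (suc (s ℕ.+ s) ℕ.+ suc d)) ((suc (s ℕ.+ s) ℕ.+ suc d) !)))) ⟩
  square (+ (suc (suc (s ℕ.+ s) ℕ.+ suc d) !))
    ≡⟨ cong (λ m → square (+ (m !))) (index s d) ⟩
  square (+ ((suc (suc s ℕ.+ suc s) ℕ.+ d) !)) ∎
  where
  a = + (suc (suc s) ℕ.+ d)
  b = + 3 + (+ s + + s + + d)
  R = rowL a (punctured s)
  minus : ∀ s d → (+ 1 + (+ 1 + s) + d) - (+ 1 + s) ≡ + 1 + d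
  minus = solve-∀
  plus : ∀ s d → (+ 1 + (+ 1 + s) + d) - - (+ 1 + s) ≡ + 3 + (s + s + d)
  plus = solve-∀
  regroup : ∀ p e b R f → p * (e * e * (b * b * R)) * (f * f) ≡ b * b * (p * R * (e * f * (e * f)))
  regroup = solve-∀
  combine : ∀ b f → b * b * (f * f) ≡ b * f * (b * f)
  combine = solve-∀
  b≡ : b ≡ + suc (suc (s ℕ.+ s) ℕ.+ suc d)
  b≡ = cong +_ (lem s d)
    where
    lem : ∀ s d → 3 ℕ.+ (s ℕ.+ s ℕ.+ d) ≡ suc (suc (s ℕ.+ s) ℕ.+ suc d)
    lem = ℕS.solve-∀
  index : ∀ s d → suc (suc (s ℕ.+ s) ℕ.+ suc d) ≡ suc (suc s ℕ.+ suc s) ℕ.+ d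
  index = ℕS.solve-∀

prodFact-suc : ∀ n → prodFact (suc (suc n)) ≡ prodFact (suc n) ℕ.* (suc n !)
prodFact-suc n = go n id
  where
  go : ∀ n (h : ℕ → ℕ) → List.foldr ℕ._*_ 1 (map (λ i → suc i !) (applyUpTo h (suc n))) ≡ List.foldr ℕ._*_ 1 (map (λ i → suc i !) (applyUpTo h n)) ℕ.* (suc (h n) !)
  go zero    h = ℕₚ.*-comm (suc (h 0) !) 1
  go (suc n) h = trans (cong ((suc (h 0) !) ℕ.*_) (go n (h ∘ suc))) (sym (ℕₚ.*-assoc (suc (h 0) !) (List.foldr ℕ._*_ 1 (map (λ i → suc i !) (applyUpTo (h ∘ suc) n))) (suc (h (suc n)) !)))

-- Adding ±a with a = s + 1 brings two rows of value ((2s + 1)!)² and the square of the difference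
-- 2a. As 2a (2s + 1)! = (2s + 2)!, these are the squares of the two new factorials.
vdmL-symmetric : ∀ s → vdmL (0ℤ ∷ punctured s) ≡ square (+ prodFact (suc (s ℕ.+ s)))
vdmL-symmetric zero    = refl
vdmL-symmetric (suc s) = begin
  vdmL (0ℤ ∷ a ∷ - a ∷ punctured s)
    ≡⟨ vdmL-↭ (shifts (0ℤ ∷ []) (a ∷ - a ∷ []) {punctured s}) ⟩
  (a - - a) * (a - - a) * rowL a X₀ * (rowL (- a) X₀ * vdmL X₀)
    ≡⟨ cong₂ (λ u v → (a - - a) * (a - - a) * u * v) row (cong₂ _*_ (trans (rowL-neg a s) row) (vdmL-symmetric s)) ⟩
  (a - - a) * (a - - a) * square f * (square f * square P)
    ≡⟨ lem a f P ⟩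
  square (P * f * ((a + a) * f))
    ≡⟨ cong square (trans (cong₂ _*_ (trans (sym (ℤₚ.pos-* p (suc (s ℕ.+ s) !))) (cong +_ (sym (prodFact-suc (s ℕ.+ s)))))
         (trans (sym (ℤₚ.pos-* (suc s ℕ.+ suc s) (suc (s ℕ.+ s) !))) (cong +_ last-factor)))
         (trans (sym (ℤₚ.pos-* (prodFact (suc (suc (s ℕ.+ s)))) (suc (suc (s ℕ.+ s)) !))) (cong +_ (sym (prodFact-suc (suc (s ℕ.+ s))))))) ⟩
  square (+ prodFact (suc (suc (suc (s ℕ.+ s)))))
    ≡⟨ cong (λ m → square (+ prodFact (suc (suc m)))) (sym (ℕₚ.+-suc s s)) ⟩
  square (+ prodFact (suc (suc s ℕ.+ suc s))) ∎
  where
  a = + suc s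
  X₀ = 0ℤ ∷ punctured s
  p = prodFact (suc (s ℕ.+ s))
  P = + p
  f = + (suc (s ℕ.+ s) !)
  row : rowL a X₀ ≡ square f
  row = trans (sym (ℤₚ.*-identityʳ (rowL a X₀))) (trans (cong (λ m → rowL (+ m) X₀ * 1ℤ) (sym (ℕₚ.+-identityʳ (suc s))))
    (trans (rowL-factorial s 0) (cong (λ m → square (+ (m !))) (ℕₚ.+-identityʳ (suc (s ℕ.+ s))))))
  last-factor : (suc s ℕ.+ suc s) ℕ.* (suc (s ℕ.+ s) !) ≡ suc (suc (s ℕ.+ s)) !
  last-factor = cong (ℕ._* (suc (s ℕ.+ s) !)) (cong suc (ℕₚ.+-suc s s))
  lem : ∀ a f P → (a - - a) * (a - - a) * (f * f) * ((f * f) * (P * P)) ≡ (P * f * ((a + a) * f)) * (P * f * ((a + a) * f))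
  lem = solve-∀

-- The pair ±a contributes -q^(2a) / (1 - q^(2a))², and the exponents 2a for a ≤ s add up to s (s +
-- 1).
WL-symmetric : ∀ s → Σ[ u ∈ Series ] WL (punctured s) ≈ X (s ℕ.* suc s) · u × u 0 ≡ sgn s
WL-symmetric zero    = ι 1ℤ , ≈-sym (≈-trans (·-cong X-0 (≈-refl {ι 1ℤ})) (·-identityˡ (ι 1ℤ))) , refl
WL-symmetric (suc s) with WL-symmetric s
... | u , e , u0 = ⊟ (g · (g · u)) ,
  ≈-trans (w a ⟨·⟩ (⊟ w a ⟨·⟩ e)) (≈-trans (solveˢ 4 (λ x g y u → (x :* g) :* ((:- (x :* g)) :* (y :* u)) := (x :* (x :* y)) :* (:- (g :* (g :* u)))) ≈-refl (X a) g (X (s ℕ.* suc s)) u)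
    (·-cong (≈-trans (X a ⟨·⟩ X-+ a (s ℕ.* suc s)) (≈-trans (X-+ a (a ℕ.+ s ℕ.* suc s)) (≡⇒≈ (cong X (lem s))))) (≈-refl {⊟ (g · (g · u))}))) ,
  trans (cong (λ z → - (1ℤ * z + 0ℤ)) (trans (ℤₚ.+-identityʳ (1ℤ * u 0)) (trans (ℤₚ.*-identityˡ (u 0)) u0)))
    (cong -_ (trans (ℤₚ.+-identityʳ (1ℤ * sgn s)) (ℤₚ.*-identityˡ (sgn s))))
  where
  a = suc s
  g = geo (a ℕ.+ a)
  lem : ∀ s → suc s ℕ.+ (suc s ℕ.+ s ℕ.* suc s) ≡ suc s ℕ.* suc (suc s)
  lem = ℕS.solve-∀

nsum : (ℤ → ℕ) → List ℤ → ℕ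
nsum h []      = 0
nsum h (x ∷ l) = h x ℕ.+ nsum h l

nsum-++ : ∀ h l k → nsum h (l ++ k) ≡ nsum h l ℕ.+ nsum h k
nsum-++ h []      k = refl
nsum-++ h (x ∷ l) k = trans (cong (h x ℕ.+_) (nsum-++ h l k)) (sym (ℕₚ.+-assoc (h x) (nsum h l) (nsum h k)))

-- Each entry of positive weight can be struck out of Y; as l has no repetitions, the later entries
-- are still found in what remains.
unique-nsum : ∀ (h : ℤ → ℕ) l Y → Unique l → (∀ x → x ∈ l → 0 < h x → x ∈ Y) → nsum h l ≤ nsum h Y
unique-nsum h []      Y _ _ = z≤n
unique-nsum h (x ∷ l) Y (x∉l AllPairs.∷ u) inY with h x in eq
... | zero  = unique-nsum h l Y u (λ y y∈l → inY y (there y∈l))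
... | suc k with ∈-∃++ (inY x (here refl) (subst (0 <_) (sym eq) (s≤s z≤n)))
...   | ys , zs , refl = ℕₚ.≤-trans (ℕₚ.+-monoʳ-≤ (suc k) (unique-nsum h l (ys ++ zs) u inRest)) (ℕₚ.≤-reflexive total)
  where
  inRest : ∀ y → y ∈ l → 0 < h y → y ∈ ys ++ zs
  inRest y y∈l 0<hy with ∈-++⁻ ys (inY y (there y∈l) 0<hy)
  ... | inj₁ y∈ys         = ∈-++⁺ˡ y∈ys
  ... | inj₂ (here refl)  = ⊥-elim (ListAll.lookup x∉l y∈l refl)
  ... | inj₂ (there y∈zs) = ∈-++⁺ʳ ys y∈zs
  total : suc k ℕ.+ nsum h (ys ++ zs) ≡ nsum h (ys ++ x ∷ zs)
  total = begin
    suc k ℕ.+ nsum h (ys ++ zs)                  ≡⟨ cong₂ ℕ._+_ (sym eq) (nsum-++ h ys zs) ⟩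
    h x ℕ.+ (nsum h ys ℕ.+ nsum h zs)            ≡⟨ lem (h x) (nsum h ys) (nsum h zs) ⟩
    nsum h ys ℕ.+ (h x ℕ.+ nsum h zs)            ≡⟨ sym (nsum-++ h ys (x ∷ zs)) ⟩
    nsum h (ys ++ x ∷ zs)                        ∎
    where
    lem : ∀ a b c → a ℕ.+ (b ℕ.+ c) ≡ b ℕ.+ (a ℕ.+ c)
    lem = ℕS.solve-∀

unique-or-zero : ∀ l → Unique l ⊎ vdmL l ≡ 0ℤ
unique-or-zero []      = inj₁ AllPairs.[]
unique-or-zero (x ∷ l) with unique-or-zero l | row l
  where
  row : ∀ l → ListAll.All (x ≢_) l ⊎ rowL x l ≡ 0ℤ
  row []      = inj₁ ListAll.[]
  row (y ∷ l) with x ℤ.≟ y | row l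
  ... | yes refl | _      = inj₂ (lem x (rowL x l))
    where
    lem : ∀ x r → (x - x) * (x - x) * r ≡ + 0
    lem = solve-∀
  ... | no x≢y | inj₁ all = inj₁ (x≢y ListAll.∷ all)
  ... | no x≢y | inj₂ z   = inj₂ (trans (cong ((x - y) * (x - y) *_) z) (ℤₚ.*-zeroʳ ((x - y) * (x - y))))
... | inj₁ u | inj₁ all = inj₁ (all AllPairs.∷ u)
... | _      | inj₂ z   = inj₂ (cong (_* vdmL l) z)
... | inj₂ z | _        = inj₂ (trans (cong (rowL x l *_) z) (ℤₚ.*-zeroʳ (rowL x l)))

absL : ℤ → ℕ
absL x = ∣ x ∣ ℕ.+ ∣ x ∣

-- n distinct nonzero integers with n = 2s satisfy Σ |rᵢ| ≥ s (s + 1): the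
-- weights (2s + 1) - 2|x| are positive exactly on the interval [-s, s].
module Counting (s : ℕ) where
  m = suc (s ℕ.+ s)

  height : ℤ → ℕ
  height x = m ∸ absL x

  interval : List ℤ
  interval = 0ℤ ∷ punctured s

  in-punctured⁺ : ∀ {k s} → k < s → + suc k ∈ punctured s
  in-punctured⁺ {k} {suc s} k<s with k ℕ.≟ s
  ... | yes refl = here refl
  ... | no k≢s   = there (there (in-punctured⁺ (ℕₚ.≤∧≢⇒< (ℕₚ.≤-pred k<s) k≢s)))

  in-punctured⁻ : ∀ {k s} → k < s → -[1+ k ] ∈ punctured s
  in-punctured⁻ {k} {suc s} k<s with k ℕ.≟ s
  ... | yes refl = there (here refl)
  ... | no k≢s   = there (there (in-punctured⁻ (ℕₚ.≤∧≢⇒< (ℕₚ.≤-pred k<s) k≢s)))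

  in-interval : ∀ x → ∣ x ∣ ≤ s → x ∈ interval
  in-interval (+ zero)  _  = here refl
  in-interval (+ suc k) le = there (in-punctured⁺ le)
  in-interval -[1+ k ]  le = there (in-punctured⁻ le)

  far-height : ∀ x → s < ∣ x ∣ → suc m ≤ absL x
  far-height x s<x = ℕₚ.≤-trans (ℕₚ.≤-reflexive (cong suc (sym (ℕₚ.+-suc s s)))) (ℕₚ.+-mono-≤ s<x s<x)

  positive-in-interval : ∀ x → 0 < height x → x ∈ interval
  positive-in-interval x 0<h with s ℕ.<? ∣ x ∣
  ... | no s≮x  = in-interval x (ℕₚ.≮⇒≥ s≮x)
  ... | yes s<x = ⊥-elim (ℕₚ.<-irrefl refl (subst (0 <_) (ℕₚ.m≤n⇒m∸n≡0 (ℕₚ.≤-trans (ℕₚ.n≤1+n m) (far-height x s<x))) 0<h))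

  height+abs≥ : ∀ x → m ≤ height x ℕ.+ absL x
  height+abs≥ x = ℕₚ.≤-trans (ℕₚ.m≤n+m∸n m (absL x)) (ℕₚ.≤-reflexive (ℕₚ.+-comm (absL x) (height x)))

  total≥ : ∀ l → List.length l ℕ.* m ≤ nsum height l ℕ.+ nsum absL l
  total≥ []      = z≤n
  total≥ (x ∷ l) = ℕₚ.≤-trans (ℕₚ.+-mono-≤ (height+abs≥ x) (total≥ l)) (ℕₚ.≤-reflexive (lem (height x) (absL x) (nsum height l) (nsum absL l)))
    where
    lem : ∀ a b c d → (a ℕ.+ b) ℕ.+ (c ℕ.+ d) ≡ (a ℕ.+ c) ℕ.+ (b ℕ.+ d)
    lem = ℕS.solve-∀

  -- An entry outside [-s, s] has 2|x| ≥ m + 1, one more than the inequality for that entry asks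
  -- for.
  total> : ∀ {n} (v : Vec ℤ n) → ¬ All (λ x → ∣ x ∣ ≤ s) v → suc (List.length (toList v) ℕ.* m) ≤ nsum height (toList v) ℕ.+ nsum absL (toList v)
  total> []      ¬all = ⊥-elim (¬all [])
  total> (x ∷ v) ¬all with s ℕ.<? ∣ x ∣
  ... | yes s<x = ℕₚ.≤-trans (ℕₚ.+-mono-≤ (ℕₚ.≤-trans (far-height x s<x) (ℕₚ.m≤n+m (absL x) (height x))) (total≥ (toList v)))
         (ℕₚ.≤-reflexive (lem (height x) (absL x) (nsum height (toList v)) (nsum absL (toList v))))
    where
    lem : ∀ a b c d → (a ℕ.+ b) ℕ.+ (c ℕ.+ d) ≡ (a ℕ.+ c) ℕ.+ (b ℕ.+ d)
    lem = ℕS.solve-∀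
  ... | no s≮x = ℕₚ.≤-trans (ℕₚ.≤-trans (ℕₚ.≤-reflexive (sym (ℕₚ.+-suc m _))) (ℕₚ.+-mono-≤ (height+abs≥ x) (total> v λ all → ¬all (ℕₚ.≮⇒≥ s≮x ∷ all))))
         (ℕₚ.≤-reflexive (lem (height x) (absL x) (nsum height (toList v)) (nsum absL (toList v))))
    where
    lem : ∀ a b c d → (a ℕ.+ b) ℕ.+ (c ℕ.+ d) ≡ (a ℕ.+ c) ℕ.+ (b ℕ.+ d)
    lem = ℕS.solve-∀

  height+abs : ∀ k → k ≤ s → (m ∸ (k ℕ.+ k)) ℕ.+ (k ℕ.+ k) ≡ m
  height+abs k k≤s = ℕₚ.m∸n+n≡m (ℕₚ.≤-trans (ℕₚ.+-mono-≤ k≤s k≤s) (ℕₚ.n≤1+n (s ℕ.+ s)))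

  total-punctured : ∀ k → k ≤ s → nsum height (punctured k) ℕ.+ nsum absL (punctured k) ≡ (k ℕ.+ k) ℕ.* m
  total-punctured zero    _   = refl
  total-punctured (suc k) k<s = begin
    h ℕ.+ (h ℕ.+ H) ℕ.+ (a ℕ.+ (a ℕ.+ M))     ≡⟨ lem₁ h a H M ⟩
    (h ℕ.+ a) ℕ.+ ((h ℕ.+ a) ℕ.+ (H ℕ.+ M))   ≡⟨ cong₂ (λ u v → u ℕ.+ (u ℕ.+ v)) (height+abs (suc k) k<s) (total-punctured k (ℕₚ.≤-trans (ℕₚ.n≤1+n k) k<s)) ⟩
    m ℕ.+ (m ℕ.+ (k ℕ.+ k) ℕ.* m)             ≡⟨ lem₂ m k ⟩
    (suc k ℕ.+ suc k) ℕ.* m                   ∎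
    where
    a = suc k ℕ.+ suc k
    h = m ∸ a
    H = nsum height (punctured k)
    M = nsum absL (punctured k)
    lem₁ : ∀ h a H M → h ℕ.+ (h ℕ.+ H) ℕ.+ (a ℕ.+ (a ℕ.+ M)) ≡ (h ℕ.+ a) ℕ.+ ((h ℕ.+ a) ℕ.+ (H ℕ.+ M))
    lem₁ = ℕS.solve-∀
    lem₂ : ∀ m k → m ℕ.+ (m ℕ.+ (k ℕ.+ k) ℕ.* m) ≡ (suc k ℕ.+ suc k) ℕ.* m
    lem₂ = ℕS.solve-∀

  abs-punctured : ∀ k → nsum absL (punctured k) ≡ k ℕ.* suc k ℕ.+ k ℕ.* suc k
  abs-punctured zero    = refl
  abs-punctured (suc k) = trans (cong (λ M → (suc k ℕ.+ suc k) ℕ.+ ((suc k ℕ.+ suc k) ℕ.+ M)) (abs-punctured k)) (lem k)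
    where
    lem : ∀ k → (suc k ℕ.+ suc k) ℕ.+ ((suc k ℕ.+ suc k) ℕ.+ (k ℕ.* suc k ℕ.+ k ℕ.* suc k)) ≡ suc k ℕ.* suc (suc k) ℕ.+ suc k ℕ.* suc (suc k)
    lem = ℕS.solve-∀

  total-interval : nsum height interval ℕ.+ (s ℕ.* suc s ℕ.+ s ℕ.* suc s) ≡ m ℕ.* m
  total-interval = trans (cong (λ M → m ℕ.+ nsum height (punctured s) ℕ.+ M) (sym (abs-punctured s)))
    (trans (ℕₚ.+-assoc m (nsum height (punctured s)) (nsum absL (punctured s))) (cong (m ℕ.+_) (total-punctured s ℕₚ.≤-refl)))

  absL-absSum : ∀ {n} (v : Vec ℤ n) → nsum absL (toList v) ≡ absSum v ℕ.+ absSum v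
  absL-absSum []      = refl
  absL-absSum (x ∷ v) = trans (cong (absL x ℕ.+_) (absL-absSum v)) (lem ∣ x ∣ (absSum v))
    where
    lem : ∀ a b → (a ℕ.+ a) ℕ.+ (b ℕ.+ b) ≡ (a ℕ.+ b) ℕ.+ (a ℕ.+ b)
    lem = ℕS.solve-∀

  half : ∀ a b → a ℕ.+ a ≤ b ℕ.+ b → a ≤ b
  half a b le with a ℕ.≤? b
  ... | yes a≤b = a≤b
  ... | no a≰b  = ⊥-elim (ℕₚ.<⇒≱ (ℕₚ.+-mono-< (ℕₚ.≰⇒> a≰b) (ℕₚ.≰⇒> a≰b)) le)

  module _ (v : Vec ℤ (s ℕ.+ s)) (u : Unique (0ℤ ∷ toList v)) where
    bound : nsum height (0ℤ ∷ toList v) ≤ nsum height interval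
    bound = unique-nsum height (0ℤ ∷ toList v) interval u λ x _ → positive-in-interval x

    private
      2j = s ℕ.* suc s ℕ.+ s ℕ.* suc s

      -- e is the slack: 0 for the bound itself, 1 for strictness. The heights of distinct entries
      -- are at most those of [-s, s], where heights and twice the absolute values add up to exactly
      -- m².
      compare : ∀ e → e ℕ.+ m ℕ.* m ≤ nsum height (0ℤ ∷ toList v) ℕ.+ nsum absL (toList v) → e ℕ.+ 2j ≤ absSum v ℕ.+ absSum v
      compare e le = ℕₚ.+-cancelˡ-≤ (nsum height interval) (e ℕ.+ 2j) (absSum v ℕ.+ absSum v)
        (ℕₚ.≤-trans (ℕₚ.≤-reflexive (trans (lem (nsum height interval) e 2j) (cong (e ℕ.+_) total-interval)))
          (ℕₚ.≤-trans le (ℕₚ.+-mono-≤ bound (ℕₚ.≤-reflexive (absL-absSum v)))))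
        where
        lem : ∀ a e b → a ℕ.+ (e ℕ.+ b) ≡ e ℕ.+ (a ℕ.+ b)
        lem = ℕS.solve-∀

      m*m≤ : ∀ e l → e ℕ.+ List.length (toList v) ℕ.* m ≤ nsum height (toList v) ℕ.+ l → e ℕ.+ m ℕ.* m ≤ nsum height (0ℤ ∷ toList v) ℕ.+ l
      m*m≤ e l le = ℕₚ.≤-trans (ℕₚ.≤-reflexive (trans (cong (λ k → e ℕ.+ (m ℕ.+ k ℕ.* m)) (sym (Vecₚ.length-toList v))) (lem₁ e m (List.length (toList v) ℕ.* m))))
        (ℕₚ.≤-trans (ℕₚ.+-monoʳ-≤ m le) (ℕₚ.≤-reflexive (sym (ℕₚ.+-assoc m (nsum height (toList v)) l))))
        where
        lem₁ : ∀ e m x → e ℕ.+ (m ℕ.+ x) ≡ m ℕ.+ (e ℕ.+ x)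
        lem₁ = ℕS.solve-∀

    absSum≥ : s ℕ.* suc s ≤ absSum v
    absSum≥ = half (s ℕ.* suc s) (absSum v) (compare 0 (m*m≤ 0 (nsum absL (toList v)) (total≥ (toList v))))

    absSum> : ¬ All (λ x → ∣ x ∣ ≤ s) v → s ℕ.* suc s < absSum v
    absSum> ¬all with s ℕ.* suc s ℕ.<? absSum v
    ... | yes lt = lt
    ... | no ≮   = ⊥-elim (ℕₚ.<⇒≱ (compare 1 (m*m≤ 1 (nsum absL (toList v)) (total> v ¬all))) (ℕₚ.+-mono-≤ (ℕₚ.≮⇒≥ ≮) (ℕₚ.≮⇒≥ ≮)))

module Leading (s : ℕ) where
  open Counting s
  private
    n = s ℕ.+ s
    j = s ℕ.* suc s
    p : Vec ℤ n → ℤ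
    p v = vdm2 (0ℤ ∷ v)

  Ord-vandermondeSum : Ord j (vandermondeSum n)
  Ord-vandermondeSum N N<j = bs-zero n N term
    where
    term : ∀ v → p v * W v N ≡ 0ℤ
    term v with unique-or-zero (0ℤ ∷ toList v)
    ... | inj₁ u = trans (cong (p v *_) (Ord-W v N (ℕₚ.<-≤-trans N<j (absSum≥ v u)))) (ℤₚ.*-zeroʳ (p v))
    ... | inj₂ z = cong (_* W v N) (trans (vdm2≡vdmL (0ℤ ∷ v)) z)

  -- In degree j = s (s + 1) the strict bound excludes every vector with an entry outside [-s, s].
  leading-supported : Supported s (λ v → p v * W v j)
  leading-supported v ¬all with unique-or-zero (0ℤ ∷ toList v)
  ... | inj₁ u = trans (cong (p v *_) (Ord-W v j (absSum> v u ¬all))) (ℤₚ.*-zeroʳ (p v))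
  ... | inj₂ z = cong (_* W v j) (trans (vdm2≡vdmL (0ℤ ∷ v)) z)

  q : List ℤ → ℤ
  q l = vdmL l * WL l j

  -- The vectors are words in the letters -s, ..., s with 0 already used up, so just the (2s)!
  -- orderings of the other letters survive, all with the same value.
  leading-coefficient : vandermondeSum n j ≡ + (n !) * (square (+ prodFact (suc n)) * sgn s)
  leading-coefficient = begin
    bs n j (λ v → p v * W v j)
      ≡⟨ bs-extend n (λ v → p v * W v j) (ℕₚ.m≤m*n s (suc s)) leading-supported ⟩
    bs n s (λ v → p v * W v j)
      ≡⟨ bs-cong n s (λ v → cong₂ _*_ (vdm2≡vdmL (0ℤ ∷ v)) (trans (cong (λ f → f j) (W≡WL v)) (sym (at (·-identityˡ (WL (toList v))) j)))) ⟩
    bs n s (λ v → q (0ℤ ∷ toList v))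
      ≡⟨ bs-words n s (λ r → q (0ℤ ∷ r)) ⟩
    words n interval (λ r → q (0ℤ ∷ r))
      ≡⟨ words-symmetric q (λ {l} {k} e → cong₂ _*_ (vdmL-↭ e) (at (WL-↭ e) j)) (λ x l → cong (_* WL (x ∷ x ∷ l) j) (vdmL-repeat x l)) n (0ℤ ∷ []) (punctured s) (length-punctured s) ⟩
    + (n !) * q interval
      ≡⟨ cong (+ (n !) *_) (cong₂ _*_ (vdmL-symmetric s) lead) ⟩
    + (n !) * (square (+ prodFact (suc n)) * sgn s) ∎
    where
    lead : WL interval j ≡ sgn s
    lead with WL-symmetric s
    ... | u , e , u0 = trans (at (≈-trans (·-identityˡ (WL (punctured s))) e) j) (trans (cong (X j · u) (sym (ℕₚ.+-identityʳ j))) (trans (X-·-at j u 0) u0))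

  vandermondeSum-value : vandermondeSum n ≈ (+ (n !) * (square (+ prodFact (suc n)) * sgn s)) • (X j · pow △ (j ℕ.* 8))
  vandermondeSum-value = ≈-trans (form-△ j (form-vandermondeSum s) Ord-vandermondeSum) (pw λ N → cong (_* (X j · pow △ (j ℕ.* 8)) N) leading-coefficient)

-- The truncated triple sum

sumℤ-++ : ∀ l k → sumℤ (l ++ k) ≡ sumℤ l + sumℤ k
sumℤ-++ []      k = sym (ℤₚ.+-identityˡ (sumℤ k))
sumℤ-++ (x ∷ l) k = trans (x ⟨+⟩ sumℤ-++ l k) (sym (ℤₚ.+-assoc x (sumℤ l) (sumℤ k)))

sumℤ-concatMap : ∀ {I J : Set} (f : J → ℤ) (g : I → List J) l → sumℤ (map f (List.concatMap g l)) ≡ sumℤ (map (λ i → sumℤ (map f (g i))) l)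
sumℤ-concatMap f g []      = refl
sumℤ-concatMap f g (i ∷ l) = trans (cong sumℤ (Listₚ.map-++ f (g i) (List.concatMap g l)))
  (trans (sumℤ-++ (map f (g i)) (map f (List.concatMap g l))) (sumℤ (map f (g i)) ⟨+⟩ sumℤ-concatMap f g l))

sumℤ-map-map : ∀ {I J : Set} (f : J → ℤ) (g : I → J) l → sumℤ (map f (map g l)) ≡ sumℤ (map (λ i → f (g i)) l)
sumℤ-map-map f g l = cong sumℤ (sym (Listₚ.map-∘ l))

minus-suc : ∀ {i b} → i ≤ b → + i - + suc b ≡ -[1+ (b ∸ i) ]
minus-suc {i} {b} i≤b = trans (cong (λ m → + i - (+ 1 + + m)) (sym (ℕₚ.m+[n∸m]≡n i≤b))) (lem (+ i) (+ (b ∸ i)))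
  where
  lem : ∀ i d → i - (+ 1 + (i + d)) ≡ - (+ 1 + d)
  lem = solve-∀

range-SZ : ∀ B (f : ℤ → ℤ) → sumℤ (map f (range B)) ≡ SZ B f
range-SZ B f = begin
  sumℤ (map f (map (λ i → + i - + B) (upTo (suc (2 ℕ.* B)))))
    ≡⟨ trans (sumℤ-map-map f (λ i → + i - + B) (upTo (suc (2 ℕ.* B)))) (sumℤ-upTo (suc (2 ℕ.* B)) (λ i → f (+ i - + B))) ⟩
  Σ (suc (2 ℕ.* B)) (λ i → f (+ i - + B))
    ≡⟨ cong (λ m → Σ m (λ i → f (+ i - + B))) (lem₁ B) ⟩
  Σ (B ℕ.+ suc B) (λ i → f (+ i - + B))
    ≡⟨ Σ-split B (suc B) (λ i → f (+ i - + B)) ⟩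
  Σ B (λ i → f (+ i - + B)) + Σ (suc B) (λ i → f (+ (B ℕ.+ i) - + B))
    ≡⟨ cong₂ _+_ (negatives B) (Σ-cong (suc B) λ i → cong f ([m+n]-m (+ B) (+ i))) ⟩
  Σ B (λ k → f -[1+ k ]) + (f 0ℤ + Σ B (λ k → f (+ suc k)))
    ≡⟨ lem₂ (Σ B (λ k → f -[1+ k ])) (f 0ℤ) (Σ B (λ k → f (+ suc k))) ⟩
  f 0ℤ + (Σ B (λ k → f (+ suc k)) + Σ B (λ k → f -[1+ k ]))
    ≡⟨ f 0ℤ ⟨+⟩ sym (Σ-+ B (λ k → f (+ suc k)) (λ k → f -[1+ k ])) ⟩
  SZ B f ∎
  where
  lem₁ : ∀ B → suc (2 ℕ.* B) ≡ B ℕ.+ suc B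
  lem₁ = ℕS.solve-∀
  lem₂ : ∀ a b c → a + (b + c) ≡ b + (c + a)
  lem₂ = solve-∀
  negatives : ∀ B → Σ B (λ i → f (+ i - + B)) ≡ Σ B (λ k → f -[1+ k ])
  negatives zero    = refl
  negatives (suc b) = trans (Σ-cong< (suc b) λ i i≤b → cong f (minus-suc (ℕₚ.≤-pred i≤b))) (Σ-reverse b (λ k → f -[1+ k ]))

box-bs : ∀ n B (f : Vec ℤ n → ℤ) → sumℤ (map f (box n B)) ≡ bs n B f
box-bs zero    B f = ℤₚ.+-identityʳ (f [])
box-bs (suc n) B f = trans (sumℤ-concatMap f (λ x → map (x ∷_) (box n B)) (range B))
  (trans (range-SZ B (λ x → sumℤ (map f (map (x ∷_) (box n B)))))
    (SZ-cong B λ x → trans (sumℤ-map-map f (x ∷_) (box n B)) (box-bs n B (λ v → f (x ∷ v)))))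

sumJ : ∀ m → (Vec Bool m → ℤ) → ℤ
sumJ zero    F = F []
sumJ (suc m) F = sumJ m (λ J → F (true ∷ J)) + sumJ m (λ J → F (false ∷ J))

subsets-sumJ : ∀ m (F : Vec Bool m → ℤ) → sumℤ (map F (subsets m)) ≡ sumJ m F
subsets-sumJ zero    F = ℤₚ.+-identityʳ (F [])
subsets-sumJ (suc m) F = trans (sumℤ-concatMap F (λ b → map (b ∷_) (subsets m)) (true ∷ false ∷ []))
  (cong₂ _+_ (trans (sumℤ-map-map F (true ∷_) (subsets m)) (subsets-sumJ m (λ J → F (true ∷ J))))
    (trans (ℤₚ.+-identityʳ (sumℤ (map F (map (false ∷_) (subsets m))))) (trans (sumℤ-map-map F (false ∷_) (subsets m)) (subsets-sumJ m (λ J → F (false ∷ J))))))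

sumJ-cong : ∀ m {F G : Vec Bool m → ℤ} → (∀ J → F J ≡ G J) → sumJ m F ≡ sumJ m G
sumJ-cong zero    e = e []
sumJ-cong (suc m) e = cong₂ _+_ (sumJ-cong m λ J → e (true ∷ J)) (sumJ-cong m λ J → e (false ∷ J))

sumJ-*ˡ : ∀ m c (F : Vec Bool m → ℤ) → sumJ m (λ J → c * F J) ≡ c * sumJ m F
sumJ-*ˡ zero    c F = refl
sumJ-*ˡ (suc m) c F = trans (cong₂ _+_ (sumJ-*ˡ m c (λ J → F (true ∷ J))) (sumJ-*ˡ m c (λ J → F (false ∷ J))))
  (sym (ℤₚ.*-distribˡ-+ c (sumJ m (λ J → F (true ∷ J))) (sumJ m (λ J → F (false ∷ J)))))

sumJ-zero : ∀ m {F : Vec Bool m → ℤ} → (∀ J → F J ≡ 0ℤ) → sumJ m F ≡ 0ℤ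
sumJ-zero zero    e = e []
sumJ-zero (suc m) e = cong₂ _+_ (sumJ-zero m λ J → e (true ∷ J)) (sumJ-zero m λ J → e (false ∷ J))

sumJ-bs : ∀ m n B (F : Vec Bool m → Vec ℤ n → ℤ) → sumJ m (λ J → bs n B (F J)) ≡ bs n B (λ v → sumJ m (λ J → F J v))
sumJ-bs zero    n B F = refl
sumJ-bs (suc m) n B F = trans (cong₂ _+_ (sumJ-bs m n B (λ J → F (true ∷ J))) (sumJ-bs m n B (λ J → F (false ∷ J))))
  (sym (bs-+ n B (λ v → sumJ m (λ J → F (true ∷ J) v)) (λ v → sumJ m (λ J → F (false ∷ J) v))))

indicator : Bool → ℤ
indicator b = if b then 1ℤ else 0ℤ

δ : ℤ → ℤ → ℤ
δ a b = indicator (isYes (a ℤ.≟ b))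

ε : ℤ → ℤ → ℤ
ε x y = if x ℤ.≤ᵇ 0ℤ then (if y ℤ.≤ᵇ 0ℤ then - 1ℤ else 0ℤ) else (if y ℤ.≤ᵇ 0ℤ then 0ℤ else 1ℤ)

E : ∀ {n} → Vec ℤ n → Vec ℤ n → ℤ
E []      []      = 1ℤ
E (x ∷ u) (y ∷ v) = ε x y * E u v

-- The sum factors over the coordinates: j in J needs both entries ≤ 0 and costs a sign, j outside J
-- needs both positive, and mixed signs fit no J.
sumJ-E : ∀ {m} (u v : Vec ℤ m) b z →
  sumJ m (λ J → minusOnePow (card J) * (if inZJ J u ∧ inZJ J v ∧ b then z else 0ℤ)) ≡ E u v * (if b then z else 0ℤ)
sumJ-E []      []      b z = refl
sumJ-E {suc m} (x ∷ u) (y ∷ v) b z with x ℤ.≤ᵇ 0ℤ | y ℤ.≤ᵇ 0ℤ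
... | true  | true  = trans (cong₂ _+_ (trans (sumJ-cong m λ J → neg (minusOnePow (card J)) (if inZJ J u ∧ inZJ J v ∧ b then z else 0ℤ))
                        (trans (sumJ-*ˡ m (- 1ℤ) (λ J → minusOnePow (card J) * (if inZJ J u ∧ inZJ J v ∧ b then z else 0ℤ))) (cong (- 1ℤ *_) (sumJ-E u v b z))))
                      (sumJ-zero m λ J → ℤₚ.*-zeroʳ (minusOnePow (card J))))
                      (trans (ℤₚ.+-identityʳ (- 1ℤ * (E u v * (if b then z else 0ℤ)))) (sym (ℤₚ.*-assoc (- 1ℤ) (E u v) (if b then z else 0ℤ))))
  where
  neg : ∀ a c → - a * c ≡ - + 1 * (a * c)
  neg = solve-∀
... | true  | false = cong₂ _+_ (sumJ-zero m λ J → trans (cong (λ c → - minusOnePow (card J) * (if c then z else 0ℤ)) (∧-zeroʳ (inZJ J u))) (ℤₚ.*-zeroʳ (- minusOnePow (card J))))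
                      (sumJ-zero m λ J → ℤₚ.*-zeroʳ (minusOnePow (card J)))
... | false | true  = cong₂ _+_ (sumJ-zero m λ J → ℤₚ.*-zeroʳ (- minusOnePow (card J)))
                      (sumJ-zero m λ J → trans (cong (λ c → minusOnePow (card J) * (if c then z else 0ℤ)) (∧-zeroʳ (inZJ J u))) (ℤₚ.*-zeroʳ (minusOnePow (card J))))
... | false | false = trans (cong₂ _+_ (sumJ-zero m λ J → ℤₚ.*-zeroʳ (- minusOnePow (card J))) (sumJ-E u v b z))
                      (trans (ℤₚ.+-identityˡ (E u v * (if b then z else 0ℤ))) (cong (_* (if b then z else 0ℤ)) (sym (ℤₚ.*-identityˡ (E u v)))))

if-* : ∀ b z → (if b then z else 0ℤ) ≡ indicator b * z
if-* true  z = sym (ℤₚ.*-identityˡ z)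
if-* false z = refl

δ-yes : ∀ {a b} → a ≡ b → δ a b ≡ 1ℤ
δ-yes {a} {b} e with a ℤ.≟ b
... | yes _ = refl
... | no ≢  = ⊥-elim (≢ e)

δ-no : ∀ {a b} → a ≢ b → δ a b ≡ 0ℤ
δ-no {a} {b} ne with a ℤ.≟ b
... | yes e = ⊥-elim (ne e)
... | no _  = refl

δ-dec : ∀ a b → a ≡ b ⊎ δ a b ≡ 0ℤ
δ-dec a b with a ℤ.≟ b
... | yes e = inj₁ e
... | no _  = inj₂ refl

δ-cong : ∀ {a b c d} → (a ≡ b → c ≡ d) → (c ≡ d → a ≡ b) → δ a b ≡ δ c d
δ-cong {a} {b} f g with a ℤ.≟ b
... | yes e = sym (δ-yes (f e))
... | no ne = sym (δ-no λ e → ne (g e))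

δ-+ : ∀ a b c → δ (a + c) (b + c) ≡ δ a b
δ-+ a b c = δ-cong {a + c} {b + c} {a} {b} (λ e → trans (sym (lem a c)) (trans (cong (_- c) e) (lem b c))) (cong (_+ c))
  where
  lem : ∀ a c → a + c - c ≡ a
  lem = solve-∀

dotPart-∷ʳ : ∀ {n} (k ρ : Vec ℤ n) l y → dotPart (k ∷ʳ l) (ρ ∷ʳ y) ≡ (+ 2 * l - 1ℤ) * y + dotPart k ρ
dotPart-∷ʳ []      []      l y = refl
dotPart-∷ʳ (x ∷ k) (z ∷ ρ) l y = trans (((+ 2 * x - 1ℤ) * z) ⟨+⟩ dotPart-∷ʳ k ρ l y) (lem ((+ 2 * x - 1ℤ) * z) ((+ 2 * l - 1ℤ) * y) (dotPart k ρ))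
  where
  lem : ∀ a b c → a + (b + c) ≡ b + (a + c)
  lem = solve-∀

offset : ℕ → ℤ
offset n = + ((suc n ℕ.* suc n ∸ 1) ℕ./ 4)

-- With kₘ = -|k| the factor -(1 + 2|k|) is 2kₘ - 1, so the last coordinate enters the exponent like
-- the others.
expo-dot : ∀ n k (r : Vec ℤ (suc n)) → expo n k r ≡ dotPart (ext k) r - offset n
expo-dot n k r = cong (_- offset n) (trans (lem (dotPart k (Vec.init r)) (sumV k) (Vec.last r))
  (trans (sym (dotPart-∷ʳ k (Vec.init r) (- sumV k) (Vec.last r))) (cong (dotPart (ext k)) (sym (proj₂ (proj₂ (Vec.initLast r)))))))
  where
  lem : ∀ d s y → d - (+ 1 + + 2 * s) * y ≡ (+ 2 * - s - + 1) * y + d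
  lem = solve-∀

summand : ∀ {n} → ℤ → Vec ℤ n → Vec ℤ n → ℤ
summand M u r = E u r * (δ (dotPart u r) M * vdm2 r)

tripleSum : ∀ n B N → tripleSumTrunc (suc n) B N ≡ bs n B (λ k → bs (suc n) B (summand (N + offset n) (ext k)))
tripleSum n B N = begin
  sumℤ (map (λ J → minusOnePow (card J) * sumℤ (map (λ k → sumℤ (map (body J k) (box (suc n) B))) (box n B))) (subsets (suc n)))
    ≡⟨ subsets-sumJ (suc n) (λ J → minusOnePow (card J) * sumℤ (map (λ k → sumℤ (map (body J k) (box (suc n) B))) (box n B))) ⟩
  sumJ (suc n) (λ J → minusOnePow (card J) * sumℤ (map (λ k → sumℤ (map (body J k) (box (suc n) B))) (box n B)))
    ≡⟨ sumJ-cong (suc n) (λ J → trans (cong (minusOnePow (card J) *_) (trans (box-bs n B (λ k → sumℤ (map (body J k) (box (suc n) B)))) (bs-cong n B λ k → box-bs (suc n) B (body J k))))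
         (trans (sym (bs-*ˡ n B (minusOnePow (card J)) (λ k → bs (suc n) B (body J k)))) (bs-cong n B λ k → sym (bs-*ˡ (suc n) B (minusOnePow (card J)) (body J k))))) ⟩
  sumJ (suc n) (λ J → bs n B (λ k → bs (suc n) B (λ r → minusOnePow (card J) * body J k r)))
    ≡⟨ trans (sumJ-bs (suc n) n B (λ J k → bs (suc n) B (λ r → minusOnePow (card J) * body J k r)))
         (bs-cong n B λ k → sumJ-bs (suc n) (suc n) B (λ J r → minusOnePow (card J) * body J k r)) ⟩
  bs n B (λ k → bs (suc n) B (λ r → sumJ (suc n) (λ J → minusOnePow (card J) * body J k r)))
    ≡⟨ bs-cong n B (λ k → bs-cong (suc n) B λ r → trans (sumJ-E (ext k) r (isYes (expo n k r ℤ.≟ N)) (vdm2 r))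
         (cong (E (ext k) r *_) (trans (if-* (isYes (expo n k r ℤ.≟ N)) (vdm2 r)) (cong (_* vdm2 r) (shift-δ k r))))) ⟩
  bs n B (λ k → bs (suc n) B (summand (N + offset n) (ext k))) ∎
  where
  body : Vec Bool (suc n) → Vec ℤ n → Vec ℤ (suc n) → ℤ
  body J k r = if inZJ J (ext k) ∧ inZJ J r ∧ isYes (expo n k r ℤ.≟ N) then vdm2 r else 0ℤ
  cancel : ∀ a c → a - c + c ≡ a
  cancel = solve-∀
  shift-δ : ∀ k r → δ (expo n k r) N ≡ δ (dotPart (ext k) r) (N + offset n)
  shift-δ k r = trans (sym (δ-+ (expo n k r) N (offset n))) (cong (λ e → δ e (N + offset n)) (trans (cong (_+ offset n) (expo-dot n k r)) (cancel (dotPart (ext k) r) (offset n))))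

-- Where ε is nonzero the exponent (2x - 1) y is a natural number; it bounds
-- |y|, and also |x| unless y = 0.
ε-bound : ∀ x y → ε x y ≡ 0ℤ ⊎ (Σ[ e ∈ ℕ ] (+ 2 * x - 1ℤ) * y ≡ + e × ∣ y ∣ ≤ e × (y ≢ 0ℤ → ∣ x ∣ ≤ e))
ε-bound (+ suc a) (+ suc b) = inj₂ (suc (a ℕ.+ a) ℕ.* suc b , trans (cong (_* + suc b) (lem (+ a))) (sym (ℤₚ.pos-* (suc (a ℕ.+ a)) (suc b))) ,
    ℕₚ.m≤n*m (suc b) (suc (a ℕ.+ a)) , λ _ → ℕₚ.≤-trans (s≤s (ℕₚ.m≤m+n a a)) (ℕₚ.m≤m*n (suc (a ℕ.+ a)) (suc b)))
  where
  lem : ∀ a → + 2 * (+ 1 + a) - + 1 ≡ + 1 + (a + a)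
  lem = solve-∀
ε-bound (+ zero)  (+ zero)  = inj₂ (0 , refl , z≤n , λ ne → ⊥-elim (ne refl))
ε-bound (+ zero)  (+ suc b) = inj₁ refl
ε-bound (+ suc a) (+ zero)  = inj₁ refl
ε-bound (+ suc a) -[1+ b ]  = inj₁ refl
ε-bound -[1+ a ]  (+ suc b) = inj₁ refl
ε-bound (+ zero)  -[1+ b ]  = inj₂ (suc b , lem (+ suc b) , ℕₚ.≤-refl , λ _ → z≤n)
  where
  lem : ∀ b → (+ 2 * + 0 - + 1) * - b ≡ b
  lem = solve-∀
ε-bound -[1+ a ]  (+ zero)  = inj₂ (0 , ℤₚ.*-zeroʳ (+ 2 * -[1+ a ] - 1ℤ) , z≤n , λ ne → ⊥-elim (ne refl))
ε-bound -[1+ a ]  -[1+ b ]  = inj₂ (suc (suc a ℕ.+ suc a) ℕ.* suc b , trans (lem (+ suc a) (+ suc b)) (sym (ℤₚ.pos-* (suc (suc a ℕ.+ suc a)) (suc b))) ,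
    ℕₚ.m≤n*m (suc b) (suc (suc a ℕ.+ suc a)) , λ _ → ℕₚ.≤-trans (ℕₚ.≤-trans (ℕₚ.m≤m+n (suc a) (suc a)) (ℕₚ.n≤1+n (suc a ℕ.+ suc a))) (ℕₚ.m≤m*n (suc (suc a ℕ.+ suc a)) (suc b)))
  where
  lem : ∀ a b → (+ 2 * - a - + 1) * - b ≡ (+ 1 + (a + a)) * b
  lem = solve-∀

E-bound : ∀ {n} (u r : Vec ℤ n) → E u r ≡ 0ℤ ⊎ (Σ[ d ∈ ℕ ] dotPart u r ≡ + d × absSum r ≤ d)
E-bound []      []      = inj₂ (0 , refl , z≤n)
E-bound (x ∷ u) (y ∷ r) with ε-bound x y | E-bound u r
... | inj₁ z | _      = inj₁ (cong (_* E u r) z)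
... | inj₂ _ | inj₁ z = inj₁ (trans (cong (ε x y *_) z) (ℤₚ.*-zeroʳ (ε x y)))
... | inj₂ (e , eq , le , _) | inj₂ (d , eq′ , le′) = inj₂ (e ℕ.+ d , cong₂ _+_ eq eq′ , ℕₚ.+-mono-≤ le le′)

-- The exponent bounds r alone, uniformly in u: this is what translating r at fixed k requires.
supported-summand : ∀ {n} M (u : Vec ℤ n) → Supported ∣ M ∣ (summand M u)
supported-summand M u r ¬all with E-bound u r | δ-dec (dotPart u r) M
... | inj₁ z | _     = cong (_* (δ (dotPart u r) M * vdm2 r)) z
... | inj₂ _ | inj₂ z = trans (cong (λ d → E u r * (d * vdm2 r)) z) (ℤₚ.*-zeroʳ (E u r))
... | inj₂ (d , eq , le) | inj₁ e = ⊥-elim (¬all (all-≤ (subst (absSum r ≤_) (cong ∣_∣ (trans (sym eq) e)) le) (all≤absSum r)))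

SZ-shift : ∀ B (g : ℤ → ℤ) → SZ B (λ x → g (x + 1ℤ)) + g (- + B) ≡ SZ B g + g (+ suc B)
SZ-shift zero g = lem (g (+ 1)) (g (+ 0))
  where
  lem : ∀ a b → (a + + 0) + b ≡ (b + + 0) + a
  lem = solve-∀
SZ-shift (suc B) g = begin
  g 1ℤ + Σ (suc B) (λ k → g (+ suc k + 1ℤ) + g (-[1+ k ] + 1ℤ)) + g -[1+ B ]
    ≡⟨ cong (λ z → g 1ℤ + z + g -[1+ B ]) (Σ-last B (λ k → g (+ suc k + 1ℤ) + g (-[1+ k ] + 1ℤ))) ⟩
  g 1ℤ + (S′ + (g (+ suc B + 1ℤ) + g (-[1+ B ] + 1ℤ))) + g -[1+ B ]
    ≡⟨ cong₂ (λ a b → g 1ℤ + (S′ + (g a + g b)) + g -[1+ B ]) (cong +_ (ℕₚ.+-comm (suc B) 1)) (lem₁ (+ B)) ⟩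
  g 1ℤ + (S′ + (g (+ suc (suc B)) + g (- + B))) + g -[1+ B ]
    ≡⟨ lem₂ (g 1ℤ) S′ (g (+ suc (suc B))) (g (- + B)) (g -[1+ B ]) ⟩
  (g 1ℤ + S′ + g (- + B)) + (g (+ suc (suc B)) + g -[1+ B ])
    ≡⟨ cong (_+ (g (+ suc (suc B)) + g -[1+ B ])) (SZ-shift B g) ⟩
  (g 0ℤ + S + g (+ suc B)) + (g (+ suc (suc B)) + g -[1+ B ])
    ≡⟨ lem₃ (g 0ℤ) S (g (+ suc B)) (g (+ suc (suc B))) (g -[1+ B ]) ⟩
  g 0ℤ + (S + (g (+ suc B) + g -[1+ B ])) + g (+ suc (suc B))
    ≡⟨ cong (λ z → g 0ℤ + z + g (+ suc (suc B))) (sym (Σ-last B (λ k → g (+ suc k) + g -[1+ k ]))) ⟩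
  SZ (suc B) g + g (+ suc (suc B)) ∎
  where
  S S′ : ℤ
  S = Σ B (λ k → g (+ suc k) + g -[1+ k ])
  S′ = Σ B (λ k → g (+ suc k + 1ℤ) + g (-[1+ k ] + 1ℤ))
  lem₁ : ∀ b → - (+ 1 + b) + + 1 ≡ - b
  lem₁ = solve-∀
  lem₂ : ∀ a s b c d → a + (s + (b + c)) + d ≡ (a + s + c) + (b + d)
  lem₂ = solve-∀
  lem₃ : ∀ a s b c d → (a + s + b) + (c + d) ≡ a + (s + (b + d)) + c
  lem₃ = solve-∀

SZ-shift-supported : ∀ B (g : ℤ → ℤ) → g (- + B) ≡ 0ℤ → g (+ suc B) ≡ 0ℤ → SZ B (λ x → g (x + 1ℤ)) ≡ SZ B g
SZ-shift-supported B g lo hi = trans (sym (ℤₚ.+-identityʳ (SZ B (λ x → g (x + 1ℤ))))) (trans (SZ B (λ x → g (x + 1ℤ)) ⟨+⟩ sym lo)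
  (trans (SZ-shift B g) (trans (SZ B g ⟨+⟩ hi) (ℤₚ.+-identityʳ (SZ B g)))))

-- The factor 1 - q^m as a difference under translation of r

increment : ∀ {n} → Vec ℤ n → Vec ℤ n
increment = Vec.map (_+ 1ℤ)

bs-shift : ∀ n {S B} (f : Vec ℤ n → ℤ) → S < B → Supported S f → bs n B (λ v → f (increment v)) ≡ bs n B f
bs-shift zero    f _ _ = refl
bs-shift (suc n) {S} {B} f S<B s = trans (SZ-cong B λ x → bs-shift n (λ v → f ((x + 1ℤ) ∷ v)) S<B (supported-tail {f = f} (x + 1ℤ) s))
  (SZ-shift-supported B (λ x → bs n B (λ v → f (x ∷ v))) (supported-head B {f} (- + B) s (subst (S <_) (sym (ℤₚ.∣-i∣≡∣i∣ (+ B))) S<B))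
    (supported-head B {f} (+ suc B) s (ℕₚ.≤-trans S<B (ℕₚ.n≤1+n B))))

isZero : ℤ → ℤ
isZero (+ zero)  = 1ℤ
isZero (+ suc _) = 0ℤ
isZero -[1+ _ ]  = 0ℤ

ε-suc : ∀ x y → ε x (y + 1ℤ) ≡ ε x y + isZero y
ε-suc x (+ zero) with x ℤ.≤ᵇ 0ℤ
... | true  = refl
... | false = refl
ε-suc x (+ suc b) = sym (ℤₚ.+-identityʳ (ε x (+ suc b)))
ε-suc x -[1+ zero ]  = sym (ℤₚ.+-identityʳ (ε x -[1+ zero ]))
ε-suc x -[1+ suc b ] = sym (ℤₚ.+-identityʳ (ε x -[1+ suc b ]))

-- Σ over the positions j with r_j = 0 of the product of ε over the others.
Z : ∀ {n} → Vec ℤ n → Vec ℤ n → ℤ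
Z []      []      = 0ℤ
Z (x ∷ u) (y ∷ r) = isZero y * E u r + ε x y * Z u r

isZero-* : ∀ y → isZero y * y ≡ 0ℤ
isZero-* (+ zero)  = refl
isZero-* (+ suc b) = refl
isZero-* -[1+ b ]  = refl

-- `Z u r` needs a zero entry z of r; if y is zero as well, the row contains (y - z)² = 0.
row-Z : ∀ {n} y (u r : Vec ℤ n) → isZero y * (vdmRow y r * Z u r) ≡ 0ℤ
row-Z y []      []      = trans (cong (isZero y *_) (ℤₚ.*-zeroʳ 1ℤ)) (ℤₚ.*-zeroʳ (isZero y))
row-Z y (x ∷ u) (z ∷ r) = trans (lem₁ (isZero y) y z (vdmRow y r) (isZero z) (E u r) (ε x z) (Z u r))
  (trans (cong₂ (λ a b → a * ((y - + 2 * z) * vdmRow y r * isZero z * E u r) + isZero y * (b * (z * vdmRow y r * E u r)) + (y - z) * (y - z) * ε x z * (isZero y * (vdmRow y r * Z u r))) (isZero-* y) (isZero-* z))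
    (trans (cong (λ a → 0ℤ * ((y - + 2 * z) * vdmRow y r * isZero z * E u r) + isZero y * (0ℤ * (z * vdmRow y r * E u r)) + (y - z) * (y - z) * ε x z * a) (row-Z y u r))
      (lem₂ ((y - + 2 * z) * vdmRow y r * isZero z * E u r) (isZero y) (z * vdmRow y r * E u r) ((y - z) * (y - z) * ε x z))))
  where
  lem₁ : ∀ i y z R j e ε Z → i * ((y - z) * (y - z) * R * (j * e + ε * Z)) ≡
    (i * y) * ((y - + 2 * z) * R * j * e) + i * ((j * z) * (z * R * e)) + (y - z) * (y - z) * ε * (i * (R * Z))
  lem₁ = solve-∀
  lem₂ : ∀ a i b c → + 0 * a + i * (+ 0 * b) + c * + 0 ≡ + 0
  lem₂ = solve-∀

-- Two vanishing coordinates are killed by the Vandermonde product.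
E-increment : ∀ {n} (u r : Vec ℤ n) → E u (increment r) * vdm2 r ≡ (E u r + Z u r) * vdm2 r
E-increment []      []      = refl
E-increment (x ∷ u) (y ∷ r) = begin
  ε x (y + 1ℤ) * E u (increment r) * (R * V)
    ≡⟨ cong (λ e → e * E u (increment r) * (R * V)) (ε-suc x y) ⟩
  (ε x y + isZero y) * E u (increment r) * (R * V)
    ≡⟨ lem₁ (ε x y + isZero y) (E u (increment r)) R V ⟩
  (ε x y + isZero y) * R * (E u (increment r) * V)
    ≡⟨ cong ((ε x y + isZero y) * R *_) (E-increment u r) ⟩
  (ε x y + isZero y) * R * ((E u r + Z u r) * V)
    ≡⟨ lem₂ (ε x y) (isZero y) R (E u r) (Z u r) V ⟩
  (ε x y * E u r + (isZero y * E u r + ε x y * Z u r)) * (R * V) + isZero y * (R * Z u r) * V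
    ≡⟨ cong (λ a → (ε x y * E u r + (isZero y * E u r + ε x y * Z u r)) * (R * V) + a * V) (row-Z y u r) ⟩
  (ε x y * E u r + (isZero y * E u r + ε x y * Z u r)) * (R * V) + 0ℤ * V
    ≡⟨ ℤₚ.+-identityʳ _ ⟩
  (ε x y * E u r + (isZero y * E u r + ε x y * Z u r)) * (R * V) ∎
  where
  R = vdmRow y r
  V = vdm2 r
  lem₁ : ∀ a e R V → a * e * (R * V) ≡ a * R * (e * V)
  lem₁ = solve-∀
  lem₂ : ∀ ε i R e Z V → (ε + i) * R * ((e + Z) * V) ≡ (ε * e + (i * e + ε * Z)) * (R * V) + i * (R * Z) * V
  lem₂ = solve-∀

vdm2-increment : ∀ {n} (r : Vec ℤ n) → vdm2 (increment r) ≡ vdm2 r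
vdm2-increment []      = refl
vdm2-increment (y ∷ r) = cong₂ _*_ (row r) (vdm2-increment r)
  where
  lem : ∀ y z → ((y + + 1) - (z + + 1)) ≡ y - z
  lem = solve-∀
  row : ∀ {n} (r : Vec ℤ n) → vdmRow (y + 1ℤ) (increment r) ≡ vdmRow y r
  row []      = refl
  row (z ∷ r) = cong₂ (λ a b → a * a * b) (lem y z) (row r)

dotPart-increment : ∀ {n} (u r : Vec ℤ n) → dotPart u (increment r) ≡ dotPart u r + (+ 2 * sumV u - + n)
dotPart-increment []      []      = refl
dotPart-increment {suc n} (x ∷ u) (y ∷ r) = trans (((+ 2 * x - 1ℤ) * (y + 1ℤ)) ⟨+⟩ dotPart-increment u r) (lem x y (dotPart u r) (sumV u) (+ n))
  where
  lem : ∀ x y d s n → (+ 2 * x - + 1) * (y + + 1) + (d + (+ 2 * s - n)) ≡ (+ 2 * x - + 1) * y + d + (+ 2 * (x + s) - (+ 1 + n))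
  lem = solve-∀

sumV-∷ʳ : ∀ {n} (k : Vec ℤ n) l → sumV (k ∷ʳ l) ≡ l + sumV k
sumV-∷ʳ []      l = refl
sumV-∷ʳ (x ∷ k) l = trans (x ⟨+⟩ sumV-∷ʳ k l) (lem x l (sumV k))
  where
  lem : ∀ a b c → a + (b + c) ≡ b + (a + c)
  lem = solve-∀

zeroSum : ∀ n B → ℤ → ℤ
zeroSum n B M = bs n B (λ k → bs (suc n) B (λ r → Z (ext k) r * (δ (dotPart (ext k) r) M * vdm2 r)))

-- At fixed k, translating r by 1 lowers the exponent by m, since Σ kⱼ = 0. So the sum in degree N -
-- m becomes one in degree N, and `E-increment` evaluates the difference. The bound on B keeps the
-- translated support inside the box.
rhs-zeroSum : ∀ n B N → ∣ N - + suc n + offset n ∣ < B → rhsCoeffTrunc (suc n) B N ≡ - zeroSum n B (N + offset n)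
rhs-zeroSum n B N lt = begin
  tripleSumTrunc (suc n) B N - tripleSumTrunc (suc n) B (N - + suc n)
    ≡⟨ cong₂ _-_ (tripleSum n B N) (tripleSum n B (N - + suc n)) ⟩
  bs n B (λ k → bs (suc n) B (summand M (ext k))) - bs n B (λ k → bs (suc n) B (summand M′ (ext k)))
    ≡⟨ minus-bs n (λ k → bs (suc n) B (summand M (ext k))) (λ k → bs (suc n) B (summand M′ (ext k))) ⟩
  bs n B (λ k → bs (suc n) B (summand M (ext k)) + - 1ℤ * bs (suc n) B (summand M′ (ext k)))
    ≡⟨ bs-cong n B inner ⟩
  bs n B (λ k → - 1ℤ * bs (suc n) B (λ r → Z (ext k) r * (δ (dotPart (ext k) r) M * vdm2 r)))
    ≡⟨ trans (bs-*ˡ n B (- 1ℤ) (λ k → bs (suc n) B (λ r → Z (ext k) r * (δ (dotPart (ext k) r) M * vdm2 r)))) (ℤₚ.-1*i≡-i (zeroSum n B M)) ⟩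
  - zeroSum n B M ∎
  where
  M M′ : ℤ
  M = N + offset n
  M′ = N - + suc n + offset n
  minus-bs : ∀ n (f g : Vec ℤ n → ℤ) → bs n B f - bs n B g ≡ bs n B (λ v → f v + - 1ℤ * g v)
  minus-bs n f g = trans (bs n B f ⟨+⟩ trans (sym (ℤₚ.-1*i≡-i (bs n B g))) (sym (bs-*ˡ n B (- 1ℤ) g))) (sym (bs-+ n B f (λ v → - 1ℤ * g v)))
  inner : ∀ k → bs (suc n) B (summand M (ext k)) + - 1ℤ * bs (suc n) B (summand M′ (ext k)) ≡
    - 1ℤ * bs (suc n) B (λ r → Z (ext k) r * (δ (dotPart (ext k) r) M * vdm2 r))
  inner k = trans (bs (suc n) B (summand M u) ⟨+⟩ trans (cong (- 1ℤ *_) (sym (bs-shift (suc n) (summand M′ u) lt (supported-summand M′ u))))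
      (sym (bs-*ˡ (suc n) B (- 1ℤ) (λ r → summand M′ u (increment r)))))
    (trans (sym (bs-+ (suc n) B (summand M u) (λ r → - 1ℤ * summand M′ u (increment r))))
      (trans (bs-cong (suc n) B pointwise) (bs-*ˡ (suc n) B (- 1ℤ) (λ r → Z u r * (δ (dotPart u r) M * vdm2 r)))))
    where
    u = ext k
    Σu≡0 : sumV u ≡ 0ℤ
    Σu≡0 = trans (sumV-∷ʳ k (- sumV k)) (ℤₚ.+-inverseˡ (sumV k))
    lem₁ : ∀ N m c → N - m + c ≡ (N + c) + (+ 2 * + 0 - m)
    lem₁ = solve-∀
    shifted-δ : ∀ r → δ (dotPart u (increment r)) M′ ≡ δ (dotPart u r) M
    shifted-δ r = trans (cong₂ δ (trans (dotPart-increment u r) (cong (λ s → dotPart u r + (+ 2 * s - + suc n)) Σu≡0)) (lem₁ N (+ suc n) (offset n)))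
      (δ-+ (dotPart u r) M (+ 2 * 0ℤ - + suc n))
    pointwise : ∀ r → summand M u r + - 1ℤ * summand M′ u (increment r) ≡ - 1ℤ * (Z u r * (δ (dotPart u r) M * vdm2 r))
    pointwise r = trans (cong₂ (λ d v → E u r * (δ (dotPart u r) M * vdm2 r) + - 1ℤ * (E u (increment r) * (d * v))) (shifted-δ r) (vdm2-increment r))
      (trans (lem₂ (E u r) (δ (dotPart u r) M) (vdm2 r) (E u (increment r)))
        (trans (cong (λ a → δ (dotPart u r) M * (E u r * vdm2 r + - 1ℤ * a)) (E-increment u r)) (lem₃ (E u r) (δ (dotPart u r) M) (vdm2 r) (Z u r))))
      where
      lem₂ : ∀ e d v e′ → e * (d * v) + - + 1 * (e′ * (d * v)) ≡ d * (e * v + - + 1 * (e′ * v))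
      lem₂ = solve-∀
      lem₃ : ∀ e d v z → d * (e * v + - + 1 * ((e + z) * v)) ≡ - + 1 * (z * (d * v))
      lem₃ = solve-∀

SZ-neg : ∀ B (g : ℤ → ℤ) → SZ B (λ x → g (- x)) ≡ SZ B g
SZ-neg B g = g 0ℤ ⟨+⟩ Σ-cong B λ k → ℤₚ.+-comm (g -[1+ k ]) (g (+ suc k))

SZ-translate⁺ : ∀ B (f : ℤ → ℤ) n → (∀ x → ∣ x ∣ ℕ.+ n ≤ B ⊎ f x ≡ 0ℤ) → SZ B (λ x → f (x + + n)) ≡ SZ B f
SZ-translate⁺ B f zero    H = SZ-cong B λ x → cong f (ℤₚ.+-identityʳ x)
SZ-translate⁺ B f (suc n) H = begin
  SZ B (λ x → f (x + + suc n))      ≡⟨ SZ-cong B (λ x → cong f (lem x (+ n))) ⟩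
  SZ B (λ x → f ((x + 1ℤ) + + n))   ≡⟨ SZ-shift-supported B (λ x → f (x + + n)) lo hi ⟩
  SZ B (λ x → f (x + + n))          ≡⟨ SZ-translate⁺ B f n weaker ⟩
  SZ B f                            ∎
  where
  lem : ∀ x n → x + (+ 1 + n) ≡ (x + + 1) + n
  lem = solve-∀
  weaker : ∀ x → ∣ x ∣ ℕ.+ n ≤ B ⊎ f x ≡ 0ℤ
  weaker x with H x
  ... | inj₁ le = inj₁ (ℕₚ.≤-trans (ℕₚ.+-monoʳ-≤ ∣ x ∣ (ℕₚ.n≤1+n n)) le)
  ... | inj₂ z  = inj₂ z
  outside : ∀ x → B ≤ ∣ x ∣ ℕ.+ n → f x ≡ 0ℤ
  outside x B≤ with H x
  ... | inj₁ le = ⊥-elim (ℕₚ.<⇒≱ (ℕₚ.≤-trans (s≤s B≤) (ℕₚ.≤-reflexive (sym (ℕₚ.+-suc ∣ x ∣ n)))) le)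
  ... | inj₂ z  = z
  lem₂ : ∀ b n → b ≡ - (- b + n) + n
  lem₂ = solve-∀
  lo : f (- + B + + n) ≡ 0ℤ
  lo = outside (- + B + + n) (ℕₚ.≤-trans (ℕₚ.≤-reflexive (cong ∣_∣ (lem₂ (+ B) (+ n))))
    (ℕₚ.≤-trans (ℤₚ.∣i+j∣≤∣i∣+∣j∣ (- (- + B + + n)) (+ n)) (ℕₚ.+-monoˡ-≤ n (ℕₚ.≤-reflexive (ℤₚ.∣-i∣≡∣i∣ (- + B + + n))))))
  hi : f (+ suc B + + n) ≡ 0ℤ
  hi = outside (+ suc B + + n) (ℕₚ.≤-trans (ℕₚ.n≤1+n B) (ℕₚ.≤-trans (ℕₚ.m≤m+n (suc B) n) (ℕₚ.m≤m+n (suc B ℕ.+ n) n)))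

-- The map x ↦ -(x + c) does not preserve the interval; the hypothesis leaves a margin |c| around
-- the support of g.
SZ-reflect : ∀ B (g : ℤ → ℤ) c → (∀ x → ∣ x ∣ ℕ.+ ∣ c ∣ ≤ B ⊎ g x ≡ 0ℤ) → SZ B (λ x → g (- (x + c))) ≡ SZ B g
SZ-reflect B g (+ n) H = trans (SZ-translate⁺ B (λ x → g (- x)) n negated) (SZ-neg B g)
  where
  negated : ∀ x → ∣ x ∣ ℕ.+ n ≤ B ⊎ g (- x) ≡ 0ℤ
  negated x with H (- x)
  ... | inj₁ le = inj₁ (subst (λ a → a ℕ.+ n ≤ B) (ℤₚ.∣-i∣≡∣i∣ x) le)
  ... | inj₂ z  = inj₂ z
SZ-reflect B g -[1+ n ] H = trans (sym (SZ-neg B (λ x → g (- (x + -[1+ n ])))))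
  (trans (SZ-cong B λ x → cong g (lem x (+ suc n))) (SZ-translate⁺ B g (suc n) H))
  where
  lem : ∀ x n → - (- x + - n) ≡ x + n
  lem = solve-∀

bs-SZ : ∀ n B B′ (f : Vec ℤ n → ℤ → ℤ) → bs n B (λ v → SZ B′ (f v)) ≡ SZ B′ (λ y → bs n B (λ v → f v y))
bs-SZ zero    B B′ f = refl
bs-SZ (suc n) B B′ f = trans (SZ-cong B λ x → bs-SZ n B B′ (λ v → f (x ∷ v))) (SZ-swap B B′ (λ x y → bs n B (λ v → f (x ∷ v) y)))

bs-swap : ∀ n m B B′ (f : Vec ℤ n → Vec ℤ m → ℤ) → bs n B (λ u → bs m B′ (f u)) ≡ bs m B′ (λ v → bs n B (λ u → f u v))
bs-swap n zero    B B′ f = refl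
bs-swap n (suc m) B B′ f = trans (bs-SZ n B B′ (λ u y → bs m B′ (λ v → f u (y ∷ v)))) (SZ-cong B′ λ y → bs-swap n m B B′ (λ u v → f u (y ∷ v)))

bs-∷ʳ : ∀ n B (f : Vec ℤ (suc n) → ℤ) → bs (suc n) B f ≡ bs n B (λ ρ → SZ B (λ y → f (ρ ∷ʳ y)))
bs-∷ʳ zero    B f = refl
bs-∷ʳ (suc n) B f = SZ-cong B λ x → bs-∷ʳ n B (λ v → f (x ∷ v))

-- Independence of the position of the zero

Pairs : Set
Pairs = List (ℤ × ℤ)

zipL : ∀ {n} → Vec ℤ n → Vec ℤ n → Pairs
zipL []      []      = []
zipL (x ∷ u) (y ∷ v) = (x , y) ∷ zipL u v

-- Sums over lists of pairs (kⱼ, rⱼ): a simultaneous permutation of k and r becomes a permutation of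
-- one list.
ps : ℕ → ℕ → (Pairs → ℤ) → ℤ
ps zero    B Ψ = Ψ []
ps (suc n) B Ψ = SZ B (λ x → SZ B (λ y → ps n B (λ l → Ψ ((x , y) ∷ l))))

bs-ps : ∀ n B (Ψ : Pairs → ℤ) → bs n B (λ k → bs n B (λ ρ → Ψ (zipL k ρ))) ≡ ps n B Ψ
bs-ps zero    B Ψ = refl
bs-ps (suc n) B Ψ = SZ-cong B λ x → trans (bs-SZ n B B (λ k y → bs n B (λ ρ → Ψ ((x , y) ∷ zipL k ρ))))
  (SZ-cong B λ y → bs-ps n B (λ l → Ψ ((x , y) ∷ l)))

ps-cong : ∀ n B {Φ Ψ : Pairs → ℤ} → (∀ l → Φ l ≡ Ψ l) → ps n B Φ ≡ ps n B Ψ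
ps-cong zero    B e = e []
ps-cong (suc n) B e = SZ-cong B λ x → SZ-cong B λ y → ps-cong n B λ l → e ((x , y) ∷ l)

ps-+ : ∀ n B (Φ Ψ : Pairs → ℤ) → ps n B (λ l → Φ l + Ψ l) ≡ ps n B Φ + ps n B Ψ
ps-+ zero    B Φ Ψ = refl
ps-+ (suc n) B Φ Ψ = trans (SZ-cong B λ x → trans (SZ-cong B λ y → ps-+ n B (λ l → Φ ((x , y) ∷ l)) (λ l → Ψ ((x , y) ∷ l)))
    (SZ-+ B (λ y → ps n B (λ l → Φ ((x , y) ∷ l))) (λ y → ps n B (λ l → Ψ ((x , y) ∷ l)))))
  (SZ-+ B (λ x → SZ B (λ y → ps n B (λ l → Φ ((x , y) ∷ l)))) (λ x → SZ B (λ y → ps n B (λ l → Ψ ((x , y) ∷ l)))))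

ps-*ˡ : ∀ n B c (Φ : Pairs → ℤ) → ps n B (λ l → c * Φ l) ≡ c * ps n B Φ
ps-*ˡ zero    B c Φ = refl
ps-*ˡ (suc n) B c Φ = trans (SZ-cong B λ x → trans (SZ-cong B λ y → ps-*ˡ n B c (λ l → Φ ((x , y) ∷ l)))
    (SZ-*ˡ B c (λ y → ps n B (λ l → Φ ((x , y) ∷ l)))))
  (SZ-*ˡ B c (λ x → SZ B (λ y → ps n B (λ l → Φ ((x , y) ∷ l)))))

ps-SZ : ∀ n B (f : Pairs → ℤ → ℤ) → ps n B (λ l → SZ B (f l)) ≡ SZ B (λ z → ps n B (λ l → f l z))
ps-SZ zero    B f = refl
ps-SZ (suc n) B f = trans (SZ-cong B λ x → trans (SZ-cong B λ y → ps-SZ n B (λ l → f ((x , y) ∷ l)))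
    (SZ-swap B B (λ y z → ps n B (λ l → f ((x , y) ∷ l) z))))
  (SZ-swap B B (λ x z → SZ B (λ y → ps n B (λ l → f ((x , y) ∷ l) z))))

exponent : ℤ × ℤ → ℤ
exponent (x , y) = (+ 2 * x - 1ℤ) * y

Eℓ Zℓ dotℓ sumℓ : Pairs → ℤ
Eℓ []            = 1ℤ
Eℓ ((x , y) ∷ l) = ε x y * Eℓ l
Zℓ []            = 0ℤ
Zℓ ((x , y) ∷ l) = isZero y * Eℓ l + ε x y * Zℓ l
dotℓ l = lsum l exponent
sumℓ l = lsum l proj₁

ys : Pairs → List ℤ
ys = map proj₂

E≡Eℓ : ∀ {n} (u v : Vec ℤ n) → E u v ≡ Eℓ (zipL u v)
E≡Eℓ []      []      = refl
E≡Eℓ (x ∷ u) (y ∷ v) = cong (ε x y *_) (E≡Eℓ u v)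

Z≡Zℓ : ∀ {n} (u v : Vec ℤ n) → Z u v ≡ Zℓ (zipL u v)
Z≡Zℓ []      []      = refl
Z≡Zℓ (x ∷ u) (y ∷ v) = cong₂ (λ a b → isZero y * a + ε x y * b) (E≡Eℓ u v) (Z≡Zℓ u v)

dotPart≡dotℓ : ∀ {n} (u v : Vec ℤ n) → dotPart u v ≡ dotℓ (zipL u v)
dotPart≡dotℓ []      []      = refl
dotPart≡dotℓ (x ∷ u) (y ∷ v) = exponent (x , y) ⟨+⟩ dotPart≡dotℓ u v

sumV≡sumℓ : ∀ {n} (u v : Vec ℤ n) → sumV u ≡ sumℓ (zipL u v)
sumV≡sumℓ []      []      = refl
sumV≡sumℓ (x ∷ u) (y ∷ v) = x ⟨+⟩ sumV≡sumℓ u v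

toList≡ys : ∀ {n} (u v : Vec ℤ n) → toList v ≡ ys (zipL u v)
toList≡ys []      []      = refl
toList≡ys (x ∷ u) (y ∷ v) = cong (y ∷_) (toList≡ys u v)

E-∷ʳ : ∀ {n} (k ρ : Vec ℤ n) l y → E (k ∷ʳ l) (ρ ∷ʳ y) ≡ ε l y * E k ρ
E-∷ʳ []      []      l y = refl
E-∷ʳ (x ∷ k) (z ∷ ρ) l y = trans (cong (ε x z *_) (E-∷ʳ k ρ l y)) (lem (ε x z) (ε l y) (E k ρ))
  where
  lem : ∀ a b c → a * (b * c) ≡ b * (a * c)
  lem = solve-∀

Z-∷ʳ : ∀ {n} (k ρ : Vec ℤ n) l y → Z (k ∷ʳ l) (ρ ∷ʳ y) ≡ isZero y * E k ρ + ε l y * Z k ρ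
Z-∷ʳ []      []      l y = refl
Z-∷ʳ (x ∷ k) (z ∷ ρ) l y = trans (cong₂ (λ a b → isZero z * a + ε x z * b) (E-∷ʳ k ρ l y) (Z-∷ʳ k ρ l y))
  (lem (isZero z) (ε l y) (E k ρ) (ε x z) (isZero y) (Z k ρ))
  where
  lem : ∀ i e E x j Z → i * (e * E) + x * (j * E + e * Z) ≡ j * (x * E) + e * (i * E + x * Z)
  lem = solve-∀

toList-∷ʳ-↭ : ∀ {n} (ρ : Vec ℤ n) y → toList (ρ ∷ʳ y) ↭ y ∷ toList ρ
toList-∷ʳ-↭ []      y = ↭.refl
toList-∷ʳ-↭ (x ∷ ρ) y = ↭-trans (↭.prep x (toList-∷ʳ-↭ ρ y)) (↭.swap x y ↭.refl)

-- As Ψ is symmetric, every position of the zero contributes the same.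
ps-Zℓ : ∀ n B (Ψ : Pairs → ℤ) → (∀ {l k} → l ↭ k → Ψ l ≡ Ψ k) →
  ps (suc n) B (λ l → Zℓ l * Ψ l) ≡ + suc n * SZ B (λ x → ps n B (λ l → Eℓ l * Ψ ((x , 0ℤ) ∷ l)))
ps-Zℓ n B Ψ inv = begin
  SZ B (λ x → SZ B (λ y → ps n B (λ l → (isZero y * Eℓ l + ε x y * Zℓ l) * Ψ ((x , y) ∷ l))))
    ≡⟨ SZ-cong B (λ x → trans (SZ-cong B λ y → trans (ps-cong n B λ l → lem₁ (isZero y) (Eℓ l) (ε x y) (Zℓ l) (Ψ ((x , y) ∷ l)))
           (trans (ps-+ n B (λ l → isZero y * (Eℓ l * Ψ ((x , y) ∷ l))) (λ l → ε x y * (Zℓ l * Ψ ((x , y) ∷ l))))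
             (cong₂ _+_ (ps-*ˡ n B (isZero y) (λ l → Eℓ l * Ψ ((x , y) ∷ l))) (ps-*ˡ n B (ε x y) (λ l → Zℓ l * Ψ ((x , y) ∷ l))))))
         (SZ-+ B (λ y → isZero y * F x y) (λ y → ε x y * G x y))) ⟩
  SZ B (λ x → SZ B (λ y → isZero y * F x y) + SZ B (λ y → ε x y * G x y))
    ≡⟨ SZ-+ B (λ x → SZ B (λ y → isZero y * F x y)) (λ x → SZ B (λ y → ε x y * G x y)) ⟩
  SZ B (λ x → SZ B (λ y → isZero y * F x y)) + SZ B (λ x → SZ B (λ y → ε x y * G x y))
    ≡⟨ cong₂ _+_ (SZ-cong B λ x → SZ-isZero (F x)) (rest n Ψ inv) ⟩
  Q + + n * Q
    ≡⟨ lem₂ Q (+ n) ⟩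
  + suc n * Q ∎
  where
  F G : ℤ → ℤ → ℤ
  F x y = ps n B (λ l → Eℓ l * Ψ ((x , y) ∷ l))
  G x y = ps n B (λ l → Zℓ l * Ψ ((x , y) ∷ l))
  Q : ℤ
  Q = SZ B (λ x → ps n B (λ l → Eℓ l * Ψ ((x , 0ℤ) ∷ l)))
  lem₁ : ∀ i E e Z p → (i * E + e * Z) * p ≡ i * (E * p) + e * (Z * p)
  lem₁ = solve-∀
  lem₂ : ∀ q n → q + n * q ≡ (+ 1 + n) * q
  lem₂ = solve-∀
  SZ-isZero : ∀ (f : ℤ → ℤ) → SZ B (λ y → isZero y * f y) ≡ f 0ℤ
  SZ-isZero f = trans (cong₂ _+_ (ℤₚ.*-identityˡ (f 0ℤ)) (Σ-zero B λ _ _ → refl)) (ℤₚ.+-identityʳ (f 0ℤ))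
  rest : ∀ n Ψ → (∀ {l k} → l ↭ k → Ψ l ≡ Ψ k) → SZ B (λ x → SZ B (λ y → ε x y * ps n B (λ l → Zℓ l * Ψ ((x , y) ∷ l)))) ≡
    + n * SZ B (λ x → ps n B (λ l → Eℓ l * Ψ ((x , 0ℤ) ∷ l)))
  rest zero    Ψ inv = SZ-zero B λ x → SZ-zero B λ y → ℤₚ.*-zeroʳ (ε x y)
  rest (suc n) Ψ inv = begin
    SZ B (λ x → SZ B (λ y → ε x y * ps (suc n) B (λ l → Zℓ l * Ψ ((x , y) ∷ l))))
      ≡⟨ SZ-cong B (λ x → SZ-cong B λ y → trans (cong (ε x y *_) (ps-Zℓ n B (λ l → Ψ ((x , y) ∷ l)) (λ e → inv (↭.prep (x , y) e))))
           (lem₃ (ε x y) (+ suc n) (SZ B (λ x′ → ps n B (λ l → Eℓ l * Ψ ((x , y) ∷ (x′ , 0ℤ) ∷ l)))))) ⟩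
    SZ B (λ x → SZ B (λ y → + suc n * (ε x y * SZ B (λ x′ → H x y x′))))
      ≡⟨ trans (SZ-cong B λ x → SZ-*ˡ B (+ suc n) (λ y → ε x y * SZ B (λ x′ → H x y x′))) (SZ-*ˡ B (+ suc n) (λ x → SZ B (λ y → ε x y * SZ B (λ x′ → H x y x′)))) ⟩
    + suc n * SZ B (λ x → SZ B (λ y → ε x y * SZ B (λ x′ → H x y x′)))
      ≡⟨ cong (+ suc n *_) (SZ-cong B λ x → trans (SZ-cong B λ y → trans (sym (SZ-*ˡ B (ε x y) (λ x′ → H x y x′))) (SZ-cong B λ x′ → trans (sym (ps-*ˡ n B (ε x y) (λ l → Eℓ l * Ψ ((x , y) ∷ (x′ , 0ℤ) ∷ l))))
           (ps-cong n B λ l → trans (sym (ℤₚ.*-assoc (ε x y) (Eℓ l) (Ψ ((x , y) ∷ (x′ , 0ℤ) ∷ l)))) (cong (ε x y * Eℓ l *_) (inv (↭.swap (x , y) (x′ , 0ℤ) ↭.refl))))))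
           (SZ-swap B B (λ y x′ → ps n B (λ l → ε x y * Eℓ l * Ψ ((x′ , 0ℤ) ∷ (x , y) ∷ l))))) ⟩
    + suc n * SZ B (λ x → SZ B (λ x′ → SZ B (λ y → ps n B (λ l → ε x y * Eℓ l * Ψ ((x′ , 0ℤ) ∷ (x , y) ∷ l)))))
      ≡⟨ cong (+ suc n *_) (SZ-swap B B (λ x x′ → SZ B (λ y → ps n B (λ l → ε x y * Eℓ l * Ψ ((x′ , 0ℤ) ∷ (x , y) ∷ l))))) ⟩
    + suc n * SZ B (λ x′ → ps (suc n) B (λ l → Eℓ l * Ψ ((x′ , 0ℤ) ∷ l))) ∎
    where
    H : ℤ → ℤ → ℤ → ℤ
    H x y x′ = ps n B (λ l → Eℓ l * Ψ ((x , y) ∷ (x′ , 0ℤ) ∷ l))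
    lem₃ : ∀ a b c → a * (b * c) ≡ b * (a * c)
    lem₃ = solve-∀

module ZeroSum (B : ℕ) (M : ℤ) (M≤B : ∣ M ∣ ≤ B) where

  -- The term whose zero sits in the last coordinate, the one with the dependent entry of k. That
  -- entry then drops out of the exponent.
  core : Pairs → ℤ
  core l = Eℓ l * (δ (dotℓ l) M * vdmL (0ℤ ∷ ys l))

  coreSum : ℕ → ℤ
  coreSum n = ps n B core

  -- The part of the summand that involves the last coordinate, with rₘ = y and kₘ = -Σ kⱼ; the ε
  -- factors of the other coordinates are kept apart.
  slice : Pairs → ℤ → ℤ
  slice l y = ε (- sumℓ l) y * (δ ((+ 2 * - sumℓ l - 1ℤ) * y + dotℓ l) M * vdmL (y ∷ ys l))

  Φ : Pairs → ℤ
  Φ l = SZ B (slice l)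

  Φ-↭ : ∀ {l k} → l ↭ k → Φ l ≡ Φ k
  Φ-↭ {l} {k} e = SZ-cong B λ y → cong₂ _*_ (cong (λ s → ε (- s) y) (lsum-↭ proj₁ e))
    (cong₂ _*_ (cong₂ (λ s d → δ ((+ 2 * - s - 1ℤ) * y + d) M) (lsum-↭ proj₁ e) (lsum-↭ exponent e)) (vdmL-↭ (↭.prep y (map⁺ proj₂ e))))

  zeroSum-split : ∀ n → zeroSum n B M ≡ coreSum n + ps n B (λ l → Zℓ l * Φ l)
  zeroSum-split n = begin
    bs n B (λ k → bs (suc n) B (λ r → Z (ext k) r * (δ (dotPart (ext k) r) M * vdm2 r)))
      ≡⟨ bs-cong n B (λ k → trans (bs-∷ʳ n B (λ r → Z (ext k) r * (δ (dotPart (ext k) r) M * vdm2 r))) (bs-cong n B (λ ρ → SZ-cong B (convert k ρ)))) ⟩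
    bs n B (λ k → bs n B (λ ρ → Ω (zipL k ρ)))
      ≡⟨ bs-ps n B Ω ⟩
    ps n B Ω
      ≡⟨ trans (ps-cong n B Ω-split) (ps-+ n B core (λ l → Zℓ l * Φ l)) ⟩
    coreSum n + ps n B (λ l → Zℓ l * Φ l) ∎
    where
    Ω : Pairs → ℤ
    Ω l = SZ B (λ y → (isZero y * Eℓ l + ε (- sumℓ l) y * Zℓ l) * (δ ((+ 2 * - sumℓ l - 1ℤ) * y + dotℓ l) M * vdmL (y ∷ ys l)))
    convert : ∀ (k ρ : Vec ℤ n) y → Z (ext k) (ρ ∷ʳ y) * (δ (dotPart (ext k) (ρ ∷ʳ y)) M * vdm2 (ρ ∷ʳ y)) ≡
      (isZero y * Eℓ (zipL k ρ) + ε (- sumℓ (zipL k ρ)) y * Zℓ (zipL k ρ)) * (δ ((+ 2 * - sumℓ (zipL k ρ) - 1ℤ) * y + dotℓ (zipL k ρ)) M * vdmL (y ∷ ys (zipL k ρ)))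
    convert k ρ y = cong₂ _*_
      (trans (Z-∷ʳ k ρ (- sumV k) y) (cong₂ _+_ (cong (isZero y *_) (E≡Eℓ k ρ)) (cong₂ (λ s z → ε (- s) y * z) (sumV≡sumℓ k ρ) (Z≡Zℓ k ρ))))
      (cong₂ _*_ (cong (λ d → δ d M) (trans (dotPart-∷ʳ k ρ (- sumV k) y) (cong₂ (λ s d → (+ 2 * - s - 1ℤ) * y + d) (sumV≡sumℓ k ρ) (dotPart≡dotℓ k ρ))))
        (trans (vdm2≡vdmL (ρ ∷ʳ y)) (trans (vdmL-↭ (toList-∷ʳ-↭ ρ y)) (cong (λ l → vdmL (y ∷ l)) (toList≡ys k ρ)))))
    Ω-split : ∀ l → Ω l ≡ core l + Zℓ l * Φ l
    Ω-split l = trans (SZ-cong B λ y → lem₁ (isZero y) (Eℓ l) (ε (- sumℓ l) y) (Zℓ l) (R y))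
      (trans (SZ-+ B (λ y → isZero y * (Eℓ l * R y)) (λ y → Zℓ l * (ε (- sumℓ l) y * R y)))
        (cong₂ _+_ (trans (cong₂ _+_ (ℤₚ.*-identityˡ (Eℓ l * R 0ℤ)) (Σ-zero B λ _ _ → refl)) (trans (ℤₚ.+-identityʳ (Eℓ l * R 0ℤ))
            (cong (λ d → Eℓ l * (δ d M * vdmL (0ℤ ∷ ys l))) (trans (cong (_+ dotℓ l) (ℤₚ.*-zeroʳ (+ 2 * - sumℓ l - 1ℤ))) (ℤₚ.+-identityˡ (dotℓ l))))))
          (SZ-*ˡ B (Zℓ l) (λ y → ε (- sumℓ l) y * R y))))
      where
      R : ℤ → ℤ
      R y = δ ((+ 2 * - sumℓ l - 1ℤ) * y + dotℓ l) M * vdmL (y ∷ ys l)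
      lem₁ : ∀ i E e Z R → (i * E + e * Z) * R ≡ i * (E * R) + Z * (e * R)
      lem₁ = solve-∀

  -- When no rⱼ is 0 the exponent also bounds the entries of k, hence the dependent one.
  Eℓ-bound : ∀ l → ListAll.All (0ℤ ≢_) (ys l) → Eℓ l ≡ 0ℤ ⊎ (Σ[ d ∈ ℕ ] dotℓ l ≡ + d × ∣ sumℓ l ∣ ≤ d)
  Eℓ-bound []            _ = inj₂ (0 , refl , z≤n)
  Eℓ-bound ((x , y) ∷ l) (y≢0 ListAll.∷ all) with ε-bound x y | Eℓ-bound l all
  ... | inj₁ z | _      = inj₁ (cong (_* Eℓ l) z)
  ... | inj₂ _ | inj₁ z = inj₁ (trans (cong (ε x y *_) z) (ℤₚ.*-zeroʳ (ε x y)))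
  ... | inj₂ (e , eq , _ , le) | inj₂ (d , eq′ , le′) = inj₂ (e ℕ.+ d , cong₂ _+_ eq eq′ ,
    ℕₚ.≤-trans (ℤₚ.∣i+j∣≤∣i∣+∣j∣ x (sumℓ l)) (ℕₚ.+-mono-≤ (le λ y≡0 → y≢0 (sym y≡0)) le′))

  -- The free summation variable and the dependent one change places.
  exchange : ∀ l y → Eℓ l * SZ B (λ x → slice ((x , 0ℤ) ∷ l) y) ≡ Eℓ l * SZ B (λ x → ε x y * (δ (exponent (x , y) + dotℓ l) M * vdmL (y ∷ 0ℤ ∷ ys l)))
  exchange l y with unique-or-zero (y ∷ 0ℤ ∷ ys l)
  ... | inj₂ z = cong (Eℓ l *_) (trans (SZ-zero B λ x → trans (cong (λ v → ε (- (x + sumℓ l)) y * (δ ((+ 2 * - (x + sumℓ l) - 1ℤ) * y + (exponent (x , 0ℤ) + dotℓ l)) M * v)) z)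
          (absorb (ε (- (x + sumℓ l)) y) (δ ((+ 2 * - (x + sumℓ l) - 1ℤ) * y + (exponent (x , 0ℤ) + dotℓ l)) M)))
        (sym (SZ-zero B λ x → trans (cong (λ v → ε x y * (δ (exponent (x , y) + dotℓ l) M * v)) z) (absorb (ε x y) (δ (exponent (x , y) + dotℓ l) M)))))
    where
    absorb : ∀ a b → a * (b * + 0) ≡ + 0
    absorb = solve-∀
  ... | inj₁ ((y≢0 ListAll.∷ _) AllPairs.∷ (all AllPairs.∷ _)) with Eℓ-bound l all
  ...   | inj₁ z = trans (cong (_* SZ B (λ x → slice ((x , 0ℤ) ∷ l) y)) z) (sym (cong (_* SZ B (λ x → ε x y * (δ (exponent (x , y) + dotℓ l) M * vdmL (y ∷ 0ℤ ∷ ys l)))) z))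
  ...   | inj₂ (d , eq , le) = cong (Eℓ l *_) (trans (SZ-cong B λ x → cong (λ c → ε (- (x + sumℓ l)) y * (δ ((+ 2 * - (x + sumℓ l) - 1ℤ) * y + c) M * vdmL (y ∷ 0ℤ ∷ ys l)))
          (trans (cong (_+ dotℓ l) (ℤₚ.*-zeroʳ (+ 2 * x - 1ℤ))) (ℤₚ.+-identityˡ (dotℓ l)))) (SZ-reflect B g (sumℓ l) bounded))
    where
    g : ℤ → ℤ
    g x = ε x y * (δ (exponent (x , y) + dotℓ l) M * vdmL (y ∷ 0ℤ ∷ ys l))
    -- The new variable is -(x + Σ kⱼ). For a nonzero term |x| and |Σ kⱼ| are bounded by two parts e
    -- and d of the exponent, and e + d = M.
    bounded : ∀ x → ∣ x ∣ ℕ.+ ∣ sumℓ l ∣ ≤ B ⊎ g x ≡ 0ℤ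
    bounded x with ε-bound x y | δ-dec (exponent (x , y) + dotℓ l) M
    ... | inj₁ z | _ = inj₂ (cong (_* (δ (exponent (x , y) + dotℓ l) M * vdmL (y ∷ 0ℤ ∷ ys l))) z)
    ... | inj₂ _ | inj₂ z = inj₂ (trans (cong (λ c → ε x y * (c * vdmL (y ∷ 0ℤ ∷ ys l))) z) (ℤₚ.*-zeroʳ (ε x y)))
    ... | inj₂ (e , eq′ , _ , le′) | inj₁ total = inj₁ (ℕₚ.≤-trans (ℕₚ.+-mono-≤ (le′ y≢0) le)
      (ℕₚ.≤-trans (ℕₚ.≤-reflexive (cong ∣_∣ {+ e + + d} (trans (sym (cong₂ _+_ eq′ eq)) total))) M≤B))

  zeroSum-Zℓ : ∀ n → ps n B (λ l → Zℓ l * Φ l) ≡ + n * coreSum n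
  zeroSum-Zℓ zero    = refl
  zeroSum-Zℓ (suc n) = trans (ps-Zℓ n B Φ Φ-↭) (cong (+ suc n *_) (begin
    SZ B (λ x → ps n B (λ l → Eℓ l * SZ B (slice ((x , 0ℤ) ∷ l))))
      ≡⟨ sym (ps-SZ n B (λ l x → Eℓ l * SZ B (slice ((x , 0ℤ) ∷ l)))) ⟩
    ps n B (λ l → SZ B (λ x → Eℓ l * SZ B (slice ((x , 0ℤ) ∷ l))))
      ≡⟨ ps-cong n B (λ l → trans (SZ-*ˡ B (Eℓ l) (λ x → SZ B (slice ((x , 0ℤ) ∷ l)))) (trans (cong (Eℓ l *_) (SZ-swap B B (λ x y → slice ((x , 0ℤ) ∷ l) y)))
           (sym (SZ-*ˡ B (Eℓ l) (λ y → SZ B (λ x → slice ((x , 0ℤ) ∷ l) y)))))) ⟩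
    ps n B (λ l → SZ B (λ y → Eℓ l * SZ B (λ x → slice ((x , 0ℤ) ∷ l) y)))
      ≡⟨ ps-cong n B (λ l → SZ-cong B λ y → trans (exchange l y) (trans (sym (SZ-*ˡ B (Eℓ l) (λ x → ε x y * (δ (exponent (x , y) + dotℓ l) M * vdmL (y ∷ 0ℤ ∷ ys l)))))
           (SZ-cong B λ x → trans (lem (Eℓ l) (ε x y) (δ (exponent (x , y) + dotℓ l) M * vdmL (y ∷ 0ℤ ∷ ys l)))
             (cong (λ v → ε x y * Eℓ l * (δ (exponent (x , y) + dotℓ l) M * v)) (vdmL-↭ {y ∷ 0ℤ ∷ ys l} {0ℤ ∷ y ∷ ys l} (↭.swap y 0ℤ ↭.refl)))))) ⟩
    ps n B (λ l → SZ B (λ y → SZ B (λ x → core ((x , y) ∷ l))))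
      ≡⟨ ps-SZ n B (λ l y → SZ B (λ x → core ((x , y) ∷ l))) ⟩
    SZ B (λ y → ps n B (λ l → SZ B (λ x → core ((x , y) ∷ l))))
      ≡⟨ SZ-cong B (λ y → ps-SZ n B (λ l x → core ((x , y) ∷ l))) ⟩
    SZ B (λ y → SZ B (λ x → ps n B (λ l → core ((x , y) ∷ l))))
      ≡⟨ SZ-swap B B (λ y x → ps n B (λ l → core ((x , y) ∷ l))) ⟩
    coreSum (suc n) ∎))
    where
    lem : ∀ E e c → E * (e * c) ≡ e * E * c
    lem = solve-∀

  zeroSum≡ : ∀ n → zeroSum n B M ≡ + suc n * coreSum n
  zeroSum≡ n = trans (zeroSum-split n) (trans (coreSum n ⟨+⟩ zeroSum-Zℓ n) (lem (coreSum n) (+ n)))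
    where
    lem : ∀ q n → q + n * q ≡ (+ 1 + n) * q
    lem = solve-∀

-- Summation over k

coeff-below : ∀ g {z B} t → z ℤ.≤ + B → B < t → coeffℤ g (z - + t) ≡ 0ℤ
coeff-below g {z} {B} t z≤B B<t = go (z - + t) (lem z (+ t))
  where
  lem : ∀ z t → z - t + t ≡ z
  lem = solve-∀
  go : ∀ d → d + + t ≡ z → coeffℤ g d ≡ 0ℤ
  go (+ k)    e = ⊥-elim (ℕₚ.<⇒≱ B<t (ℕₚ.≤-trans (ℕₚ.m≤n+m t k) (ℤₚ.drop‿+≤+ (ℤₚ.≤-trans (ℤₚ.≤-reflexive e) z≤B))))
  go -[1+ _ ] e = refl

coeff-cong : ∀ {f g} → f ≈ g → ∀ z → coeffℤ f z ≡ coeffℤ g z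
coeff-cong p (+ n)    = at p n
coeff-cong p -[1+ n ] = refl

coeff-⊞ : ∀ f g z → coeffℤ (f ⊞ g) z ≡ coeffℤ f z + coeffℤ g z
coeff-⊞ f g (+ n)    = refl
coeff-⊞ f g -[1+ n ] = refl

coeff-X : ∀ e g z → coeffℤ (X e · g) z ≡ coeffℤ g (z - + e)
coeff-X e g -[1+ n ] = sym (negative e)
  where
  negative : ∀ e → coeffℤ g (-[1+ n ] - + e) ≡ 0ℤ
  negative zero    = refl
  negative (suc e) = refl
coeff-X e g (+ n) with e ℕ.≤? n
... | yes e≤n = trans (cong (X e · g) (sym (ℕₚ.m+[n∸m]≡n e≤n))) (trans (X-·-at e g (n ∸ e)) (cong (coeffℤ g) (sym (trans (cong (λ m → + m - + e) (sym (ℕₚ.m+[n∸m]≡n e≤n))) ([m+n]-m (+ e) (+ (n ∸ e)))))))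
... | no e≰n  = trans (Ord-·ʳ g (Ord-X e) n (ℕₚ.≰⇒> e≰n)) (sym (coeff-below g {+ n} {n} e ℤₚ.≤-refl (ℕₚ.≰⇒> e≰n)))

-- Unfolds g = 1 + q^(e+1) g exactly k times and keeps the remainder, which vanishes once its degree
-- is negative.
coeff-geo : ∀ e f z k → coeffℤ (geo (suc e) · f) z ≡ Σ k (λ i → coeffℤ f (z - + (i ℕ.* suc e))) + coeffℤ (geo (suc e) · f) (z - + (k ℕ.* suc e))
coeff-geo e f z zero    = trans (cong (coeffℤ (geo (suc e) · f)) (sym (ℤₚ.+-identityʳ z))) (sym (ℤₚ.+-identityˡ _))
coeff-geo e f z (suc k) = begin
  coeffℤ (g · f) z
    ≡⟨ coeff-geo e f z k ⟩
  Σ k F + coeffℤ (g · f) zₖ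
    ≡⟨ Σ k F ⟨+⟩ trans (coeff-cong unfold zₖ) (trans (coeff-⊞ f (X (suc e) · (g · f)) zₖ) (coeffℤ f zₖ ⟨+⟩ trans (coeff-X (suc e) (g · f) zₖ)
         (cong (coeffℤ (g · f)) (lem z (+ (k ℕ.* suc e)) (+ suc e))))) ⟩
  Σ k F + (coeffℤ f zₖ + coeffℤ (g · f) (z - + (suc k ℕ.* suc e)))
    ≡⟨ sym (ℤₚ.+-assoc (Σ k F) (coeffℤ f zₖ) (coeffℤ (g · f) (z - + (suc k ℕ.* suc e)))) ⟩
  Σ k F + coeffℤ f zₖ + coeffℤ (g · f) (z - + (suc k ℕ.* suc e))
    ≡⟨ cong (_+ coeffℤ (g · f) (z - + (suc k ℕ.* suc e))) (sym (Σ-last k F)) ⟩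
  Σ (suc k) F + coeffℤ (g · f) (z - + (suc k ℕ.* suc e)) ∎
  where
  g = geo (suc e)
  zₖ = z - + (k ℕ.* suc e)
  F : ℕ → ℤ
  F i = coeffℤ f (z - + (i ℕ.* suc e))
  unfold : g · f ≈ f ⊞ X (suc e) · (g · f)
  unfold = ≈-trans (·-cong (geo-unfold e) (≈-refl {f})) (solveˢ 3 (λ x g f → (con 1ℤ :+ x :* g) :* f := f :+ x :* (g :* f)) ≈-refl (X (suc e)) g f)
  lem : ∀ z a b → z - a - b ≡ z - (b + a)
  lem = solve-∀

coeff-w : ∀ a f z k → coeffℤ (geo (suc a ℕ.+ suc a) · f) (z - + suc a - + (k ℕ.* (suc a ℕ.+ suc a))) ≡ 0ℤ →
  coeffℤ (w (suc a) · f) z ≡ Σ k (λ i → coeffℤ f (z - + ((i ℕ.+ i ℕ.+ 1) ℕ.* suc a)))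
coeff-w a f z k rest = begin
  coeffℤ ((X (suc a) · g) · f) z
    ≡⟨ trans (coeff-cong (·-assoc (X (suc a)) g f) z) (coeff-X (suc a) (g · f) z) ⟩
  coeffℤ (g · f) (z - + suc a)
    ≡⟨ coeff-geo (a ℕ.+ suc a) f (z - + suc a) k ⟩
  Σ k (λ i → coeffℤ f (z - + suc a - + (i ℕ.* (suc a ℕ.+ suc a)))) + coeffℤ (g · f) (z - + suc a - + (k ℕ.* (suc a ℕ.+ suc a)))
    ≡⟨ trans (Σ k (λ i → coeffℤ f (z - + suc a - + (i ℕ.* (suc a ℕ.+ suc a)))) ⟨+⟩ rest) (ℤₚ.+-identityʳ _) ⟩
  Σ k (λ i → coeffℤ f (z - + suc a - + (i ℕ.* (suc a ℕ.+ suc a))))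
    ≡⟨ Σ-cong k (λ i → cong (coeffℤ f) (trans (lem₁ z (+ suc a) (+ (i ℕ.* (suc a ℕ.+ suc a)))) (cong (λ m → z - + m) (lem₂ (suc a) i)))) ⟩
  Σ k (λ i → coeffℤ f (z - + ((i ℕ.+ i ℕ.+ 1) ℕ.* suc a))) ∎
  where
  g = geo (suc a ℕ.+ suc a)
  lem₁ : ∀ z a b → z - a - b ≡ z - (a + b)
  lem₁ = solve-∀
  lem₂ : ∀ a i → a ℕ.+ i ℕ.* (a ℕ.+ a) ≡ (i ℕ.+ i ℕ.+ 1) ℕ.* a
  lem₂ = ℕS.solve-∀

coeff-rest : ∀ a g z B k → z ℤ.≤ + B → B ≤ k → coeffℤ g (z - + suc a - + (k ℕ.* (suc a ℕ.+ suc a))) ≡ 0ℤ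
coeff-rest a g z B k z≤B B≤k = trans (cong (coeffℤ g) (lem z (+ suc a) (+ (k ℕ.* (suc a ℕ.+ suc a))))) (coeff-below g (suc a ℕ.+ k ℕ.* (suc a ℕ.+ suc a)) z≤B
  (s≤s (ℕₚ.≤-trans B≤k (ℕₚ.≤-trans (ℕₚ.m≤m*n k (suc a ℕ.+ suc a)) (ℕₚ.m≤n+m (k ℕ.* (suc a ℕ.+ suc a)) a)))))
  where
  lem : ∀ z a b → z - a - b ≡ z - (a + b)
  lem = solve-∀

-- Up to the common sign of `ŵ y`, the exponents (2x - 1) y with ε ≠ 0 are the odd multiples of |y|.
-- The box stops their series at a point where the degree left for f is already negative, as z ≤ B.
ŵ-coefficient : ∀ B f y z → y ≢ 0ℤ → z ℤ.≤ + B → SZ B (λ x → ε x y * coeffℤ f (z - (+ 2 * x - 1ℤ) * y)) ≡ coeffℤ (ŵ y · f) z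
ŵ-coefficient B f (+ zero)  z y≢0 _   = ⊥-elim (y≢0 refl)
ŵ-coefficient B f (+ suc a) z _ z≤B = trans (ℤₚ.+-identityˡ _) (trans
  (Σ-cong B λ k → trans (ℤₚ.+-identityʳ _) (trans (ℤₚ.*-identityˡ _) (cong (λ t → coeffℤ f (z - t)) (trans (cong (_* + suc a) (lem (+ k))) (sym (ℤₚ.pos-* (k ℕ.+ k ℕ.+ 1) (suc a)))))))
  (sym (coeff-w a f z B (coeff-rest a (geo (suc a ℕ.+ suc a) · f) z B B z≤B ℕₚ.≤-refl))))
  where
  lem : ∀ k → + 2 * (+ 1 + k) - + 1 ≡ k + k + + 1
  lem = solve-∀
ŵ-coefficient B f -[1+ a ] z _ z≤B = begin
  - 1ℤ * coeffℤ f (z - (+ 2 * 0ℤ - 1ℤ) * -[1+ a ]) + Σ B (λ k → 0ℤ + - 1ℤ * coeffℤ f (z - (+ 2 * -[1+ k ] - 1ℤ) * -[1+ a ]))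
    ≡⟨ cong₂ _+_ (cong (λ t → - 1ℤ * coeffℤ f (z - t)) (lem₀ (+ suc a))) (Σ-cong B λ k → trans (ℤₚ.+-identityˡ _)
         (cong (λ t → - 1ℤ * coeffℤ f (z - t)) (trans (lem (+ k) (+ suc a)) (sym (ℤₚ.pos-* (suc k ℕ.+ suc k ℕ.+ 1) (suc a)))))) ⟩
  -- For negative y the value x = 0 counts too, so there are B + 1 terms here against B for positive
  -- y.
  Σ (suc B) (λ i → - 1ℤ * coeffℤ f (z - + ((i ℕ.+ i ℕ.+ 1) ℕ.* suc a)))
    ≡⟨ Σ-*ˡ (suc B) (- 1ℤ) (λ i → coeffℤ f (z - + ((i ℕ.+ i ℕ.+ 1) ℕ.* suc a))) ⟩
  - 1ℤ * Σ (suc B) (λ i → coeffℤ f (z - + ((i ℕ.+ i ℕ.+ 1) ℕ.* suc a)))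
    ≡⟨ cong (- 1ℤ *_) (sym (coeff-w a f z (suc B) (coeff-rest a (geo (suc a ℕ.+ suc a) · f) z B (suc B) z≤B (ℕₚ.n≤1+n B)))) ⟩
  - 1ℤ * coeffℤ (w (suc a) · f) z
    ≡⟨ negate z ⟩
  coeffℤ (⊟ w (suc a) · f) z ∎
  where
  lem₀ : ∀ a → (+ 2 * + 0 - + 1) * - a ≡ + 1 * a
  lem₀ = solve-∀
  lem : ∀ k a → (+ 2 * - (+ 1 + k) - + 1) * - a ≡ ((+ 1 + k) + (+ 1 + k) + + 1) * a
  lem = solve-∀
  negate : ∀ z → - 1ℤ * coeffℤ (w (suc a) · f) z ≡ coeffℤ (⊟ w (suc a) · f) z
  negate (+ n)    = trans (ℤₚ.-1*i≡-i ((w (suc a) · f) n)) (at (solveˢ 2 (λ w f → :- (w :* f) := (:- w) :* f) ≈-refl (w (suc a)) f) n)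
  negate -[1+ n ] = refl

-- The first coordinate is split off and lowers the degree by τ. Where ε ≠ 0, τ is a natural number,
-- so z - τ ≤ B again; it may be negative, hence integer degrees.
E-coefficient : ∀ {n} B (ρ : Vec ℤ n) → All (_≢ 0ℤ) ρ → ∀ z → z ℤ.≤ + B → bs n B (λ k → E k ρ * δ (dotPart k ρ) z) ≡ coeffℤ (W ρ) z
E-coefficient B [] [] (+ zero)  _ = refl
E-coefficient B [] [] (+ suc n) _ = refl
E-coefficient B [] [] -[1+ n ]  _ = refl
E-coefficient {suc n} B (y ∷ ρ) (y≢0 ∷ all) z z≤B = trans (SZ-cong B step) (ŵ-coefficient B (W ρ) y z y≢0 z≤B)
  where
  step : ∀ x → bs n B (λ k → ε x y * E k ρ * δ ((+ 2 * x - 1ℤ) * y + dotPart k ρ) z) ≡ ε x y * coeffℤ (W ρ) (z - (+ 2 * x - 1ℤ) * y)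
  step x = trans (bs-cong n B λ k → trans (ℤₚ.*-assoc (ε x y) (E k ρ) (δ ((+ 2 * x - 1ℤ) * y + dotPart k ρ) z)) (cong (λ d → ε x y * (E k ρ * d)) (move k)))
    (trans (bs-*ˡ n B (ε x y) (λ k → E k ρ * δ (dotPart k ρ) (z - τ))) (evaluate (ε-bound x y)))
    where
    τ = (+ 2 * x - 1ℤ) * y
    lem₁ : ∀ a b → b + a + - b ≡ a
    lem₁ = solve-∀
    move : ∀ k → δ (τ + dotPart k ρ) z ≡ δ (dotPart k ρ) (z - τ)
    move k = trans (sym (δ-+ (τ + dotPart k ρ) z (- τ))) (cong (λ d → δ d (z - τ)) (lem₁ (dotPart k ρ) τ))
    evaluate : ε x y ≡ 0ℤ ⊎ (Σ[ e ∈ ℕ ] τ ≡ + e × ∣ y ∣ ≤ e × (y ≢ 0ℤ → ∣ x ∣ ≤ e)) → ε x y * bs n B (λ k → E k ρ * δ (dotPart k ρ) (z - τ)) ≡ ε x y * coeffℤ (W ρ) (z - τ)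
    evaluate (inj₁ zero-ε) = trans (cong (_* bs n B (λ k → E k ρ * δ (dotPart k ρ) (z - τ))) zero-ε) (sym (cong (_* coeffℤ (W ρ) (z - τ)) zero-ε))
    evaluate (inj₂ (e , eq , _)) = cong (ε x y *_) (E-coefficient B ρ all (z - τ) (ℤₚ.≤-trans (ℤₚ.≤-reflexive (cong (λ u → z - u) eq)) (ℤₚ.≤-trans (ℤₚ.i-j≤i z (+ e)) z≤B)))

nonzero-or-vanishing : ∀ {n} (ρ : Vec ℤ n) → All (_≢ 0ℤ) ρ ⊎ vdm2 (0ℤ ∷ ρ) ≡ 0ℤ
nonzero-or-vanishing ρ with unique-or-zero (0ℤ ∷ toList ρ)
... | inj₂ z = inj₂ (trans (vdm2≡vdmL (0ℤ ∷ ρ)) z)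
... | inj₁ (all AllPairs.∷ _) = inj₁ (fromList ρ all)
  where
  fromList : ∀ {n} (ρ : Vec ℤ n) → ListAll.All (0ℤ ≢_) (toList ρ) → All (_≢ 0ℤ) ρ
  fromList []      ListAll.[]          = []
  fromList (y ∷ ρ) (p ListAll.∷ all)  = (λ e → p (sym e)) ∷ fromList ρ all

-- With r fixed the sum over k is a product of geometric series provided r has no zero entry; the
-- remaining r are killed by Δ(0, r).
coreSum≡ : ∀ n B M (M≤B : ∣ M ∣ ≤ B) → ZeroSum.coreSum B M M≤B n ≡ coeffℤ (vandermondeSum n) M
coreSum≡ n B M M≤B = begin
  ps n B core
    ≡⟨ sym (bs-ps n B core) ⟩
  bs n B (λ k → bs n B (λ ρ → core (zipL k ρ)))
    ≡⟨ bs-swap n n B B (λ k ρ → core (zipL k ρ)) ⟩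
  bs n B (λ ρ → bs n B (λ k → core (zipL k ρ)))
    ≡⟨ bs-cong n B (λ ρ → trans (bs-cong n B λ k → back k ρ) (trans (bs-*ˡ n B (vdm2 (0ℤ ∷ ρ)) (λ k → E k ρ * δ (dotPart k ρ) M)) (evaluate ρ (nonzero-or-vanishing ρ)))) ⟩
  bs n B (λ ρ → vdm2 (0ℤ ∷ ρ) * coeffℤ (W ρ) M)
    ≡⟨ collapse M M≤B ⟩
  coeffℤ (vandermondeSum n) M ∎
  where
  open ZeroSum B M M≤B
  lem : ∀ e d v → e * (d * v) ≡ v * (e * d)
  lem = solve-∀
  back : ∀ k ρ → core (zipL k ρ) ≡ vdm2 (0ℤ ∷ ρ) * (E k ρ * δ (dotPart k ρ) M)
  back k ρ = trans (cong₂ (λ e c → e * c) (sym (E≡Eℓ k ρ)) (cong₂ (λ d v → δ d M * v) (sym (dotPart≡dotℓ k ρ)) (sym (trans (vdm2≡vdmL (0ℤ ∷ ρ)) (cong (λ l → vdmL (0ℤ ∷ l)) (toList≡ys k ρ))))))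
    (lem (E k ρ) (δ (dotPart k ρ) M) (vdm2 (0ℤ ∷ ρ)))
  bounded : ∀ M → ∣ M ∣ ≤ B → M ℤ.≤ + B
  bounded (+ k)    le = ℤ.+≤+ le
  bounded -[1+ k ] le = ℤ.-≤+
  evaluate : ∀ ρ → All (_≢ 0ℤ) ρ ⊎ vdm2 (0ℤ ∷ ρ) ≡ 0ℤ → vdm2 (0ℤ ∷ ρ) * bs n B (λ k → E k ρ * δ (dotPart k ρ) M) ≡ vdm2 (0ℤ ∷ ρ) * coeffℤ (W ρ) M
  evaluate ρ (inj₁ all) = cong (vdm2 (0ℤ ∷ ρ) *_) (E-coefficient B ρ all M (bounded M M≤B))
  evaluate ρ (inj₂ z)   = trans (cong (_* bs n B (λ k → E k ρ * δ (dotPart k ρ) M)) z) (sym (cong (_* coeffℤ (W ρ) M) z))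
  collapse : ∀ M → ∣ M ∣ ≤ B → bs n B (λ ρ → vdm2 (0ℤ ∷ ρ) * coeffℤ (W ρ) M) ≡ coeffℤ (vandermondeSum n) M
  collapse (+ k)    k≤B = Tn-at n (λ ρ → vdm2 (0ℤ ∷ ρ)) k≤B
  collapse -[1+ k ] _   = bs-zero n B λ ρ → ℤₚ.*-zeroʳ (vdm2 (0ℤ ∷ ρ))

rhs-value : ∀ n N B → ∣ N - + suc n + offset n ∣ < B → ∣ N + offset n ∣ ≤ B →
  rhsCoeffTrunc (suc n) B N ≡ - (+ suc n * coeffℤ (vandermondeSum n) (N + offset n))
rhs-value n N B lt le = trans (rhs-zeroSum n B N lt) (cong -_ (trans (ZeroSum.zeroSum≡ B (N + offset n) le n) (cong (+ suc n *_) (coreSum≡ n B (N + offset n) le))))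

-- The constants, and the conclusion for m = 2s + 1

≡ᵇ-cong : ∀ {a b c d} → (a ≡ b → c ≡ d) → (c ≡ d → a ≡ b) → (a ℕ.≡ᵇ b) ≡ (c ℕ.≡ᵇ d)
≡ᵇ-cong {a} {b} {c} {d} f g with a ℕ.≡ᵇ b in e | c ℕ.≡ᵇ d in e′
... | true  | true  = refl
... | false | false = refl
... | true  | false = ⊥-elim (subst Data.Bool.T e′ (ℕₚ.≡⇒≡ᵇ c d (f (ℕₚ.≡ᵇ⇒≡ a b (subst Data.Bool.T (sym e) tt)))))
... | false | true  = ⊥-elim (subst Data.Bool.T e (ℕₚ.≡⇒≡ᵇ a b (g (ℕₚ.≡ᵇ⇒≡ c d (subst Data.Bool.T (sym e′) tt)))))

triangle≈△ : triangle ≈ △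
triangle≈△ = pw λ N → trans (sumℤ-upTo (suc N) (λ n → if (n ℕ.* suc n) ℕ.≡ᵇ (2 ℕ.* N) then 1ℤ else 0ℤ))
  (Σ-cong (suc N) λ n → cong indicator (≡ᵇ-cong {n ℕ.* suc n} {2 ℕ.* N} {T n} {N}
    (λ e → ℕₚ.*-cancelˡ-≡ (T n) N 2 (trans (double n) e)) (λ e → trans (sym (double n)) (cong (2 ℕ.*_) e))))
  where
  double : ∀ n → 2 ℕ.* T n ≡ n ℕ.* suc n
  double zero    = refl
  double (suc n) = trans (ℕₚ.*-distribˡ-+ 2 (suc n) (T n)) (trans (cong (2 ℕ.* suc n ℕ.+_) (double n)) (lem n))
    where
    lem : ∀ n → 2 ℕ.* suc n ℕ.+ n ℕ.* suc n ≡ suc n ℕ.* suc (suc n)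
    lem = ℕS.solve-∀

^ˢ≈pow : ∀ k → triangle ^ˢ k ≈ pow △ k
^ˢ≈pow zero    = one≈ι
^ˢ≈pow (suc k) = ≈-trans (⊛≈· triangle (triangle ^ˢ k)) (·-cong triangle≈△ (^ˢ≈pow k))

sgn-+ : ∀ a b → sgn (a ℕ.+ b) ≡ sgn a * sgn b
sgn-+ zero    b = sym (ℤₚ.*-identityˡ (sgn b))
sgn-+ (suc a) b = trans (cong -_ (sgn-+ a b)) (ℤₚ.neg-distribˡ-* (sgn a) (sgn b))

sgn-square : ∀ a → sgn a * sgn a ≡ 1ℤ
sgn-square a = trans (sym (sgn-+ a a)) (sgn-even a)

module Odd (s : ℕ) where
  n m j : ℕ
  n = s ℕ.+ s
  m = suc n
  j = s ℕ.* suc s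

  offset-value : offset n ≡ + j
  offset-value = cong +_ (trans (cong (λ k → (k ∸ 1) ℕ./ 4) (lem s)) (DivMod.m*n/n≡m j 4))
    where
    lem : ∀ s → suc (s ℕ.+ s) ℕ.* suc (s ℕ.+ s) ≡ suc (s ℕ.* suc s ℕ.* 4)
    lem = ℕS.solve-∀

  exponent-value : 2 ℕ.* m ℕ.* m ∸ 2 ≡ j ℕ.* 8
  exponent-value = cong (_∸ 2) (lem s)
    where
    lem : ∀ s → 2 ℕ.* suc (s ℕ.+ s) ℕ.* suc (s ℕ.+ s) ≡ 2 ℕ.+ s ℕ.* suc s ℕ.* 8
    lem = ℕS.solve-∀

  -- m (m + 1) / 2 = (2s + 1)(s + 1) = 2 s (s + 1) + s + 1.
  sign-value : sgn ((m ℕ.* suc m) ℕ./ 2) ≡ - sgn s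
  sign-value = begin
    sgn ((m ℕ.* suc m) ℕ./ 2)          ≡⟨ cong (λ k → sgn (k ℕ./ 2)) (lem s) ⟩
    sgn ((j ℕ.+ j ℕ.+ suc s) ℕ.* 2 ℕ./ 2) ≡⟨ cong sgn (DivMod.m*n/n≡m (j ℕ.+ j ℕ.+ suc s) 2) ⟩
    sgn (j ℕ.+ j ℕ.+ suc s)            ≡⟨ trans (sgn-+ (j ℕ.+ j) (suc s)) (cong (_* sgn (suc s)) (sgn-even j)) ⟩
    1ℤ * - sgn s                       ≡⟨ ℤₚ.*-identityˡ (- sgn s) ⟩
    - sgn s                            ∎
    where
    lem : ∀ s → suc (s ℕ.+ s) ℕ.* suc (suc (s ℕ.+ s)) ≡ (s ℕ.* suc s ℕ.+ s ℕ.* suc s ℕ.+ suc s) ℕ.* 2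
    lem = ℕS.solve-∀

  coeff-• : ∀ c f z → coeffℤ (c • f) z ≡ c * coeffℤ f z
  coeff-• c f (+ k)    = refl
  coeff-• c f -[1+ k ] = sym (ℤₚ.*-zeroʳ c)

  sum-coefficient : ∀ N → coeffℤ (vandermondeSum n) (N + offset n) ≡
    + (n !) * (square (+ prodFact m) * sgn s) * coeffℤ (triangle ^ˢ (2 ℕ.* m ℕ.* m ∸ 2)) N
  sum-coefficient N = begin
    coeffℤ (vandermondeSum n) (N + offset n)
      ≡⟨ cong (λ o → coeffℤ (vandermondeSum n) (N + o)) offset-value ⟩
    coeffℤ (vandermondeSum n) (N + + j)
      ≡⟨ trans (coeff-cong (Leading.vandermondeSum-value s) (N + + j)) (coeff-• c (X j · pow △ (j ℕ.* 8)) (N + + j)) ⟩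
    c * coeffℤ (X j · pow △ (j ℕ.* 8)) (N + + j)
      ≡⟨ cong (c *_) (trans (coeff-X j (pow △ (j ℕ.* 8)) (N + + j)) (cong (coeffℤ (pow △ (j ℕ.* 8))) (lem N (+ j)))) ⟩
    c * coeffℤ (pow △ (j ℕ.* 8)) N
      ≡⟨ cong (c *_) (sym (trans (cong (λ k → coeffℤ (triangle ^ˢ k) N) exponent-value) (coeff-cong (^ˢ≈pow (j ℕ.* 8)) N))) ⟩
    c * coeffℤ (triangle ^ˢ (2 ℕ.* m ℕ.* m ∸ 2)) N ∎
    where
    c = + (n !) * (square (+ prodFact m) * sgn s)
    lem : ∀ N j → N + j - j ≡ N
    lem = solve-∀

  identity : ∀ N → ∃ λ B₀ → ∀ B → B₀ ≤ B →
    + (m ! ℕ.* (prodFact m ℕ.* prodFact m)) * coeffℤ (triangle ^ˢ (2 ℕ.* m ℕ.* m ∸ 2)) N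
      ≡ minusOnePow ((m ℕ.* suc m) ℕ./ 2) * rhsCoeffTrunc m B N
  -- The sum of the two absolute values plus 1 satisfies both bounds of `rhs-value`: the strict one
  -- for translating r and the weak one for reflecting and summing k.
  identity N = suc (∣ N - + m + offset n ∣ ℕ.+ ∣ N + offset n ∣) , λ B le → begin
    + (m ! ℕ.* (p ℕ.* p)) * a
      ≡⟨ cong (_* a) (trans (ℤₚ.pos-* (m !) (p ℕ.* p)) (cong₂ _*_ (ℤₚ.pos-* m (n !)) (ℤₚ.pos-* p p))) ⟩
    + m * + (n !) * (+ p * + p) * a
      ≡⟨ lem₁ (+ m) (+ (n !)) (+ p) a ⟩
    1ℤ * (+ m * + (n !) * (+ p * + p) * a)
      -- One (-1)^s belongs to the prefactor and the other to the leading coefficient of I; the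
      -- remaining minus sign of the prefactor meets the one in -m I.
      ≡⟨ cong (_* (+ m * + (n !) * (+ p * + p) * a)) (sym (sgn-square s)) ⟩
    sgn s * sgn s * (+ m * + (n !) * (+ p * + p) * a)
      ≡⟨ lem₂ (sgn s) (+ m) (+ (n !)) (+ p) a ⟩
    - sgn s * - (+ m * (+ (n !) * (square (+ p) * sgn s) * a))
      ≡⟨ cong₂ (λ u v → u * - (+ m * v)) (sym sign-value) (sym (sum-coefficient N)) ⟩
    sgn ((m ℕ.* suc m) ℕ./ 2) * - (+ m * coeffℤ (vandermondeSum n) (N + offset n))
      ≡⟨ cong (sgn ((m ℕ.* suc m) ℕ./ 2) *_) (sym (rhs-value n N B
           (ℕₚ.≤-trans (s≤s (ℕₚ.m≤m+n ∣ N - + m + offset n ∣ ∣ N + offset n ∣)) le)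
           (ℕₚ.≤-trans (ℕₚ.m≤n+m ∣ N + offset n ∣ (suc ∣ N - + m + offset n ∣)) le))) ⟩
    minusOnePow ((m ℕ.* suc m) ℕ./ 2) * rhsCoeffTrunc m B N ∎
    where
    p = prodFact m
    a = coeffℤ (triangle ^ˢ (2 ℕ.* m ℕ.* m ∸ 2)) N
    lem₁ : ∀ m f p a → m * f * (p * p) * a ≡ + 1 * (m * f * (p * p) * a)
    lem₁ = solve-∀
    lem₂ : ∀ s m f p a → s * s * (m * f * (p * p) * a) ≡ - s * - (m * (f * (p * p * s) * a))
    lem₂ = solve-∀

theorem5p5 : (m : ℕ) → 1 < m → m % 2 ≡ 1 →
    (N : ℤ) → ∃ λ B₀ → (B : ℕ) → B₀ ≤ B →
    + (m ! ℕ.* (prodFact m ℕ.* prodFact m)) * coeffℤ (triangle ^ˢ (2 ℕ.* m ℕ.* m ℕ.∸ 2)) N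
    ≡ minusOnePow ((m ℕ.* ℕ.suc m) ℕ./ 2) * rhsCoeffTrunc m B N
theorem5p5 m _ odd-m = subst (λ k → (N : ℤ) → ∃ λ B₀ → (B : ℕ) → B₀ ≤ B →
    + (k ! ℕ.* (prodFact k ℕ.* prodFact k)) * coeffℤ (triangle ^ˢ (2 ℕ.* k ℕ.* k ℕ.∸ 2)) N
    ≡ minusOnePow ((k ℕ.* ℕ.suc k) ℕ./ 2) * rhsCoeffTrunc k B N) (sym m≡) (Odd.identity (m ℕ./ 2))
  where
  lem : ∀ s → 1 ℕ.+ s ℕ.* 2 ≡ suc (s ℕ.+ s)
  lem = ℕS.solve-∀
  m≡ : m ≡ suc (m ℕ./ 2 ℕ.+ m ℕ./ 2)
  m≡ = trans (DivMod.m≡m%n+[m/n]*n m 2) (trans (cong (ℕ._+ m ℕ./ 2 ℕ.* 2) odd-m) (lem (m ℕ./ 2)))
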